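{- Let $P \subseteq \mathbb{Z}^2\setminus\{(0,0)\}$ be a finite set. The following two statements are equivalent. (1) There exists a $P$-primal non-uniform grid that admits a crossing gate; that is, there exist $\ell,\ell'\ge 1$ and an assignment to each cell $v\in V=\{1,\dots,\ell\}\times\{1,\dots,\ell'\}$ of a neighborhood $N_v\subseteq P$ with $|N_v|=1$, such that some configuration on the resulting grid is a crossing gate. (2) There exists a weighted $P$-grid that admits a crossing gate; that is, there exist $\ell,\ell'\ge 1$ and a finite multiset $N$ of elements of $P$, in which every element of $P$ appears at least once, such that some configuration on the uniform $\ell\times\ell'$ grid with neighborhood $N$ is a crossing gate.
   Context: Sandpile grids. For $\ell,\ell'\ge 1$ let $V=\{1,\dots,\ell\}\times\{1,\dots,\ell'\}$ be the set of cells; the first coordinate increases to the East and the second coordinate increases to the North. The West, East, South and North edges of the grid are the sets of cells with first coordinate $1$, first coordinate $\ell$, second coordinate $1$, second coordinate $\ell'$, respectively; corners are cells lying on two edges of different axes. Each cell $u\in V$ is assigned a neighborhood $N_u$, a finite multiset of elements of $\mathbb{Z}^2\setminus\{(0,0)\}$; $N_u(\delta)$ denotes the multiplicity of $\delta$ in $N_u$, and $|N_u|$ is the total number of elements counted with multiplicity. The grid is uniform (with neighborhood $N$) if $N_u=N$ for all $u\in V$. Dynamics. A configuration is a function $c:V\to\mathbb{N}$ (number of grains in each cell). A cell $u$ is stable in $c$ if $c(u)<|N_u|$ and unstable otherwise; $c$ is stable if all cells are stable. One parallel step is the map $$T(c)(u)=c(u)-|N_u|\,H(c(u)-|N_u|)+\sum_{v\in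 V}N_v(u-v)\,H(c(v)-|N_v|),$$ where $H(x)=1$ if $x\ge 0$ and $H(x)=0$ if $x<0$. That is, each unstable cell $v$ topples, sending $N_v(\delta)$ grains to $v+\delta$ for each $\delta$; grains sent outside $V$ are lost (they go to a sink which never topples). Starting from a configuration $c$, we say that a cell $u$ topples if $u$ is unstable in $T^t(c)$ for some $t\ge 0$. Crossing gate. Let $A,A'$ be two opposite edges of the grid and $B,B'$ be the other two opposite edges (so $\{\{A,A'\},\{B,B'\}\}=\{\{\text{North},\text{South}\},\{\text{West},\text{East}\}\}$; any choice of directions is allowed, e.g. $A=$ North, $A'=$ South, $B=$ West, $B'=$ East). A stable configuration $c$ is a crossing gate (with respect to such $A,A',B,B'$) if there are a non-corner cell $a\in A$, a cell $a'\in A'$, a non-corner cell $b\in B$ and a cell $b'\in B'$ such that: (i) starting from $c$ with one grain added at $a$, the cell $a'$ topples and no cell of $B'$ topples; (ii) starting from $c$ with one grain added at $b$, the cell $b'$ topples and no cell of $A'$ topples. A grid admits a crossing gate if some stable configuration on it is a crossing gate. -}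

module Defs where

open import Algebra.Properties.Semiring.Sum using (sum)
open import Data.Bool.Base using (if_then_else_)
open import Data.Fin.Base using (Fin; toℕ)
import Data.Fin.Properties as Fin
open import Data.Integer.Base as ℤ using (ℤ; +_; -[1+_]; 0ℤ; _⊖_)
import Data.Integer.Properties as ℤ
open import Data.List.Base using (List; length; filter)
open import Data.List.Membership.Propositional using (_∈_)
open import Data.List.Relation.Binary.Subset.Propositional using (_⊆_)
open import Data.List.Relation.Unary.All using (All)
open import Data.Nat.Base using (ℕ; suc; _+_; _*_; _∸_; _<_; _≤_)
open import Data.Nat.GeneralisedArithmetic using (fold)
open import Data.Nat.Properties using (+-*-semiring)
open import Data.Product.Base using (_×_; _,_; proj₁; proj₂; ∃-syntax)
open import Data.Product.Properties using (≡-dec)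
open import Data.Sum.Base using (_⊎_)
open import Relation.Binary.Definitions using (DecidableEquality)
open import Relation.Binary.PropositionalEquality.Core using (_≡_; _≢_)
open import Relation.Nullary.Decidable.Core using (does)
open import Relation.Nullary.Negation.Core using (¬_)

ℤ² : Set
ℤ² = ℤ × ℤ

_≟ℤ²_ : DecidableEquality ℤ²
_≟ℤ²_ = ≡-dec ℤ._≟_ ℤ._≟_

NonZero² : ℤ² → Set
NonZero² δ = δ ≢ (0ℤ , 0ℤ)

-- A finite multiset is represented by a list enumerating it with
-- repetitions.  Everything below uses the list only through membership,
-- multiplicities and length, so the order of the enumeration is immaterial.
record Neighborhood : Set where
  field
    elements : List ℤ²
    nonZero  : All NonZero² elements

open Neighborhood public

mult : Neighborhood → ℤ² → ℕ
mult N δ = length (filter (δ ≟ℤ²_) (elements N))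

∣_∣ₙ : Neighborhood → ℕ
∣ N ∣ₙ = length (elements N)

Cell : ℕ → ℕ → Set
Cell ℓ ℓ′ = Fin ℓ × Fin ℓ′

Grid : ℕ → ℕ → Set
Grid ℓ ℓ′ = Cell ℓ ℓ′ → Neighborhood

Config : ℕ → ℕ → Set
Config ℓ ℓ′ = Cell ℓ ℓ′ → ℕ

uniform : ∀ {ℓ ℓ′} → Neighborhood → Grid ℓ ℓ′
uniform N _ = N

H : ℤ → ℕ
H (+ _)    = 1
H -[1+ _ ] = 0

module _ {ℓ ℓ′ : ℕ} where

  -- Fin counts from 0, whereas the grid is {1,…,ℓ} × {1,…,ℓ′}.
  xcoord ycoord : Cell ℓ ℓ′ → ℕ
  xcoord u = suc (toℕ (proj₁ u))
  ycoord u = suc (toℕ (proj₂ u))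

  _≟ᶜ_ : DecidableEquality (Cell ℓ ℓ′)
  _≟ᶜ_ = ≡-dec Fin._≟_ Fin._≟_

  _-ᶜ_ : Cell ℓ ℓ′ → Cell ℓ ℓ′ → ℤ²
  u -ᶜ v = (+ xcoord u) ℤ.- (+ xcoord v) , (+ ycoord u) ℤ.- (+ ycoord v)

  ∑ᶜ : (Cell ℓ ℓ′ → ℕ) → ℕ
  ∑ᶜ f = sum +-*-semiring λ x → sum +-*-semiring λ y → f (x , y)

  CellStable : Grid ℓ ℓ′ → Config ℓ ℓ′ → Cell ℓ ℓ′ → Set
  CellStable 𝒩 c u = c u < ∣ 𝒩 u ∣ₙ

  CellUnstable : Grid ℓ ℓ′ → Config ℓ ℓ′ → Cell ℓ ℓ′ → Set
  CellUnstable 𝒩 c u = ¬ CellStable 𝒩 c u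

  Stable : Grid ℓ ℓ′ → Config ℓ ℓ′ → Set
  Stable 𝒩 c = ∀ u → CellStable 𝒩 c u

  -- m ⊖ n is the integer difference of the naturals m and n.  The truncated
  -- subtraction is exact: H (c u ⊖ ∣ 𝒩 u ∣ₙ) is 1 only if ∣ 𝒩 u ∣ₙ ≤ c u.
  T : Grid ℓ ℓ′ → Config ℓ ℓ′ → Config ℓ ℓ′
  T 𝒩 c u = (c u ∸ ∣ 𝒩 u ∣ₙ * H (c u ⊖ ∣ 𝒩 u ∣ₙ))
          + ∑ᶜ (λ v → mult (𝒩 v) (u -ᶜ v) * H (c v ⊖ ∣ 𝒩 v ∣ₙ))

  Topples : Grid ℓ ℓ′ → Config ℓ ℓ′ → Cell ℓ ℓ′ → Set
  Topples 𝒩 c u = ∃[ t ] CellUnstable 𝒩 (fold c (T 𝒩) t) u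

  addGrain : Cell ℓ ℓ′ → Config ℓ ℓ′ → Config ℓ ℓ′
  addGrain a c u = if does (u ≟ᶜ a) then suc (c u) else c u

data Edge : Set where
  west east south north : Edge

opposite : Edge → Edge
opposite west  = east
opposite east  = west
opposite south = north
opposite north = south

data Axis : Set where
  westEast southNorth : Axis

axis : Edge → Axis
axis west  = westEast
axis east  = westEast
axis south = southNorth
axis north = southNorth

module _ {ℓ ℓ′ : ℕ} where

  infix 4 _on_

  _on_ : Cell ℓ ℓ′ → Edge → Set
  u on west  = xcoord u ≡ 1
  u on east  = xcoord u ≡ ℓ
  u on south = ycoord u ≡ 1
  u on north = ycoord u ≡ ℓ′

  Corner : Cell ℓ ℓ′ → Set
  Corner u = ∃[ E ] ∃[ F ] axis E ≢ axis F × u on E × u on F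

  -- A crossing gate with respect to the edges A, opposite A, B, opposite B.
  record IsCrossingGateFor (𝒩 : Grid ℓ ℓ′) (A B : Edge) (c : Config ℓ ℓ′) : Set where
    field
      stable         : Stable 𝒩 c
      a a′ b b′      : Cell ℓ ℓ′
      a-on-A         : a on A
      a-nonCorner    : ¬ Corner a
      a′-on-A′       : a′ on opposite A
      b-on-B         : b on B
      b-nonCorner    : ¬ Corner b
      b′-on-B′       : b′ on opposite B
      a′-topples     : Topples 𝒩 (addGrain a c) a′
      B′-not-toppled : ∀ u → u on opposite B → ¬ Topples 𝒩 (addGrain a c) u
      b′-topples     : Topples 𝒩 (addGrain b c) b′
      A′-not-toppled : ∀ u → u on opposite A → ¬ Topples 𝒩 (addGrain b c) u

  IsCrossingGate : Grid ℓ ℓ′ → Config ℓ ℓ′ → Set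
  IsCrossingGate 𝒩 c = ∃[ A ] ∃[ B ] axis A ≢ axis B × IsCrossingGateFor 𝒩 A B c

  AdmitsCrossingGate : Grid ℓ ℓ′ → Set
  AdmitsCrossingGate 𝒩 = ∃[ c ] IsCrossingGate 𝒩 c

-- The finite set P is given by a list enumerating it, possibly with
-- repetitions; only membership in P is used.
module _ (P : List ℤ²) where

  Primal : ∀ {ℓ ℓ′} → Grid ℓ ℓ′ → Set
  Primal 𝒩 = ∀ v → elements (𝒩 v) ⊆ P × ∣ 𝒩 v ∣ₙ ≡ 1

  Weighted : Neighborhood → Set
  Weighted N = elements N ⊆ P × (∀ {p} → p ∈ P → 1 ≤ mult N p)

  PrimalNonUniformCrossing : Set
  PrimalNonUniformCrossing =
    ∃[ ℓ ] ∃[ ℓ′ ] 1 ≤ ℓ × 1 ≤ ℓ′ ×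
    (∃[ 𝒩 ] Primal {ℓ} {ℓ′} 𝒩 × AdmitsCrossingGate 𝒩)

  WeightedCrossing : Set
  WeightedCrossing =
    ∃[ ℓ ] ∃[ ℓ′ ] 1 ≤ ℓ × 1 ≤ ℓ′ ×
    (∃[ N ] Weighted N × AdmitsCrossingGate (uniform {ℓ} {ℓ′} N))

{-# OPTIONS --safe #-}

-- Both statements are equivalent to the existence of δ₁, δ₂ ∈ P with |det (δ₁ , δ₂)| ≥ 2.
--
-- A gate of either kind yields two paths with steps in P that have no cell in common,
-- one from A to A′ avoiding B′ and one from B to B′ avoiding A′.  In the primal case these
-- are the trajectories of the single grain.  In the weighted case every cell topples at
-- most once per run, and the cells toppled from a but not (yet) from b still connect a to a′.
-- If u runs through one path and w through the other, then w − u is never zero and traces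
-- a closed curve around the boundary of the product of the two paths that winds once
-- around the origin; so one of the small parallelograms spanned by a pair of steps winds
-- around the origin as well.  With nonzero lattice vertices its area is at least 2.
--
-- Conversely, if |det (δ₁ , δ₂)| ≥ 2, then δ₁ and δ₂ span a proper sublattice Λ of ℤ².  Two
-- paths with steps δ₁, δ₂ in different cosets of Λ never interact through δ₁ or δ₂, even
-- where they cross.  Giving δ₁ and δ₂ a large weight makes all other directions harmless.
module Submission where

import Algebra.Properties.Group
open import Algebra.Bundles using (AbelianGroup)
open import Algebra.Properties.Semiring.Sum using (sum)
open import Data.Bool.Base using (Bool; true; false; if_then_else_; _xor_)
open import Data.Bool.Properties using (xor-identityʳ; xor-assoc; xor-same; ¬-not) renaming (_≟_ to _≟ᵇ_)
open import Data.Empty using (⊥; ⊥-elim)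
open import Data.Fin.Base as Fin using (Fin)
import Data.Fin.Properties as Fin
open import Data.Integer.Base as ℤ using (ℤ; -[1+_]; 0ℤ; 1ℤ; -1ℤ; ∣_∣; _⊖_)
open import Data.Integer.Divisibility.Signed
  using (divides; _∣?_; ∣m∣n⇒∣m+n; ∣m∣n⇒∣m-n; ∣n⇒∣m*n; ∣⇒∣ᵤ; ∣m⇒∣-m) renaming (_∣_ to infix 4 _∣ᶻ_)
import Data.Integer.Properties as ℤ
import Data.Integer.Tactic.RingSolver as ℤ-Solver
open import Data.List.Base using (List; []; _∷_; length; filter; _++_; replicate)
open import Data.List.Membership.Propositional using (_∈_; find; lose)
open import Data.List.Membership.Propositional.Properties using (∈-++⁻; ∈-++⁺ˡ)
open import Data.List.Properties using (length-++; length-replicate)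
open import Data.List.Relation.Binary.Subset.Propositional using (_⊆_)
open import Data.List.Relation.Unary.All as All using (All; []; _∷_)
open import Data.List.Relation.Unary.Any using (here; there; any?)
open import Data.Nat.Base as ℕ using (ℕ; zero; suc; z≤n; s≤s; _+_; _*_; _∸_; _≤_; _<_; ⌊_/2⌋; ⌈_/2⌉)
open import Data.Nat.Divisibility using (∣⇒≤)
open import Data.Nat.GeneralisedArithmetic using (fold)
import Data.Nat.Properties as ℕ
import Data.Nat.Tactic.RingSolver as ℕ-Solver
open import Data.Product.Base using (_×_; _,_; proj₁; proj₂; ∃-syntax; Σ-syntax)
open import Data.Sum.Base as Sum using (_⊎_; inj₁; inj₂)
open import Function.Base using (_∘_; const)
open import Function.Bundles using (_⇔_; mk⇔)
open import Level using (0ℓ)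
open import Relation.Binary.Construct.Closure.ReflexiveTransitive as Star using (Star; ε; _◅_; _◅◅_)
open import Relation.Binary.Core using (Rel)
open import Relation.Binary.Definitions using (tri<; tri≈; tri>)
open import Relation.Binary.PropositionalEquality
open import Relation.Nullary using (¬_; Dec; yes; no; does)
open import Relation.Nullary.Decidable using (dec-true; dec-false; does-⇔; _⊎-dec_)
open import Defs

-- Winding numbers

-- Winding is needed only modulo 2, so a Boolean built from signs of integer cross products replaces
-- angles and curves. The three cross products of a triangle add up to twice its area; if the origin
-- lies inside and the sum is at most 1, integrality makes two of them vanish, and then a vertex is
-- the origin. In the weighted case the balance of grains is manageable only while no cell topples
-- twice. The added grain could force a second toppling at the starting cell alone. It does not,
-- because some direction of the neighborhood points inwards from the starting edge, and through it
-- no cell of the grid feeds that edge. Conversely, the obstacle is room: both paths cross one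
-- rectangle and must keep clear of the edges beside them. If one drifts by α while advancing by β,
-- and the other by η while advancing by γ, a suitable rectangle is available when α η < γ β. Slopes
-- of equal absolute value violate this and need a bent path. Different cosets are then obtained by
-- moving one of the two starts by at most one cell.

cross : ℤ² → ℤ² → ℤ
cross u v = proj₁ u ℤ.* proj₂ v ℤ.- proj₂ u ℤ.* proj₁ v

infixl 6 _⊕_ _⊝_
_⊕_ _⊝_ : ℤ² → ℤ² → ℤ²
u ⊕ v = proj₁ u ℤ.+ proj₁ v , proj₂ u ℤ.+ proj₂ v
u ⊝ v = proj₁ u ℤ.- proj₁ v , proj₂ u ℤ.- proj₂ v

area : ℤ² → ℤ² → ℤ² → ℤ
area x y z = cross x y ℤ.+ cross y z ℤ.+ cross z x

upper : ℤ² → Bool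
upper z = does (0ℤ ℤ.≤? proj₂ z)

upper-true : ∀ {z} → 0ℤ ℤ.≤ proj₂ z → upper z ≡ true
upper-true {z} = dec-true (0ℤ ℤ.≤? proj₂ z)

upper-false : ∀ {z} → proj₂ z ℤ.< 0ℤ → upper z ≡ false
upper-false {z} z<0 = dec-false (0ℤ ℤ.≤? proj₂ z) (ℤ.<⇒≱ z<0)

ccw : ℤ² → ℤ² → Bool
ccw u v = does (0ℤ ℤ.<? cross u v)

-- Whether the segment from x to y crosses the positive first axis.  Over a closed polygon
-- the exclusive or of these bits is the parity of the winding number around the origin.
wind : ℤ² → ℤ² → Bool
wind x y = if upper x
  then (if upper y then false else ccw y x)
  else (if upper y then ccw x y else false)

wind-sym : ∀ x y → wind x y ≡ wind y x
wind-sym x y with upper x | upper y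
... | true  | true  = refl
... | true  | false = refl
... | false | true  = refl
... | false | false = refl

cross-antisym : ∀ u v → cross u v ≡ ℤ.- cross v u
cross-antisym (a , b) (c , d) = identity a b c d
  where
  identity : ∀ a b c d → a ℤ.* d ℤ.- b ℤ.* c ≡ ℤ.- (c ℤ.* b ℤ.- d ℤ.* a)
  identity = ℤ-Solver.solve-∀

-- Divided by `area x y z`, the cross products are the barycentric coordinates of the origin in the
-- triangle.
cramer₁ : ∀ x y z → proj₁ x ℤ.* cross y z ℤ.+ proj₁ y ℤ.* cross z x ℤ.+ proj₁ z ℤ.* cross x y ≡ 0ℤ
cramer₁ (a , b) (c , d) (e , f) = identity a b c d e f
  where
  identity : ∀ a b c d e f → a ℤ.* (c ℤ.* f ℤ.- d ℤ.* e) ℤ.+ c ℤ.* (e ℤ.* b ℤ.- f ℤ.* a)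
                             ℤ.+ e ℤ.* (a ℤ.* d ℤ.- b ℤ.* c) ≡ 0ℤ
  identity = ℤ-Solver.solve-∀

cramer₂ : ∀ x y z → proj₂ x ℤ.* cross y z ℤ.+ proj₂ y ℤ.* cross z x ℤ.+ proj₂ z ℤ.* cross x y ≡ 0ℤ
cramer₂ (a , b) (c , d) (e , f) = identity a b c d e f
  where
  identity : ∀ a b c d e f → b ℤ.* (c ℤ.* f ℤ.- d ℤ.* e) ℤ.+ d ℤ.* (e ℤ.* b ℤ.- f ℤ.* a)
                             ℤ.+ f ℤ.* (a ℤ.* d ℤ.- b ℤ.* c) ≡ 0ℤ
  identity = ℤ-Solver.solve-∀

*-nonNeg : ∀ {i j} → 0ℤ ℤ.≤ i → 0ℤ ℤ.≤ j → 0ℤ ℤ.≤ i ℤ.* j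
*-nonNeg {ℤ.+ m} {ℤ.+ n} _ _ = subst (0ℤ ℤ.≤_) (ℤ.pos-* m n) (ℤ.+≤+ z≤n)

*-neg : ∀ {i j} → i ℤ.< 0ℤ → j ℤ.< 0ℤ → 0ℤ ℤ.< i ℤ.* j
*-neg { -[1+ m ]} { -[1+ n ]} _ _ = ℤ.+<+ (s≤s z≤n)
*-neg {ℤ.+ _} (ℤ.+<+ ())
*-neg { -[1+ _ ]} {ℤ.+ _} _ (ℤ.+<+ ())

+-nonNeg : ∀ {i j} → 0ℤ ℤ.≤ i → 0ℤ ℤ.≤ j → 0ℤ ℤ.≤ i ℤ.+ j
+-nonNeg = ℤ.+-mono-≤

-- Being integers, the cross products must be 1, 0 and 0; Cramer's identities then reduce to `z`
-- being the origin.
unit-triangle : ∀ {x y z} → NonZero² z → 0ℤ ℤ.< cross x y → 0ℤ ℤ.≤ cross y z → 0ℤ ℤ.≤ cross z x →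
                ¬ (area x y z ℤ.≤ 1ℤ)
unit-triangle {x} {y} {z} z≢0 a>0 b≥0 c≥0 area≤1 =
  lemma (cross x y) (cross y z) (cross z x) a>0 b≥0 c≥0 area≤1 (cramer₁ x y z) (cramer₂ x y z)
  where
  lemma : ∀ a b c → 0ℤ ℤ.< a → 0ℤ ℤ.≤ b → 0ℤ ℤ.≤ c → a ℤ.+ b ℤ.+ c ℤ.≤ 1ℤ →
          proj₁ x ℤ.* b ℤ.+ proj₁ y ℤ.* c ℤ.+ proj₁ z ℤ.* a ≡ 0ℤ →
          proj₂ x ℤ.* b ℤ.+ proj₂ y ℤ.* c ℤ.+ proj₂ z ℤ.* a ≡ 0ℤ → ⊥
  lemma (ℤ.+ zero) _ _ (ℤ.+<+ ())
  lemma (ℤ.+ suc (suc _)) (ℤ.+ _) (ℤ.+ _) _ _ _ (ℤ.+≤+ (s≤s ()))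
  lemma (ℤ.+ 1) (ℤ.+ suc _) (ℤ.+ _) _ _ _ (ℤ.+≤+ (s≤s ()))
  lemma (ℤ.+ 1) (ℤ.+ 0) (ℤ.+ suc _) _ _ _ (ℤ.+≤+ (s≤s ()))
  lemma (ℤ.+ 1) (ℤ.+ 0) (ℤ.+ 0) _ _ _ _ e₁ e₂ =
    z≢0 (cong₂ _,_ (trans (identity (proj₁ x) (proj₁ y) (proj₁ z)) e₁)
                   (trans (identity (proj₂ x) (proj₂ y) (proj₂ z)) e₂))
    where
    identity : ∀ i j k → k ≡ i ℤ.* 0ℤ ℤ.+ j ℤ.* 0ℤ ℤ.+ k ℤ.* 1ℤ
    identity = ℤ-Solver.solve-∀

-- Otherwise the segments from the lower point `x` to `y` and to `z` would not pass the origin on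
-- the same side. The second coordinates in `cramer₂` then force `cross y z` to be nonnegative, so
-- the triangle contains the origin.
ccw-upper : ∀ {x y z} → proj₂ x ℤ.< 0ℤ → 0ℤ ℤ.≤ proj₂ y → 0ℤ ℤ.≤ proj₂ z → NonZero² z →
            area x y z ℤ.≤ 1ℤ → 0ℤ ℤ.< cross x y → 0ℤ ℤ.< cross x z
ccw-upper {x} {y} {z} x<0 y≥0 z≥0 z≢0 area≤1 a>0 with 0ℤ ℤ.<? cross x z
... | yes p = p
... | no ¬p = ⊥-elim (unit-triangle {x} {y} {z} z≢0 a>0 (ℤ.≮⇒≥ b≮0) c≥0 area≤1)
  where
  c≥0 : 0ℤ ℤ.≤ cross z x
  c≥0 = subst (0ℤ ℤ.≤_) (sym (cross-antisym z x)) (ℤ.neg-mono-≤ (ℤ.≮⇒≥ ¬p))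
  b≮0 : ¬ (cross y z ℤ.< 0ℤ)
  b≮0 b<0 = ℤ.<-irrefl (sym (cramer₂ x y z))
    (ℤ.+-mono-<-≤ (ℤ.+-mono-<-≤ (*-neg x<0 b<0) (*-nonNeg y≥0 c≥0)) (*-nonNeg z≥0 (ℤ.<⇒≤ a>0)))

-- Here `y` and `z` lie strictly below the axis, so `cramer₂` yields a strict sign: two cross
-- products are at most -1, the third is not positive, and the area drops to -2.
ccw-lower : ∀ {x y z} → 0ℤ ℤ.≤ proj₂ x → proj₂ y ℤ.< 0ℤ → proj₂ z ℤ.< 0ℤ →
            ℤ.- 1ℤ ℤ.≤ area x y z → 0ℤ ℤ.< cross y x → 0ℤ ℤ.< cross z x
ccw-lower {x} {y} {z} x≥0 y<0 z<0 area≥-1 a>0 with 0ℤ ℤ.<? cross z x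
... | yes p = p
... | no ¬p = ⊥-elim (ℤ.<⇒≱ area<-1 area≥-1)
  where
  c≤0 : cross z x ℤ.≤ 0ℤ
  c≤0 = ℤ.≮⇒≥ ¬p
  a<0 : cross x y ℤ.< 0ℤ
  a<0 = subst (ℤ._< 0ℤ) (sym (cross-antisym x y)) (ℤ.neg-mono-< a>0)
  nonPos* : ∀ {i j} → i ℤ.< 0ℤ → j ℤ.≤ 0ℤ → 0ℤ ℤ.≤ i ℤ.* j
  nonPos* {i} i<0 j≤0 = subst₂ ℤ._≤_ (ℤ.*-zeroʳ i) refl (ℤ.*-monoˡ-≤-nonPos i {{ℤ.nonPositive (ℤ.<⇒≤ i<0)}} j≤0)
  b<0 : cross y z ℤ.< 0ℤ
  b<0 = ℤ.≰⇒> λ b≥0 → ℤ.<-irrefl (sym (cramer₂ x y z))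
    (ℤ.+-mono-≤-< (ℤ.+-mono-≤ (*-nonNeg x≥0 b≥0) (nonPos* y<0 c≤0)) (*-neg z<0 a<0))
  step : ∀ {i} → i ℤ.< 0ℤ → i ℤ.≤ ℤ.- 1ℤ
  step = ℤ.i<j⇒i≤pred[j]
  area<-1 : area x y z ℤ.< ℤ.- 1ℤ
  area<-1 = ℤ.≤-<-trans (ℤ.+-mono-≤ (ℤ.+-mono-≤ (step a<0) (step b<0)) c≤0) (ℤ.-<- (s≤s z≤n))

Small : ℤ² → ℤ² → ℤ² → Set
Small x y z = ∣ area x y z ∣ ≤ 1

∣i∣≤1⇒i≤1 : ∀ {i} → ∣ i ∣ ≤ 1 → i ℤ.≤ 1ℤ
∣i∣≤1⇒i≤1 {ℤ.+ _} h = ℤ.+≤+ h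
∣i∣≤1⇒i≤1 { -[1+ _ ]} _ = ℤ.-≤+

∣i∣≤1⇒-1≤i : ∀ {i} → ∣ i ∣ ≤ 1 → ℤ.- 1ℤ ℤ.≤ i
∣i∣≤1⇒-1≤i {ℤ.+ _} _ = ℤ.-≤+
∣i∣≤1⇒-1≤i { -[1+ _ ]} (s≤s h) = ℤ.-≤- h

Small-swap : ∀ x y z → Small x y z → Small x z y
Small-swap (a , b) (c , d) (e , f) = subst (ℕ._≤ 1)
  (trans (sym (ℤ.∣-i∣≡∣i∣ (area (a , b) (c , d) (e , f)))) (cong ∣_∣ (identity a b c d e f)))
  where
  identity : ∀ a b c d e f →
    ℤ.- (a ℤ.* d ℤ.- b ℤ.* c ℤ.+ (c ℤ.* f ℤ.- d ℤ.* e) ℤ.+ (e ℤ.* b ℤ.- f ℤ.* a)) ≡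
    a ℤ.* f ℤ.- b ℤ.* e ℤ.+ (e ℤ.* d ℤ.- f ℤ.* c) ℤ.+ (c ℤ.* b ℤ.- d ℤ.* a)
  identity = ℤ-Solver.solve-∀

Small-rotate : ∀ x y z → Small x y z → Small y z x
Small-rotate x y z = subst (ℕ._≤ 1) (cong ∣_∣ (identity (cross x y) (cross y z) (cross z x)))
  where
  identity : ∀ a b c → a ℤ.+ b ℤ.+ c ≡ b ℤ.+ c ℤ.+ a
  identity = ℤ-Solver.solve-∀

wind-apex : ∀ x y z → NonZero² y → NonZero² z → Small x y z → upper y ≡ upper z → upper x ≢ upper y →
            wind x y ≡ wind x z
wind-apex x y z y≢0 z≢0 sm y≡z x≢y with 0ℤ ℤ.≤? proj₂ x | 0ℤ ℤ.≤? proj₂ y | 0ℤ ℤ.≤? proj₂ z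
... | yes px | yes py | _      = ⊥-elim (x≢y refl)
... | yes px | no  py | no  pz =
  does-⇔ (mk⇔
    (ccw-lower {x} {y} {z} px (ℤ.≰⇒> py) (ℤ.≰⇒> pz) (∣i∣≤1⇒-1≤i sm))
    (ccw-lower {x} {z} {y} px (ℤ.≰⇒> pz) (ℤ.≰⇒> py) (∣i∣≤1⇒-1≤i (Small-swap x y z sm))))
    (0ℤ ℤ.<? cross y x) (0ℤ ℤ.<? cross z x)
... | no  px | yes py | yes pz =
  does-⇔ (mk⇔
    (ccw-upper {x} {y} {z} (ℤ.≰⇒> px) py pz z≢0 (∣i∣≤1⇒i≤1 sm))
    (ccw-upper {x} {z} {y} (ℤ.≰⇒> px) pz py y≢0 (∣i∣≤1⇒i≤1 (Small-swap x y z sm))))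
    (0ℤ ℤ.<? cross x y) (0ℤ ℤ.<? cross x z)
... | no  px | no  py | _      = ⊥-elim (x≢y refl)

wind-level : ∀ x y → upper x ≡ upper y → wind x y ≡ false
wind-level x y x≡y with upper x | upper y
wind-level x y refl | true  | true  = refl
wind-level x y refl | false | false = refl

-- Two of the vertices lie on the same side of the axis. The segment between them contributes
-- nothing, and the two segments to the third vertex contribute equally.
wind-triangle : ∀ x y z → NonZero² x → NonZero² y → NonZero² z → Small x y z →
                wind x y xor wind y z ≡ wind x z
wind-triangle x y z x≢0 y≢0 z≢0 sm with upper x ≟ᵇ upper y | upper y ≟ᵇ upper z
... | yes x≡y | yes y≡z rewrite wind-level x y x≡y | wind-level y z y≡z =
  sym (wind-level x z (trans x≡y y≡z))
... | no  x≢y | yes y≡z rewrite wind-level y z y≡z =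
  trans (xor-identityʳ _) (wind-apex x y z y≢0 z≢0 sm y≡z x≢y)
... | yes x≡y | no  y≢z rewrite wind-level x y x≡y =
  trans (wind-sym y z) (trans (sym (wind-apex z x y x≢0 y≢0 (Small-rotate y z x (Small-rotate x y z sm)) x≡y
    λ z≡x → y≢z (sym (trans z≡x x≡y)))) (wind-sym z x))
... | no  x≢y | no  y≢z =
  trans (cong (_xor wind y z) (trans (wind-sym x y)
          (sym (wind-apex y z x z≢0 x≢0 (Small-rotate x y z sm) (sym x≡z) y≢z))))
        (trans (xor-same (wind y z)) (sym (wind-level x z x≡z)))
  where
  x≡z : upper x ≡ upper z
  x≡z = trans (¬-not x≢y) (sym (¬-not λ z≡y → y≢z (sym z≡y)))

i<j⇒0<j-i : ∀ {i j} → i ℤ.< j → 0ℤ ℤ.< j ℤ.- i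
i<j⇒0<j-i {i} {j} i<j = subst (ℤ._< j ℤ.- i) (ℤ.+-inverseʳ i) (ℤ.+-monoˡ-< (ℤ.- i) i<j)

0<i-j⇒j<i : ∀ {i j} → 0ℤ ℤ.< i ℤ.- j → j ℤ.< i
0<i-j⇒j<i 0<i-j = ℤ.≰⇒> λ i≤j → ℤ.<⇒≱ 0<i-j (ℤ.i≤j⇒i-j≤0 i≤j)

cross-left : ∀ {x y} → proj₁ x ℤ.≤ 0ℤ → proj₁ y ℤ.≤ 0ℤ → proj₂ x ℤ.< 0ℤ → 0ℤ ℤ.≤ proj₂ y →
             cross x y ℤ.≤ 0ℤ
cross-left {a , b} {c , d} a≤0 c≤0 b<0 d≥0 = subst (ℤ._≤ 0ℤ) (identity a b c d)
  (ℤ.neg-mono-≤ (+-nonNeg (*-nonNeg (ℤ.neg-mono-≤ a≤0) d≥0) (*-nonNeg (ℤ.neg-mono-≤ (ℤ.<⇒≤ b<0)) (ℤ.neg-mono-≤ c≤0))))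
  where
  identity : ∀ a b c d → ℤ.- (ℤ.- a ℤ.* d ℤ.+ ℤ.- b ℤ.* (ℤ.- c)) ≡ a ℤ.* d ℤ.- b ℤ.* c
  identity = ℤ-Solver.solve-∀

cross-right : ∀ {x y} → 0ℤ ℤ.< proj₁ x → 0ℤ ℤ.< proj₁ y → proj₂ x ℤ.< 0ℤ → 0ℤ ℤ.≤ proj₂ y →
              0ℤ ℤ.< cross x y
cross-right {a , b} {c , d} a>0 c>0 b<0 d≥0 = subst (0ℤ ℤ.<_) (identity a b c d)
  (ℤ.+-mono-≤-< (*-nonNeg (ℤ.<⇒≤ a>0) d≥0) (*-neg b<0 (ℤ.neg-mono-< c>0)))
  where
  identity : ∀ a b c d → a ℤ.* d ℤ.+ b ℤ.* (ℤ.- c) ≡ a ℤ.* d ℤ.- b ℤ.* c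
  identity = ℤ-Solver.solve-∀

wind-left : ∀ x y → proj₁ x ℤ.≤ 0ℤ → proj₁ y ℤ.≤ 0ℤ → wind x y ≡ false
wind-left x y x≤0 y≤0 with 0ℤ ℤ.≤? proj₂ x | 0ℤ ℤ.≤? proj₂ y
... | yes _  | yes _  = refl
... | no  _  | no  _  = refl
... | yes px | no  py = dec-false (0ℤ ℤ.<? cross y x) (ℤ.≤⇒≯ (cross-left {y} {x} y≤0 x≤0 (ℤ.≰⇒> py) px))
... | no  px | yes py = dec-false (0ℤ ℤ.<? cross x y) (ℤ.≤⇒≯ (cross-left {x} {y} x≤0 y≤0 (ℤ.≰⇒> px) py))

wind-right : ∀ x y → 0ℤ ℤ.< proj₁ x → 0ℤ ℤ.< proj₁ y → wind x y ≡ upper x xor upper y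
wind-right x y x>0 y>0 with 0ℤ ℤ.≤? proj₂ x | 0ℤ ℤ.≤? proj₂ y
... | yes _  | yes _  = refl
... | no  _  | no  _  = refl
... | yes px | no  py = dec-true (0ℤ ℤ.<? cross y x) (cross-right {y} {x} y>0 x>0 (ℤ.≰⇒> py) px)
... | no  px | yes py = dec-true (0ℤ ℤ.<? cross x y) (cross-right {x} {y} x>0 y>0 (ℤ.≰⇒> px) py)

-- Winding of the difference of two moving points

module _ {C : Set} (pos : C → ℤ²) where

  difference : C → C → ℤ²
  difference u w = pos w ⊝ pos u

  -- Both sides equal the bit of the diagonal from `difference u w` to `difference u′ w′`. The
  -- diagonal cuts the parallelogram into two triangles, each of doubled area plus or minus the
  -- determinant of the two steps.
  wind-square : ∀ {u u′ w w′} →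
    NonZero² (difference u w) → NonZero² (difference u′ w) →
    NonZero² (difference u w′) → NonZero² (difference u′ w′) →
    ∣ cross (difference u u′) (difference w w′) ∣ ≤ 1 →
    wind (difference u w) (difference u′ w) xor wind (difference u′ w) (difference u′ w′) ≡
    wind (difference u w) (difference u w′) xor wind (difference u w′) (difference u′ w′)
  wind-square {u} {u′} {w} {w′} nz nz₁ nz₂ nz₁₂ small =
    trans (wind-triangle _ _ _ nz nz₁ nz₁₂ (subst (ℕ._≤ 1) (trans (sym (ℤ.∣-i∣≡∣i∣ D)) (cong ∣_∣ area₁)) small))
          (sym (wind-triangle _ _ _ nz nz₂ nz₁₂ (subst (ℕ._≤ 1) (cong ∣_∣ area₂) small)))
    where
    D = cross (difference u u′) (difference w w′)
    identity₁ : ∀ a b a′ b′ c d c′ d′ →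
      ℤ.- ((a′ ℤ.- a) ℤ.* (d′ ℤ.- d) ℤ.- (b′ ℤ.- b) ℤ.* (c′ ℤ.- c)) ≡
      ((c ℤ.- a) ℤ.* (d ℤ.- b′) ℤ.- (d ℤ.- b) ℤ.* (c ℤ.- a′)) ℤ.+
      ((c ℤ.- a′) ℤ.* (d′ ℤ.- b′) ℤ.- (d ℤ.- b′) ℤ.* (c′ ℤ.- a′)) ℤ.+
      ((c′ ℤ.- a′) ℤ.* (d ℤ.- b) ℤ.- (d′ ℤ.- b′) ℤ.* (c ℤ.- a))
    identity₁ = ℤ-Solver.solve-∀
    identity₂ : ∀ a b a′ b′ c d c′ d′ →
      (a′ ℤ.- a) ℤ.* (d′ ℤ.- d) ℤ.- (b′ ℤ.- b) ℤ.* (c′ ℤ.- c) ≡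
      ((c ℤ.- a) ℤ.* (d′ ℤ.- b) ℤ.- (d ℤ.- b) ℤ.* (c′ ℤ.- a)) ℤ.+
      ((c′ ℤ.- a) ℤ.* (d′ ℤ.- b′) ℤ.- (d′ ℤ.- b) ℤ.* (c′ ℤ.- a′)) ℤ.+
      ((c′ ℤ.- a′) ℤ.* (d ℤ.- b) ℤ.- (d′ ℤ.- b′) ℤ.* (c ℤ.- a))
    identity₂ = ℤ-Solver.solve-∀
    area₁ : ℤ.- D ≡ area (difference u w) (difference u′ w) (difference u′ w′)
    area₁ = identity₁ (proj₁ (pos u)) (proj₂ (pos u)) (proj₁ (pos u′)) (proj₂ (pos u′))
                      (proj₁ (pos w)) (proj₂ (pos w)) (proj₁ (pos w′)) (proj₂ (pos w′))
    area₂ : D ≡ area (difference u w) (difference u w′) (difference u′ w′)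
    area₂ = identity₂ (proj₁ (pos u)) (proj₂ (pos u)) (proj₁ (pos u′)) (proj₂ (pos u′))
                      (proj₁ (pos w)) (proj₂ (pos w)) (proj₁ (pos w′)) (proj₂ (pos w′))

  module _ {R S : Rel C 0ℓ}
    (nonZero : ∀ {u u′ w w′} → R u u′ → S w w′ →
               NonZero² (difference u w) × NonZero² (difference u′ w) ×
               NonZero² (difference u w′) × NonZero² (difference u′ w′))
    (small : ∀ {u u′ w w′} → R u u′ → S w w′ → ∣ cross (difference u u′) (difference w w′) ∣ ≤ 1)
    where

    windˡ : ∀ {u u′} → Star R u u′ → C → Bool
    windˡ ε w = false
    windˡ (_◅_ {u} {u′} _ p) w = wind (difference u w) (difference u′ w) xor windˡ p w

    windʳ : ∀ {w w′} → C → Star S w w′ → Bool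
    windʳ u ε = false
    windʳ u (_◅_ {w} {w′} _ q) = wind (difference u w) (difference u w′) xor windʳ u q

    -- Gluing two squares, or two strips of squares, along a common side.
    xor-glue : ∀ {h v v′ h′ k l l′} → h xor v ≡ v′ xor h′ → h′ xor k ≡ l xor l′ →
               h xor (v xor k) ≡ (v′ xor l) xor l′
    xor-glue {h} {v} {v′} {h′} {k} {l} {l′} e f = begin
      h xor (v xor k)   ≡⟨ xor-assoc h v k ⟨
      (h xor v) xor k   ≡⟨ cong (_xor k) e ⟩
      (v′ xor h′) xor k ≡⟨ xor-assoc v′ h′ k ⟩
      v′ xor (h′ xor k) ≡⟨ cong (v′ xor_) f ⟩
      v′ xor (l xor l′) ≡⟨ xor-assoc v′ l l′ ⟨
      (v′ xor l) xor l′ ∎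
      where open ≡-Reasoning

    wind-strip : ∀ {u u′ w w′} → R u u′ → (q : Star S w w′) →
      wind (difference u w) (difference u′ w) xor windʳ u′ q ≡
      windʳ u q xor wind (difference u w′) (difference u′ w′)
    wind-strip r ε = xor-identityʳ _
    wind-strip {u} {u′} {w} {w″} r (_◅_ {j = w′} s q) =
      let nz , nz₁ , nz₂ , nz₁₂ = nonZero r s in
      xor-glue {h = wind (difference u w) (difference u′ w)} {v′ = wind (difference u w) (difference u w′)}
        {h′ = wind (difference u w′) (difference u′ w′)} {l = windʳ u q}
        (wind-square {u} {u′} {w} {w′} nz nz₁ nz₂ nz₁₂ (small r s)) (wind-strip r q)

    -- A discrete homotopy: the two ways around the product of the paths differ by the squares
    -- between them, each of which contributes nothing.
    wind-rectangle : ∀ {u u′ w w′} (p : Star R u u′) (q : Star S w w′) →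
      windˡ p w xor windʳ u′ q ≡ windʳ u q xor windˡ p w′
    wind-rectangle ε q = sym (xor-identityʳ _)
    wind-rectangle {u} {u″} {w} {w′} (_◅_ {j = u′} r p) q = begin
      (h xor windˡ p w) xor windʳ u″ q  ≡⟨ xor-assoc h (windˡ p w) _ ⟩
      h xor (windˡ p w xor windʳ u″ q)  ≡⟨ cong (h xor_) (wind-rectangle p q) ⟩
      h xor (windʳ u′ q xor windˡ p w′) ≡⟨ xor-assoc h (windʳ u′ q) _ ⟨
      (h xor windʳ u′ q) xor windˡ p w′ ≡⟨ cong (_xor windˡ p w′) (wind-strip r q) ⟩
      (windʳ u q xor h′) xor windˡ p w′ ≡⟨ xor-assoc (windʳ u q) h′ _ ⟩
      windʳ u q xor (h′ xor windˡ p w′) ∎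
      where
      open ≡-Reasoning
      h = wind (difference u w) (difference u′ w)
      h′ = wind (difference u w′) (difference u′ w′)

    -- Around the boundary of p × q the difference of the two positions stays in
    -- the left, lower, right and upper half-planes in turn, so it winds once
    -- around the origin, whereas each small parallelogram contributes zero.
    no-disjoint-crossing : ∀ {a a′ b b′} (p : Star R a a′) (q : Star S b b′) →
      (∀ u → proj₁ (pos b) ℤ.≤ proj₁ (pos u)) →
      (∀ w → proj₂ (pos a) ℤ.≤ proj₂ (pos w)) →
      (∀ {u u′} → R u u′ → proj₁ (pos u) ℤ.< proj₁ (pos b′) × proj₁ (pos u′) ℤ.< proj₁ (pos b′)) →
      (∀ {w w′} → S w w′ → proj₂ (pos w) ℤ.< proj₂ (pos a′) × proj₂ (pos w′) ℤ.< proj₂ (pos a′)) →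
      proj₂ (pos b′) ℤ.< proj₂ (pos a′) → ⊥
    no-disjoint-crossing {a} {a′} {b} {b′} p q b-left a-low p-left q-low b′-low =
      absurd (trans (cong₂ _xor_ (sym (left p)) (sym (low q)))
             (trans (wind-rectangle p q) (cong₂ _xor_ (high q) (right p))))
      where
      sub≤ : ∀ {i j} → i ℤ.≤ j → i ℤ.- j ℤ.≤ 0ℤ
      sub≤ = ℤ.i≤j⇒i-j≤0
      left : ∀ {u u′} (p : Star R u u′) → windˡ p b ≡ false
      left ε = refl
      left (_◅_ {u} {u′} _ p) = cong₂ _xor_
        (wind-left (difference u b) (difference u′ b) (sub≤ (b-left u)) (sub≤ (b-left u′))) (left p)
      neg : ∀ {w} → proj₂ (pos w) ℤ.< proj₂ (pos a′) → upper (difference a′ w) ≡ false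
      neg {w} w<a′ = upper-false {difference a′ w}
        (subst (proj₂ (pos w) ℤ.- proj₂ (pos a′) ℤ.<_) (ℤ.+-inverseʳ (proj₂ (pos a′))) (ℤ.+-monoˡ-< (ℤ.- proj₂ (pos a′)) w<a′))
      nonneg : ∀ w → upper (difference a w) ≡ true
      nonneg w = upper-true {difference a w} (ℤ.i≤j⇒0≤j-i (a-low w))
      low : ∀ {w w′} (q : Star S w w′) → windʳ a′ q ≡ false
      low ε = refl
      low (_◅_ {w} {w′} s q) = cong₂ _xor_
        (wind-level (difference a′ w) (difference a′ w′)
          (trans (neg {w} (proj₁ (q-low s))) (sym (neg {w′} (proj₂ (q-low s)))))) (low q)
      high : ∀ {w w′} (q : Star S w w′) → windʳ a q ≡ false
      high ε = refl
      high (_◅_ {w} {w′} s q) = cong₂ _xor_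
        (wind-level (difference a w) (difference a w′) (trans (nonneg w) (sym (nonneg w′)))) (high q)
      telescope : ∀ x y z → (x xor y) xor (y xor z) ≡ x xor z
      telescope x y z = trans (xor-assoc x y _) (cong (x xor_)
        (trans (sym (xor-assoc y y z)) (cong (_xor z) (xor-same y))))
      right′ : ∀ {u u′} (p : Star R u u′) → windˡ p b′ ≡ upper (difference u b′) xor upper (difference u′ b′)
      right′ {u} ε = sym (xor-same (upper (difference u b′)))
      right′ {u} (_◅_ {j = u′} r p) = trans (cong₂ _xor_
        (wind-right (difference u b′) (difference u′ b′) (i<j⇒0<j-i (proj₁ (p-left r))) (i<j⇒0<j-i (proj₂ (p-left r)))) (right′ p))
        (telescope (upper (difference u b′)) (upper (difference u′ b′)) _)
      right : (p : Star R a a′) → windˡ p b′ ≡ true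
      right p = trans (right′ p) (cong₂ _xor_ (nonneg b′) (neg {b′} b′-low))
      absurd : false ≢ true
      absurd ()

module ℤ-Group = Algebra.Properties.Group (AbelianGroup.group ℤ.+-0-abelianGroup)

-- Sums over cells

∑ : ∀ {n} → (Fin n → ℕ) → ℕ
∑ = sum ℕ.+-*-semiring

∑-mono : ∀ {n} {f g : Fin n → ℕ} → (∀ i → f i ≤ g i) → ∑ f ≤ ∑ g
∑-mono {zero}  f≤g = z≤n
∑-mono {suc n} f≤g = ℕ.+-mono-≤ (f≤g Fin.zero) (∑-mono (f≤g ∘ Fin.suc))

∑-+ : ∀ {n} (f g : Fin n → ℕ) → ∑ (λ i → f i + g i) ≡ ∑ f + ∑ g
∑-+ = ∑-distrib-+
  where open import Algebra.Properties.Semiring.Sum ℕ.+-*-semiring using (∑-distrib-+)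

∑-exceeds : ∀ {n} {f g : Fin n → ℕ} → ∑ f < ∑ g → ∃[ i ] f i < g i
∑-exceeds {zero} ()
∑-exceeds {suc n} {f} {g} f<g with f Fin.zero ℕ.<? g Fin.zero
... | yes p = Fin.zero , p
... | no ¬p = let i , q = ∑-exceeds {n} {f ∘ Fin.suc} {g ∘ Fin.suc} tail< in Fin.suc i , q
  where
  tail< : ∑ (f ∘ Fin.suc) < ∑ (g ∘ Fin.suc)
  tail< = ℕ.≰⇒> λ g≤f → ℕ.<⇒≱ f<g (ℕ.+-mono-≤ (ℕ.≮⇒≥ ¬p) g≤f)

∑-zero : ∀ {n} {f : Fin n → ℕ} → (∀ i → f i ≡ 0) → ∑ f ≡ 0
∑-zero {zero}  f≡0 = refl
∑-zero {suc n} f≡0 = cong₂ _+_ (f≡0 Fin.zero) (∑-zero (f≡0 ∘ Fin.suc))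

∑-positive : ∀ {n} {f : Fin n → ℕ} → 0 < ∑ f → ∃[ i ] 0 < f i
∑-positive {n} {f} 0<f = ∑-exceeds {n} {λ _ → 0} (subst (_< ∑ f) (sym (∑-zero {n} λ _ → refl)) 0<f)

∑-term : ∀ {n} (f : Fin n → ℕ) i → f i ≤ ∑ f
∑-term f Fin.zero    = ℕ.m≤m+n _ _
∑-term f (Fin.suc i) = ℕ.≤-trans (∑-term (f ∘ Fin.suc) i) (ℕ.m≤n+m _ _)

∑-≤1 : ∀ {n} {f : Fin n → ℕ} → (∀ i → f i ≤ 1) → (∀ {i j} → 0 < f i → 0 < f j → i ≡ j) → ∑ f ≤ 1
∑-≤1 {zero} f≤1 unique = z≤n
∑-≤1 {suc n} {f} f≤1 unique with f Fin.zero in eq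
... | zero  = ∑-≤1 (f≤1 ∘ Fin.suc) λ p q → suc-injective (unique p q)
  where open import Data.Fin.Properties using (suc-injective)
... | suc k = subst (_≤ 1) (trans eq (sym (trans (cong (suc k +_) (∑-zero tail≡0)) (ℕ.+-identityʳ _)))) (f≤1 Fin.zero)
  where
  tail≡0 : ∀ i → f (Fin.suc i) ≡ 0
  tail≡0 i with f (Fin.suc i) in eq′
  ... | zero  = refl
  ... | suc m with () ← unique {Fin.zero} {Fin.suc i} (subst (0 <_) (sym eq) (s≤s z≤n)) (subst (0 <_) (sym eq′) (s≤s z≤n))

module _ {ℓ ℓ′ : ℕ} where

  ∑ᶜ-mono : {f g : Cell ℓ ℓ′ → ℕ} → (∀ u → f u ≤ g u) → ∑ᶜ f ≤ ∑ᶜ g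
  ∑ᶜ-mono f≤g = ∑-mono λ x → ∑-mono λ y → f≤g (x , y)

  ∑ᶜ-cong : {f g : Cell ℓ ℓ′ → ℕ} → (∀ u → f u ≡ g u) → ∑ᶜ f ≡ ∑ᶜ g
  ∑ᶜ-cong f≡g = ℕ.≤-antisym (∑ᶜ-mono λ u → ℕ.≤-reflexive (f≡g u)) (∑ᶜ-mono λ u → ℕ.≤-reflexive (sym (f≡g u)))

  ∑ᶜ-+ : (f g : Cell ℓ ℓ′ → ℕ) → ∑ᶜ (λ u → f u + g u) ≡ ∑ᶜ f + ∑ᶜ g
  ∑ᶜ-+ f g = trans (∑-cong λ x → ∑-+ (λ y → f (x , y)) (λ y → g (x , y)))
                   (∑-+ (λ x → ∑ λ y → f (x , y)) (λ x → ∑ λ y → g (x , y)))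
    where open import Algebra.Properties.Semiring.Sum ℕ.+-*-semiring using () renaming (sum-cong-≗ to ∑-cong)

  ∑ᶜ-exceeds : {f g : Cell ℓ ℓ′ → ℕ} → ∑ᶜ f < ∑ᶜ g → ∃[ u ] f u < g u
  ∑ᶜ-exceeds f<g =
    let x , fx<gx = ∑-exceeds f<g
        y , p = ∑-exceeds fx<gx
    in (x , y) , p

  ∑ᶜ-zero : {f : Cell ℓ ℓ′ → ℕ} → (∀ u → f u ≡ 0) → ∑ᶜ f ≡ 0
  ∑ᶜ-zero f≡0 = ∑-zero λ x → ∑-zero λ y → f≡0 (x , y)

  ∑ᶜ-positive : {f : Cell ℓ ℓ′ → ℕ} → 0 < ∑ᶜ f → ∃[ u ] 0 < f u
  ∑ᶜ-positive 0<f =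
    let x , 0<fx = ∑-positive 0<f
        y , p = ∑-positive 0<fx
    in (x , y) , p

  ∑ᶜ-term : (f : Cell ℓ ℓ′ → ℕ) → ∀ u → f u ≤ ∑ᶜ f
  ∑ᶜ-term f (x , y) = ℕ.≤-trans (∑-term (λ y → f (x , y)) y) (∑-term (λ x → ∑ λ y → f (x , y)) x)

  ∑ᶜ-≤1 : {f : Cell ℓ ℓ′ → ℕ} → (∀ u → f u ≤ 1) → (∀ {u v} → 0 < f u → 0 < f v → u ≡ v) → ∑ᶜ f ≤ 1
  ∑ᶜ-≤1 {f} f≤1 unique = ∑-≤1 (λ x → ∑-≤1 (λ y → f≤1 (x , y)) λ p q → cong proj₂ (unique p q))
    λ {x} {x′} p q → cong proj₁ (unique (proj₂ (∑-positive {f = λ y → f (x , y)} p))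
                                          (proj₂ (∑-positive {f = λ y → f (x′ , y)} q)))

-- Multiplicities and arriving grains

count : ℤ² → List ℤ² → ℕ
count δ L = length (filter (δ ≟ℤ²_) L)

indicator : ℤ² → ℤ² → ℕ
indicator δ δ′ = if does (δ ≟ℤ² δ′) then 1 else 0

count-∷ : ∀ δ δ′ L → count δ (δ′ ∷ L) ≡ indicator δ δ′ + count δ L
count-∷ δ δ′ L with does (δ ≟ℤ² δ′)
... | true  = refl
... | false = refl

count-++ : ∀ δ L L′ → count δ (L ++ L′) ≡ count δ L + count δ L′
count-++ δ []       L′ = refl
count-++ δ (δ′ ∷ L) L′ = begin
  count δ (δ′ ∷ L ++ L′)                        ≡⟨ count-∷ δ δ′ (L ++ L′) ⟩
  indicator δ δ′ + count δ (L ++ L′)            ≡⟨ cong (indicator δ δ′ +_) (count-++ δ L L′) ⟩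
  indicator δ δ′ + (count δ L + count δ L′)     ≡⟨ ℕ.+-assoc (indicator δ δ′) _ _ ⟨
  (indicator δ δ′ + count δ L) + count δ L′     ≡⟨ cong (_+ count δ L′) (count-∷ δ δ′ L) ⟨
  count δ (δ′ ∷ L) + count δ L′                 ∎
  where open ≡-Reasoning

indicator-refl : ∀ δ → indicator δ δ ≡ 1
indicator-refl δ = cong (if_then 1 else 0) (dec-true (δ ≟ℤ² δ) refl)

indicator-≢ : ∀ {δ δ′} → δ ≢ δ′ → indicator δ δ′ ≡ 0
indicator-≢ {δ} {δ′} δ≢δ′ = cong (if_then 1 else 0) (dec-false (δ ≟ℤ² δ′) δ≢δ′)

indicator-≤1 : ∀ δ δ′ → indicator δ δ′ ≤ 1
indicator-≤1 δ δ′ with does (δ ≟ℤ² δ′)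
... | true  = s≤s z≤n
... | false = z≤n

indicator-positive : ∀ {δ δ′} → 0 < indicator δ δ′ → δ ≡ δ′
indicator-positive {δ} {δ′} p with δ ≟ℤ² δ′
... | yes e = e
... | no  _ with () ← p

count-positive : ∀ {δ} L → 0 < count δ L → δ ∈ L
count-positive {δ} (δ′ ∷ L) p with δ ≟ℤ² δ′
... | yes e = here e
... | no  _ = there (count-positive L p)

∈⇒count : ∀ {δ L} → δ ∈ L → 1 ≤ count δ L
∈⇒count {δ} {.δ ∷ L} (here refl) = subst (1 ≤_) (sym (count-∷ δ δ L))
  (ℕ.≤-trans (ℕ.≤-reflexive (sym (indicator-refl δ))) (ℕ.m≤m+n _ _))
∈⇒count {δ} {δ′ ∷ L} (there p) = subst (1 ≤_) (sym (count-∷ δ δ′ L)) (ℕ.≤-trans (∈⇒count p) (ℕ.m≤n+m _ _))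

minus-injectiveʳ : ∀ i j k → i ℤ.- j ≡ i ℤ.- k → j ≡ k
minus-injectiveʳ i j k eq = ℤ.neg-injective (ℤ-Group.∙-cancelˡ i (ℤ.- j) (ℤ.- k) eq)

minus-injectiveˡ : ∀ i j k → i ℤ.- k ≡ j ℤ.- k → i ≡ j
minus-injectiveˡ i j k = ℤ-Group.∙-cancelʳ (ℤ.- k) i j

module _ {ℓ ℓ′ : ℕ} where

  private
    C : Set
    C = Cell ℓ ℓ′

  coords-injective : {u v : C} → xcoord u ≡ xcoord v → ycoord u ≡ ycoord v → u ≡ v
  coords-injective p q = cong₂ _,_ (toℕ-injective (ℕ.suc-injective p)) (toℕ-injective (ℕ.suc-injective q))
    where open import Data.Fin.Properties using (toℕ-injective)

  -ᶜ-injectiveʳ : ∀ (u : C) {v w} → u -ᶜ v ≡ u -ᶜ w → v ≡ w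
  -ᶜ-injectiveʳ u {v} {w} eq = coords-injective
    (ℤ.+-injective (minus-injectiveʳ (ℤ.+ xcoord u) (ℤ.+ xcoord v) (ℤ.+ xcoord w) (cong proj₁ eq)))
    (ℤ.+-injective (minus-injectiveʳ (ℤ.+ ycoord u) (ℤ.+ ycoord v) (ℤ.+ ycoord w) (cong proj₂ eq)))

  -ᶜ-injectiveˡ : ∀ {u v} (w : C) → u -ᶜ w ≡ v -ᶜ w → u ≡ v
  -ᶜ-injectiveˡ {u} {v} w eq = coords-injective
    (ℤ.+-injective (minus-injectiveˡ (ℤ.+ xcoord u) (ℤ.+ xcoord v) (ℤ.+ xcoord w) (cong proj₁ eq)))
    (ℤ.+-injective (minus-injectiveˡ (ℤ.+ ycoord u) (ℤ.+ ycoord v) (ℤ.+ ycoord w) (cong proj₂ eq)))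

  -- With `χ u` the number of topplings of `u`, this is what `v` receives from them when every cell
  -- has the neighborhood `L`.
  arrivals : List ℤ² → (C → ℕ) → C → ℕ
  arrivals L χ v = ∑ᶜ λ u → count (v -ᶜ u) L * χ u

  arrivals₁ : ℤ² → (C → ℕ) → C → ℕ
  arrivals₁ δ χ v = ∑ᶜ λ u → indicator (v -ᶜ u) δ * χ u

  arrivals-∷ : ∀ δ L χ v → arrivals (δ ∷ L) χ v ≡ arrivals₁ δ χ v + arrivals L χ v
  arrivals-∷ δ L χ v = trans
    (∑ᶜ-cong λ u → trans (cong (_* χ u) (count-∷ (v -ᶜ u) δ L)) (ℕ.*-distribʳ-+ (χ u) (indicator (v -ᶜ u) δ) _))
    (∑ᶜ-+ (λ u → indicator (v -ᶜ u) δ * χ u) _)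

  arrivals-++ : ∀ L L′ χ v → arrivals (L ++ L′) χ v ≡ arrivals L χ v + arrivals L′ χ v
  arrivals-++ L L′ χ v = trans
    (∑ᶜ-cong λ u → trans (cong (_* χ u) (count-++ (v -ᶜ u) L L′)) (ℕ.*-distribʳ-+ (χ u) (count (v -ᶜ u) L) _))
    (∑ᶜ-+ (λ u → count (v -ᶜ u) L * χ u) _)

  arrivals-+ : ∀ L χ χ′ v → arrivals L (λ u → χ u + χ′ u) v ≡ arrivals L χ v + arrivals L χ′ v
  arrivals-+ L χ χ′ v = trans
    (∑ᶜ-cong λ u → ℕ.*-distribˡ-+ (count (v -ᶜ u) L) (χ u) (χ′ u))
    (∑ᶜ-+ (λ u → count (v -ᶜ u) L * χ u) _)

  arrivals-mono : ∀ L {χ χ′ : C → ℕ} v → (∀ u → χ u ≤ χ′ u) → arrivals L χ v ≤ arrivals L χ′ v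
  arrivals-mono L v χ≤χ′ = ∑ᶜ-mono λ u → ℕ.*-monoʳ-≤ (count (v -ᶜ u) L) (χ≤χ′ u)

  arrivals-none : ∀ L {χ : C → ℕ} v → (∀ u → 0 < χ u → ¬ (v -ᶜ u) ∈ L) → arrivals L χ v ≡ 0
  arrivals-none L {χ} v none = ∑ᶜ-zero λ u → lemma u
    where
    lemma : ∀ u → count (v -ᶜ u) L * χ u ≡ 0
    lemma u with χ u in eq | count (v -ᶜ u) L in eq′
    ... | zero  | k     = ℕ.*-zeroʳ k
    ... | suc _ | zero  = refl
    ... | suc _ | suc _ = ⊥-elim (none u (subst (0 <_) (sym eq) (s≤s z≤n))
                                         (count-positive L (subst (0 <_) (sym eq′) (s≤s z≤n))))

  arrivals₁-none : ∀ δ {χ : C → ℕ} v → (∀ u → 0 < χ u → v -ᶜ u ≢ δ) → arrivals₁ δ χ v ≡ 0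
  arrivals₁-none δ {χ} v none = ∑ᶜ-zero λ u → lemma u
    where
    lemma : ∀ u → indicator (v -ᶜ u) δ * χ u ≡ 0
    lemma u with χ u in eq
    ... | zero  = ℕ.*-zeroʳ (indicator (v -ᶜ u) δ)
    ... | suc k = cong (_* suc k) (indicator-≢ (none u (subst (0 <_) (sym eq) (s≤s z≤n))))

  -- At most one cell sends grains to v in direction δ, namely v − δ.
  arrivals₁-≤1 : ∀ δ {χ : C → ℕ} v → (∀ u → χ u ≤ 1) → arrivals₁ δ χ v ≤ 1
  arrivals₁-≤1 δ {χ} v χ≤1 = ∑ᶜ-≤1
    (λ u → ℕ.*-mono-≤ (indicator-≤1 (v -ᶜ u) δ) (χ≤1 u))
    λ {u} {w} p q → -ᶜ-injectiveʳ v (trans (positive u p) (sym (positive w q)))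
    where
    positive : ∀ u → 0 < indicator (v -ᶜ u) δ * χ u → v -ᶜ u ≡ δ
    positive u p with indicator (v -ᶜ u) δ in eq
    ... | suc _ = indicator-positive (subst (0 <_) (sym eq) (s≤s z≤n))

  arrivals-≤length : ∀ L {χ : C → ℕ} v → (∀ u → χ u ≤ 1) → arrivals L χ v ≤ length L
  arrivals-≤length []      v χ≤1 = ℕ.≤-reflexive (∑ᶜ-zero {ℓ} {ℓ′} λ _ → refl)
  arrivals-≤length (δ ∷ L) {χ} v χ≤1 = subst (_≤ suc (length L)) (sym (arrivals-∷ δ L χ v))
    (ℕ.+-mono-≤ (arrivals₁-≤1 δ v χ≤1) (arrivals-≤length L v χ≤1))

  -- The occurrence of `δ` in `L` would need a source outside the grid, so it delivers nothing.
  arrivals-<length : ∀ {L δ} {χ : C → ℕ} v → (∀ u → χ u ≤ 1) → δ ∈ L → (∀ u → v -ᶜ u ≢ δ) →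
                     arrivals L χ v < length L
  arrivals-<length {δ ∷ L} {χ = χ} v χ≤1 (here refl) none =
    subst (_< suc (length L)) (sym (trans (arrivals-∷ δ L χ v) (cong (_+ arrivals L χ v) (arrivals₁-none δ {χ} v λ u _ → none u))))
      (s≤s (arrivals-≤length L v χ≤1))
  arrivals-<length {δ′ ∷ L} {χ = χ} v χ≤1 (there p) none =
    subst (_< suc (length L)) (sym (arrivals-∷ δ′ L χ v))
      (ℕ.+-mono-≤-< (arrivals₁-≤1 δ′ v χ≤1) (arrivals-<length {L} v χ≤1 p none))

-- Dynamics

H-≤1 : ∀ i → H i ≤ 1
H-≤1 (ℤ.+ _)  = s≤s z≤n
H-≤1 -[1+ _ ] = z≤n

H-≥ : ∀ {m n} → n ≤ m → H (m ⊖ n) ≡ 1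
H-≥ n≤m = cong H (ℤ.⊖-≥ n≤m)

H-< : ∀ {m n} → m < n → H (m ⊖ n) ≡ 0
H-< {m} {n} m<n = trans (cong H (ℤ.⊖-< m<n)) (lemma (ℕ.m<n⇒0<n∸m m<n))
  where
  lemma : ∀ {k} → 0 < k → H (ℤ.- (ℤ.+ k)) ≡ 0
  lemma (s≤s _) = refl

H-positive : ∀ {m n} → 0 < H (m ⊖ n) → n ≤ m
H-positive {m} {n} p with n ℕ.≤? m
... | yes n≤m = n≤m
... | no  n≰m = ⊥-elim (ℕ.n≮0 (subst (0 <_) (H-< (ℕ.≰⇒> n≰m)) p))

module _ {ℓ ℓ′ : ℕ} where

  private
    C : Set
    C = Cell ℓ ℓ′

  addGrain-at : ∀ (a : C) c → addGrain a c a ≡ suc (c a)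
  addGrain-at a c = cong (if_then suc (c a) else c a) (dec-true (a ≟ᶜ a) refl)

  addGrain-away : ∀ {a u : C} c → u ≢ a → addGrain a c u ≡ c u
  addGrain-away {a} {u} c u≢a = cong (if_then suc (c u) else c u) (dec-false (u ≟ᶜ a) u≢a)

  module Dynamics (𝒩 : Grid ℓ ℓ′) (c₀ : Config ℓ ℓ′) where

    at : ℕ → Config ℓ ℓ′
    at = fold c₀ (T 𝒩)

    topples-at : ℕ → C → ℕ
    topples-at t v = H (at t v ⊖ ∣ 𝒩 v ∣ₙ)

    Step : C → C → Set
    Step v w = (w -ᶜ v) ∈ elements (𝒩 v)

    unstable-≥ : ∀ {t u} → CellUnstable 𝒩 (at t) u → ∣ 𝒩 u ∣ₙ ≤ at t u
    unstable-≥ = ℕ.≮⇒≥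

  module _ (𝒩 : Grid ℓ ℓ′) {c : Config ℓ ℓ′} (stable : Stable 𝒩 c) (a : C) where

    open Dynamics 𝒩 (addGrain a c)

    private
      c₀ : Config ℓ ℓ′
      c₀ = addGrain a c

      initially : ∀ {u} → ∣ 𝒩 u ∣ₙ ≤ c₀ u → Star Step a u
      initially {u} le with u ≟ᶜ a
      ... | yes refl = ε
      ... | no  _    = ⊥-elim (ℕ.<⇒≱ (stable u) le)

      -- A grain that arrives comes from a cell that was unstable one step earlier, hence reachable
      -- by induction; while nothing arrives, a cell cannot exceed its initial content. After the
      -- grain is added, only `a` can be unstable.
      origin : ∀ t u → at t u ≤ c₀ u ⊎ Star Step a u
      unstable : ∀ t {u} → ∣ 𝒩 u ∣ₙ ≤ at t u → Star Step a u

      origin zero    u = inj₁ ℕ.≤-refl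
      origin (suc t) u with 0 ℕ.<? ∑ᶜ (λ v → mult (𝒩 v) (u -ᶜ v) * topples-at t v)
      ... | yes p =
        let v , q = ∑ᶜ-positive p
            m>0 = ℕ.>-nonZero⁻¹ _ {{ℕ.m*n≢0⇒m≢0 (mult (𝒩 v) (u -ᶜ v)) {{ℕ.>-nonZero q}}}}
            h>0 = ℕ.>-nonZero⁻¹ _ {{ℕ.m*n≢0⇒n≢0 (mult (𝒩 v) (u -ᶜ v)) {{ℕ.>-nonZero q}}}}
        in inj₂ (unstable t (H-positive h>0) ◅◅ (count-positive (elements (𝒩 v)) m>0 ◅ ε))
      ... | no ¬p with origin t u
      ...   | inj₂ q = inj₂ q
      ...   | inj₁ q = inj₁ (begin
        at t u ∸ d + s ≡⟨ cong (at t u ∸ d +_) (ℕ.n≤0⇒n≡0 (ℕ.≮⇒≥ ¬p)) ⟩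
        at t u ∸ d + 0 ≡⟨ ℕ.+-identityʳ _ ⟩
        at t u ∸ d     ≤⟨ ℕ.m∸n≤m (at t u) d ⟩
        at t u         ≤⟨ q ⟩
        c₀ u           ∎)
        where
        open ℕ.≤-Reasoning
        d = ∣ 𝒩 u ∣ₙ * topples-at t u
        s = ∑ᶜ (λ v → mult (𝒩 v) (u -ᶜ v) * topples-at t v)

      unstable t {u} le with origin t u
      ... | inj₁ q = initially (ℕ.≤-trans le q)
      ... | inj₂ q = q

    topples⇒reachable : ∀ {u} → Topples 𝒩 c₀ u → Star Step a u
    topples⇒reachable (t , u) = unstable t (unstable-≥ {t} u)

  -- Runs in which every cell topples at most once

  module Uniform (N : Neighborhood) (c₀ : Config ℓ ℓ′) where

    open Dynamics (uniform N) c₀ using (at; topples-at)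

    private
      θ : ℕ
      θ = ∣ N ∣ₙ

    -- Anticipates that no cell topples twice: a cell has fired as soon as its initial grains
    -- and one round of arrivals from each previously fired cell reach the threshold.
    fired : ℕ → C → ℕ
    fired zero    v = 0
    fired (suc t) v = H (c₀ v + arrivals (elements N) (fired t) v ⊖ θ)

    fired-≤1 : ∀ t v → fired t v ≤ 1
    fired-≤1 zero    v = z≤n
    fired-≤1 (suc t) v = H-≤1 _

    fired-mono : ∀ t v → fired t v ≤ fired (suc t) v
    fired-mono zero    v = z≤n
    fired-mono (suc t) v with θ ℕ.≤? c₀ v + arrivals (elements N) (fired t) v
    ... | no  θ≰ = subst (_≤ fired (suc (suc t)) v) (sym (H-< (ℕ.≰⇒> θ≰))) z≤n
    ... | yes θ≤ = subst₂ _≤_ (sym (H-≥ θ≤)) (sym (H-≥ (ℕ.≤-trans θ≤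
      (ℕ.+-monoʳ-≤ (c₀ v) (arrivals-mono (elements N) v (fired-mono t)))))) (s≤s z≤n)

    -- The initial grains together with one grain per element of the neighborhood do not pay for two
    -- topplings.
    module _ (bounded : ∀ v {χ : C → ℕ} → (∀ u → χ u ≤ 1) →
                        c₀ v + arrivals (elements N) χ v < θ + θ) where

      private
        arr : ℕ → C → ℕ
        arr t = arrivals (elements N) (fired t)

      mutual
        -- Balance of grains, with `fired t` read as the number of topplings before time `t`. That
        -- reading is `fired-suc`, which in turn takes the balance at time `t` as input; hence the
        -- mutual induction.
        conservation : ∀ t v → at t v + θ * fired t v ≡ c₀ v + arr t v
        conservation zero v = begin
          c₀ v + θ * 0  ≡⟨ cong (c₀ v +_) (ℕ.*-zeroʳ θ) ⟩
          c₀ v + 0      ≡⟨ cong (c₀ v +_) (arrivals-none (elements N) {λ _ → 0} v (λ _ ())) ⟨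
          c₀ v + arr 0 v ∎
          where open ≡-Reasoning
        conservation (suc t) v = begin
          (at t v ∸ θ * h + s) + θ * fired (suc t) v
            ≡⟨ cong (λ k → (at t v ∸ θ * h + s) + θ * k) (fired-suc t v) ⟨
          (at t v ∸ θ * h + s) + θ * (h + fired t v)
            ≡⟨ cong ((at t v ∸ θ * h + s) +_) (ℕ.*-distribˡ-+ θ h (fired t v)) ⟩
          (at t v ∸ θ * h + s) + (θ * h + θ * fired t v)
            ≡⟨ rearrange (at t v ∸ θ * h) s (θ * h) (θ * fired t v) ⟩
          (at t v ∸ θ * h + θ * h) + θ * fired t v + s
            ≡⟨ cong (λ k → k + θ * fired t v + s) (ℕ.m∸n+n≡m θh≤) ⟩
          at t v + θ * fired t v + s
            ≡⟨ cong (_+ s) (conservation t v) ⟩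
          c₀ v + arr t v + s
            ≡⟨ ℕ.+-assoc (c₀ v) _ _ ⟩
          c₀ v + (arr t v + s)
            ≡⟨ cong (c₀ v +_) (trans (ℕ.+-comm _ s) (sym (arrivals-+ (elements N) (topples-at t) (fired t) v))) ⟩
          c₀ v + arrivals (elements N) (λ u → topples-at t u + fired t u) v
            ≡⟨ cong (c₀ v +_) (∑ᶜ-cong λ u → cong (count (v -ᶜ u) (elements N) *_) (fired-suc t u)) ⟩
          c₀ v + arr (suc t) v ∎
          where
          open ≡-Reasoning
          h = topples-at t v
          s = arrivals (elements N) (topples-at t) v
          rearrange : ∀ a b c d → (a + b) + (c + d) ≡ (a + c) + d + b
          rearrange = ℕ-Solver.solve-∀
          θh≤ : θ * h ≤ at t v
          θh≤ with θ ℕ.≤? at t v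
          ... | yes p = subst (_≤ at t v) (sym (trans (cong (θ *_) (H-≥ p)) (ℕ.*-identityʳ θ))) p
          ... | no ¬p = subst (_≤ at t v) (sym (trans (cong (θ *_) (H-< (ℕ.≰⇒> ¬p))) (ℕ.*-zeroʳ θ))) z≤n

        -- A cell that has toppled once has lost θ grains, and stays stable from then on.
        fired-suc : ∀ t v → topples-at t v + fired t v ≡ fired (suc t) v
        fired-suc t v with fired t v in eq | conservation t v
        ... | zero  | e = trans (ℕ.+-identityʳ _)
          (cong (λ k → H (k ⊖ θ)) (trans (sym (trans (cong (at t v +_) (ℕ.*-zeroʳ θ)) (ℕ.+-identityʳ _))) e))
        ... | suc (suc _) | _ = ⊥-elim (ℕ.<⇒≱ (s≤s (s≤s z≤n)) (subst (_≤ 1) eq (fired-≤1 t v)))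
        ... | suc zero | e = trans (cong (_+ 1) (H-< at<θ))
          (ℕ.≤-antisym (subst (_≤ fired (suc t) v) eq (fired-mono t v)) (fired-≤1 (suc t) v))
          where
          at<θ : at t v < θ
          at<θ = ℕ.+-cancelʳ-< θ (at t v) θ (subst (_< θ + θ)
            (trans (sym e) (cong (at t v +_) (ℕ.*-identityʳ θ))) (bounded v (fired-≤1 t)))

      topples⇒fired : ∀ {u} → Topples (uniform N) c₀ u → ∃[ t ] 0 < fired t u
      topples⇒fired {u} (t , unstable) = suc t , subst (0 <_) (fired-suc t u)
        (ℕ.≤-trans (ℕ.≤-reflexive (sym (H-≥ (ℕ.≮⇒≥ unstable)))) (ℕ.m≤m+n _ _))

      fired⇒topples : ∀ t {u} → 0 < fired t u → Topples (uniform N) c₀ u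
      fired⇒topples (suc t) {u} p with θ ℕ.≤? at t u
      ... | yes θ≤ = t , ℕ.≤⇒≯ θ≤
      ... | no  θ≰ = fired⇒topples t (subst (0 <_) (trans (sym (fired-suc t u)) (cong (_+ fired t u) (H-< (ℕ.≰⇒> θ≰)))) p)

-- Edges and depths

component : Axis → ℤ² → ℤ
component westEast   = proj₁
component southNorth = proj₂

orientation : Edge → ℤ
orientation west  = 1ℤ
orientation east  = -1ℤ
orientation south = 1ℤ
orientation north = -1ℤ

-- The component along the inward normal of `E`: positive for directions that lead away from `E`
-- into the grid.
along : Edge → ℤ² → ℤ
along E δ = orientation E ℤ.* component (axis E) δ

∣orientation∣ : ∀ E → ∣ orientation E ∣ ≡ 1
∣orientation∣ west  = refl
∣orientation∣ east  = refl
∣orientation∣ south = refl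
∣orientation∣ north = refl

along-injective : ∀ E {δ δ′} → along E δ ≡ along E δ′ → component (axis E) δ ≡ component (axis E) δ′
along-injective west  = ℤ.*-cancelˡ-≡ 1ℤ _ _
along-injective east  = ℤ.*-cancelˡ-≡ -1ℤ _ _
along-injective south = ℤ.*-cancelˡ-≡ 1ℤ _ _
along-injective north = ℤ.*-cancelˡ-≡ -1ℤ _ _

both-axes : ∀ {Q : Axis → Set} {α β} → α ≢ β → Q α → Q β → Q westEast × Q southNorth
both-axes {α = westEast}   {westEast}   α≢β _ _ = ⊥-elim (α≢β refl)
both-axes {α = westEast}   {southNorth} α≢β p q = p , q
both-axes {α = southNorth} {westEast}   α≢β p q = q , p
both-axes {α = southNorth} {southNorth} α≢β _ _ = ⊥-elim (α≢β refl)

module Oriented {A B : Edge} (A≢B : axis A ≢ axis B) where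

  -- Reflections and a swap of axes turn `B` into the west edge and `A` into the south edge, so one
  -- choice of directions stands for all. Determinants change at most their sign.
  oriented : ℤ² → ℤ²
  oriented δ = along B δ , along A δ

  oriented-injective : ∀ {δ δ′} → oriented δ ≡ oriented δ′ → δ ≡ δ′
  oriented-injective {δ} {δ′} eq =
    let p , q = both-axes {λ α → component α δ ≡ component α δ′} A≢B
                  (along-injective A (cong proj₂ eq)) (along-injective B (cong proj₁ eq))
    in cong₂ _,_ p q

  ∣cross-oriented∣ : ∀ δ δ′ → ∣ cross (oriented δ) (oriented δ′) ∣ ≡ ∣ cross δ δ′ ∣
  ∣cross-oriented∣ δ δ′ = begin
    ∣ cross (oriented δ) (oriented δ′) ∣
      ≡⟨ cong ∣_∣ (identity (orientation B) (orientation A) (component (axis B) δ) (component (axis A) δ) (component (axis B) δ′) (component (axis A) δ′)) ⟩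
    ∣ orientation B ℤ.* orientation A ℤ.* unoriented ∣
      ≡⟨ ℤ.abs-* (orientation B ℤ.* orientation A) unoriented ⟩
    ∣ orientation B ℤ.* orientation A ∣ * ∣ unoriented ∣
      ≡⟨ cong (_* ∣ unoriented ∣) (trans (ℤ.abs-* (orientation B) (orientation A)) (cong₂ _*_ (∣orientation∣ B) (∣orientation∣ A))) ⟩
    1 * ∣ unoriented ∣
      ≡⟨ ℕ.*-identityˡ _ ⟩
    ∣ unoriented ∣
      ≡⟨ components (axis A) (axis B) A≢B ⟩
    ∣ cross δ δ′ ∣ ∎
    where
    open ≡-Reasoning
    unoriented = cross (component (axis B) δ , component (axis A) δ) (component (axis B) δ′ , component (axis A) δ′)
    identity : ∀ σ τ a b c d → (σ ℤ.* a) ℤ.* (τ ℤ.* d) ℤ.- (τ ℤ.* b) ℤ.* (σ ℤ.* c) ≡ σ ℤ.* τ ℤ.* (a ℤ.* d ℤ.- b ℤ.* c)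
    identity = ℤ-Solver.solve-∀
    swap-identity : ∀ a b c d → ℤ.- (a ℤ.* d ℤ.- b ℤ.* c) ≡ b ℤ.* c ℤ.- a ℤ.* d
    swap-identity = ℤ-Solver.solve-∀
    components : ∀ α β → α ≢ β →
      ∣ cross (component β δ , component α δ) (component β δ′ , component α δ′) ∣ ≡ ∣ cross δ δ′ ∣
    components westEast   westEast   α≢β = ⊥-elim (α≢β refl)
    components southNorth southNorth α≢β = ⊥-elim (α≢β refl)
    components southNorth westEast   α≢β = refl
    components westEast   southNorth α≢β = trans
      (cong ∣_∣ (sym (swap-identity (proj₁ δ) (proj₂ δ) (proj₁ δ′) (proj₂ δ′)))) (ℤ.∣-i∣≡∣i∣ (cross δ δ′))

opposite-+ : ∀ {n} (i : Fin n) → Fin.toℕ (Fin.opposite i) + suc (Fin.toℕ i) ≡ n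
opposite-+ i = trans (cong (_+ suc (Fin.toℕ i)) (Fin.opposite-prop i)) (ℕ.m∸n+n≡m (Fin.toℕ<n i))

module _ {ℓ ℓ′ : ℕ} where

  private
    C : Set
    C = Cell ℓ ℓ′

  length-along : Axis → ℕ
  length-along westEast   = ℓ
  length-along southNorth = ℓ′

  depth : Edge → C → ℕ
  depth west  u = Fin.toℕ (proj₁ u)
  depth east  u = Fin.toℕ (Fin.opposite (proj₁ u))
  depth south u = Fin.toℕ (proj₂ u)
  depth north u = Fin.toℕ (Fin.opposite (proj₂ u))

  depth< : ∀ E u → depth E u < length-along (axis E)
  depth< west  u = Fin.toℕ<n (proj₁ u)
  depth< east  u = Fin.toℕ<n (Fin.opposite (proj₁ u))
  depth< south u = Fin.toℕ<n (proj₂ u)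
  depth< north u = Fin.toℕ<n (Fin.opposite (proj₂ u))

  private
    near : ∀ m n → 1ℤ ℤ.* (ℤ.+ suc m ℤ.- ℤ.+ suc n) ≡ ℤ.+ m ℤ.- ℤ.+ n
    near m n = identity (ℤ.+ m) (ℤ.+ n)
      where
      identity : ∀ i j → 1ℤ ℤ.* ((1ℤ ℤ.+ i) ℤ.- (1ℤ ℤ.+ j)) ≡ i ℤ.- j
      identity = ℤ-Solver.solve-∀
    far : ∀ {n} (i j : Fin n) → -1ℤ ℤ.* (ℤ.+ suc (Fin.toℕ i) ℤ.- ℤ.+ suc (Fin.toℕ j)) ≡
                                ℤ.+ Fin.toℕ (Fin.opposite i) ℤ.- ℤ.+ Fin.toℕ (Fin.opposite j)
    far i j = trans (identity₁ (ℤ.+ suc (Fin.toℕ i)) (ℤ.+ suc (Fin.toℕ j)) d)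
      (trans (cong (λ n → d ℤ.+ ℤ.+ suc (Fin.toℕ j) ℤ.- ℤ.+ n) (trans (opposite-+ i) (sym (opposite-+ j))))
             (identity₂ d (ℤ.+ suc (Fin.toℕ j)) (ℤ.+ Fin.toℕ (Fin.opposite j))))
      where
      d = ℤ.+ Fin.toℕ (Fin.opposite i)
      identity₁ : ∀ i j d → -1ℤ ℤ.* (i ℤ.- j) ≡ d ℤ.+ j ℤ.- (d ℤ.+ i)
      identity₁ = ℤ-Solver.solve-∀
      identity₂ : ∀ d j e → d ℤ.+ j ℤ.- (e ℤ.+ j) ≡ d ℤ.- e
      identity₂ = ℤ-Solver.solve-∀

  along-difference : ∀ E u v → along E (u -ᶜ v) ≡ ℤ.+ depth E u ℤ.- ℤ.+ depth E v
  along-difference west  u v = near (Fin.toℕ (proj₁ u)) (Fin.toℕ (proj₁ v))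
  along-difference east  u v = far (proj₁ u) (proj₁ v)
  along-difference south u v = near (Fin.toℕ (proj₂ u)) (Fin.toℕ (proj₂ v))
  along-difference north u v = far (proj₂ u) (proj₂ v)

  private
    far-zero : ∀ {n} (i : Fin n) → suc (Fin.toℕ i) ≡ n → Fin.toℕ (Fin.opposite i) ≡ 0
    far-zero i eq = ℕ.+-cancelʳ-≡ (suc (Fin.toℕ i)) _ _ (trans (opposite-+ i) (sym eq))
    zero-far : ∀ {n} (i : Fin n) → Fin.toℕ (Fin.opposite i) ≡ 0 → suc (Fin.toℕ i) ≡ n
    zero-far i eq = trans (cong (_+ suc (Fin.toℕ i)) (sym eq)) (opposite-+ i)
    far-last : ∀ {n} (i : Fin n) → suc (Fin.toℕ i) ≡ 1 → suc (Fin.toℕ (Fin.opposite i)) ≡ n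
    far-last i eq = trans (ℕ.+-comm 1 _) (trans (cong (Fin.toℕ (Fin.opposite i) +_) (sym eq)) (opposite-+ i))
    last-far : ∀ {n} (i : Fin n) → suc (Fin.toℕ (Fin.opposite i)) ≡ n → suc (Fin.toℕ i) ≡ 1
    last-far i eq = ℕ.+-cancelˡ-≡ (Fin.toℕ (Fin.opposite i)) _ _ (trans (opposite-+ i) (trans (sym eq) (ℕ.+-comm 1 _)))

  on⇒depth : ∀ E {u} → u on E → depth E u ≡ 0
  on⇒depth west  = ℕ.suc-injective
  on⇒depth east  {u} = far-zero (proj₁ u)
  on⇒depth south = ℕ.suc-injective
  on⇒depth north {u} = far-zero (proj₂ u)

  depth⇒on : ∀ E {u} → depth E u ≡ 0 → u on E
  depth⇒on west  = cong suc
  depth⇒on east  {u} = zero-far (proj₁ u)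
  depth⇒on south = cong suc
  depth⇒on north {u} = zero-far (proj₂ u)

  on-opposite⇒depth : ∀ E {u} → u on opposite E → suc (depth E u) ≡ length-along (axis E)
  on-opposite⇒depth west  p = p
  on-opposite⇒depth east  {u} = far-last (proj₁ u)
  on-opposite⇒depth south p = p
  on-opposite⇒depth north {u} = far-last (proj₂ u)

  depth⇒on-opposite : ∀ E {u} → suc (depth E u) ≡ length-along (axis E) → u on opposite E
  depth⇒on-opposite west  p = p
  depth⇒on-opposite east  {u} = last-far (proj₁ u)
  depth⇒on-opposite south p = p
  depth⇒on-opposite north {u} = last-far (proj₂ u)

  depth<-opposite : ∀ E {u v} → ¬ u on opposite E → v on opposite E → depth E u < depth E v
  depth<-opposite E {u} ¬p q = ℕ.s<s⁻¹ (subst (suc (depth E u) <_) (sym (on-opposite⇒depth E q))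
    (ℕ.≤∧≢⇒< (depth< E u) (¬p ∘ depth⇒on-opposite E)))

  module Position {A B : Edge} (A≢B : axis A ≢ axis B) where

    open Oriented A≢B public

    position : C → ℤ²
    position u = ℤ.+ depth B u , ℤ.+ depth A u

    oriented-difference : ∀ u v → oriented (v -ᶜ u) ≡ difference position u v
    oriented-difference u v = cong₂ _,_ (along-difference B v u) (along-difference A v u)

    position-injective : ∀ {u v} → position u ≡ position v → u ≡ v
    position-injective {u} {v} eq = -ᶜ-injectiveˡ u (oriented-injective (begin
      oriented (u -ᶜ u)        ≡⟨ oriented-difference u u ⟩
      position u ⊝ position u  ≡⟨ cong (_⊝ position u) eq ⟩
      position v ⊝ position u  ≡⟨ oriented-difference u v ⟨
      oriented (v -ᶜ u)        ∎))
      where open ≡-Reasoning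

-- Disjoint crossing paths force a large determinant

Spanning : List ℤ² → Set
Spanning P = ∃[ δ ] ∃[ δ′ ] δ ∈ P × δ′ ∈ P × 2 ≤ ∣ cross δ δ′ ∣

-- The geometric argument only refutes that all determinants are small; deciding the matter over the
-- finite list turns this into an actual pair.
spanning? : ∀ P → Spanning P ⊎ (∀ {δ δ′} → δ ∈ P → δ′ ∈ P → ∣ cross δ δ′ ∣ ≤ 1)
spanning? P with any? (λ δ → any? (λ δ′ → 2 ℕ.≤? ∣ cross δ δ′ ∣) P) P
... | yes p = let δ , δ∈P , q = find p
                  δ′ , δ′∈P , r = find q
              in inj₁ (δ , δ′ , δ∈P , δ′∈P , r)
... | no ¬p = inj₂ λ δ∈P δ′∈P → ℕ.≮⇒≥ λ r → ¬p (lose δ∈P (lose δ′∈P r))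

-- Colours are predicates on cells because the gates supply disjoint sets of toppled cells, within
-- which the paths run.
record DisjointPaths (P : List ℤ²) {ℓ ℓ′} (A B : Edge) : Set₁ where
  field
    a a′ b b′  : Cell ℓ ℓ′
    a-on-A     : a on A
    a′-on-A′   : a′ on opposite A
    b-on-B     : b on B
    b′-on-B′   : b′ on opposite B
    Red Blue   : Cell ℓ ℓ′ → Set
    disjoint   : ∀ {u} → Red u → Blue u → ⊥
    red-avoids  : ∀ {u} → Red u → ¬ u on opposite B
    blue-avoids : ∀ {u} → Blue u → ¬ u on opposite A
    -- Colours are attached to steps, so an empty blue path would say nothing about `b′`.
    blue-end    : Blue b′
    red-path    : Star (λ u v → (Red u × Red v) × (v -ᶜ u) ∈ P) a a′
    blue-path   : Star (λ u v → (Blue u × Blue v) × (v -ᶜ u) ∈ P) b b′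

disjointPaths⇒spanning : ∀ {P ℓ ℓ′ A B} → axis A ≢ axis B → DisjointPaths P {ℓ} {ℓ′} A B → Spanning P
disjointPaths⇒spanning {P} {ℓ} {ℓ′} {A} {B} A≢B paths with spanning? P
... | inj₁ p = p
... | inj₂ small = ⊥-elim (no-disjoint-crossing position distinct₄
    (λ { {u} {u′} {w} {w′} (_ , p) (_ , q) → subst (_≤ 1) (trans (sym (∣cross-oriented∣ (u′ -ᶜ u) (w′ -ᶜ w)))
           (cong ∣_∣ (cong₂ cross (oriented-difference u u′) (oriented-difference w w′)))) (small p q) })
    red-path blue-path
    (λ u → subst (λ k → ℤ.+ k ℤ.≤ ℤ.+ depth B u) (sym (on⇒depth B b-on-B)) (ℤ.+≤+ z≤n))
    (λ u → subst (λ k → ℤ.+ k ℤ.≤ ℤ.+ depth A u) (sym (on⇒depth A a-on-A)) (ℤ.+≤+ z≤n))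
    (λ { ((p , q) , _) → ℤ.+<+ (depth<-opposite B (red-avoids p) b′-on-B′) , ℤ.+<+ (depth<-opposite B (red-avoids q) b′-on-B′) })
    (λ { ((p , q) , _) → ℤ.+<+ (depth<-opposite A (blue-avoids p) a′-on-A′) , ℤ.+<+ (depth<-opposite A (blue-avoids q) a′-on-A′) })
    (ℤ.+<+ (depth<-opposite A (blue-avoids blue-end) a′-on-A′)))
  where
  open DisjointPaths paths
  open Position {ℓ} {ℓ′} A≢B
  distinct : ∀ {u w} → Red u → Blue w → NonZero² (difference position u w)
  distinct {u} {w} p q eq = disjoint p (subst Blue (position-injective (cong₂ _,_
    (ℤ.i-j≡0⇒i≡j _ _ (cong proj₁ eq)) (ℤ.i-j≡0⇒i≡j _ _ (cong proj₂ eq)))) q)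
  distinct₄ : ∀ {u u′ w w′} → (Red u × Red u′) × (u′ -ᶜ u) ∈ P → (Blue w × Blue w′) × (w′ -ᶜ w) ∈ P → _
  distinct₄ ((p , p′) , _) ((q , q′) , _) = distinct p q , distinct p′ q , distinct p q′ , distinct p′ q′

-- From gates to disjoint paths

deterministic-comparable : ∀ {C : Set} {R : Rel C 0ℓ} → (∀ {u v w} → R u v → R u w → v ≡ w) →
                           ∀ {u v w} → Star R u v → Star R u w → Star R v w ⊎ Star R w v
deterministic-comparable det ε q = inj₁ q
deterministic-comparable det p ε = inj₂ p
deterministic-comparable det (r ◅ p) (s ◅ q) with refl ← det r s = deterministic-comparable det p q

-- Lying between the two ends is the colour of a cell in the primal case, so every step has to carry
-- it for both of its cells.
reachable-between : ∀ {C : Set} {R : Rel C 0ℓ} {a u a′} → Star R a u → Star R u a′ →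
  Star (λ v w → ((Star R a v × Star R v a′) × (Star R a w × Star R w a′)) × R v w) u a′
reachable-between p ε = ε
reachable-between p (r ◅ q) = (((p , r ◅ q) , (p′ , q)) , r) ◅ reachable-between p′ q
  where p′ = p ◅◅ (r ◅ ε)

module _ {ℓ ℓ′ : ℕ} where

  private
    C : Set
    C = Cell ℓ ℓ′

  module PrimalGrid (𝒩 : Grid ℓ ℓ′) (single : ∀ v → ∣ 𝒩 v ∣ₙ ≡ 1) where

    Next : C → C → Set
    Next v w = (w -ᶜ v) ∈ elements (𝒩 v)

    Next-deterministic : ∀ {u v w} → Next u v → Next u w → v ≡ w
    Next-deterministic {u} {v} {w} p q = -ᶜ-injectiveˡ u (unique (elements (𝒩 u)) (single u) p q)
      where
      unique : ∀ L {δ δ′ : ℤ²} → length L ≡ 1 → δ ∈ L → δ′ ∈ L → δ ≡ δ′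
      unique (_ ∷ []) _ (here refl) (here refl) = refl

    module _ (c₀ : Config ℓ ℓ′) where

      open Dynamics 𝒩 c₀ using (at; topples-at)

      topples-next : ∀ {u w} → Topples 𝒩 c₀ u → Next u w → Topples 𝒩 c₀ w
      topples-next {u} {w} (t , unstable) r = suc t , ℕ.≤⇒≯ (begin
        ∣ 𝒩 w ∣ₙ                            ≡⟨ single w ⟩
        1 * 1                               ≤⟨ ℕ.*-mono-≤ (∈⇒count r) (ℕ.≤-reflexive (sym (H-≥ (ℕ.≮⇒≥ unstable)))) ⟩
        mult (𝒩 u) (w -ᶜ u) * topples-at t u ≤⟨ ∑ᶜ-term (λ v → mult (𝒩 v) (w -ᶜ v) * topples-at t v) u ⟩
        ∑ᶜ (λ v → mult (𝒩 v) (w -ᶜ v) * topples-at t v) ≤⟨ ℕ.m≤n+m _ (at t w ∸ ∣ 𝒩 w ∣ₙ * topples-at t w) ⟩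
        at (suc t) w                        ∎)
        where open ℕ.≤-Reasoning

      topples-reachable : ∀ {u w} → Topples 𝒩 c₀ u → Star Next u w → Topples 𝒩 c₀ w
      topples-reachable p ε       = p
      topples-reachable p (r ◅ q) = topples-reachable (topples-next p r) q

    source-topples : ∀ (a : C) c → Topples 𝒩 (addGrain a c) a
    source-topples a c = 0 , ℕ.≤⇒≯ (subst₂ _≤_ (sym (single a)) (sym (addGrain-at a c)) (s≤s z≤n))

    reachable⇒topples : ∀ {a u} c → Star Next a u → Topples 𝒩 (addGrain a c) u
    reachable⇒topples {a} c = topples-reachable (addGrain a c) (source-topples a c)

  primal⇒disjointPaths : ∀ {P 𝒩 A B c} → Primal P 𝒩 → IsCrossingGateFor 𝒩 A B c → DisjointPaths P {ℓ} {ℓ′} A B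
  primal⇒disjointPaths {P} {𝒩} {A} {B} {c} primal gate = record
    { a = a ; a′ = a′ ; b = b ; b′ = b′
    ; a-on-A = a-on-A ; a′-on-A′ = a′-on-A′ ; b-on-B = b-on-B ; b′-on-B′ = b′-on-B′
    ; Red = λ u → Star Next a u × Star Next u a′
    ; Blue = λ u → Star Next b u × Star Next u b′
    ; disjoint = disjoint
    ; red-avoids = λ { {u} (p , _) e → B′-not-toppled u e (reachable⇒topples c p) }
    ; blue-avoids = λ { {u} (p , _) e → A′-not-toppled u e (reachable⇒topples c p) }
    ; blue-end = b⇝b′ , ε
    ; red-path = Star.map (λ { (p , r) → p , proj₁ (primal _) r }) (reachable-between ε a⇝a′)
    ; blue-path = Star.map (λ { (p , r) → p , proj₁ (primal _) r }) (reachable-between ε b⇝b′)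
    }
    where
    open IsCrossingGateFor gate
    open PrimalGrid 𝒩 (proj₂ ∘ primal)
    a⇝a′ : Star Next a a′
    a⇝a′ = topples⇒reachable 𝒩 stable a a′-topples
    b⇝b′ : Star Next b b′
    b⇝b′ = topples⇒reachable 𝒩 stable b b′-topples
    disjoint : ∀ {u} → Star Next a u × Star Next u a′ → Star Next b u × Star Next u b′ → ⊥
    disjoint (p , q) (p′ , q′) with deterministic-comparable Next-deterministic q q′
    ... | inj₁ r = B′-not-toppled b′ b′-on-B′ (reachable⇒topples c (a⇝a′ ◅◅ r))
    ... | inj₂ r = A′-not-toppled a′ a′-on-A′ (reachable⇒topples c (b⇝b′ ◅◅ r))

  not-into-edge : ∀ E {a : C} {δ} → a on E → 0ℤ ℤ.< along E δ → ∀ (u : C) → a -ᶜ u ≢ δ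
  not-into-edge E {a} {δ} a-on-E 0<δ u refl = ℤ.<⇒≱ 0<δ (subst (ℤ._≤ 0ℤ)
    (sym (trans (along-difference E a u) (cong (λ k → ℤ.+ k ℤ.- ℤ.+ depth E u) (on⇒depth E a-on-E))))
    (ℤ.i≤j⇒i-j≤0 {0ℤ} {ℤ.+ depth E u} (ℤ.+≤+ z≤n)))

  module UniformGrid (N : Neighborhood) {c : Config ℓ ℓ′} (stable : Stable (uniform N) c) where

    private
      θ : ℕ
      θ = ∣ N ∣ₙ

      L : List ℤ²
      L = elements N

    -- The cell `a` may hold `θ` grains but receives fewer than `θ`, since nothing comes in through
    -- `δ`; any other cell holds fewer than `θ` and receives at most `θ`.
    bounded : ∀ {a : C} {δ} → δ ∈ L → (∀ u → a -ᶜ u ≢ δ) →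
              ∀ v {χ : C → ℕ} → (∀ u → χ u ≤ 1) → addGrain a c v + arrivals L χ v < θ + θ
    bounded {a} δ∈L none v χ≤1 with v ≟ᶜ a
    ... | yes refl = ℕ.+-mono-≤-< (stable a) (arrivals-<length a χ≤1 δ∈L none)
    ... | no  _    = ℕ.+-mono-<-≤ (stable v) (arrivals-≤length L v χ≤1)

    -- Only through a direction δ with along E δ > 0 can the grains leave the edge E,
    -- and no cell of the grid sends grains to the edge E in such a direction.
    exit-direction : ∀ E {u v : C} → depth E u < depth E v → Star (λ x y → (y -ᶜ x) ∈ L) u v →
                     ∃[ δ ] δ ∈ L × 0ℤ ℤ.< along E δ
    exit-direction E u<v ε = ⊥-elim (ℕ.<-irrefl refl u<v)
    exit-direction E {u} {v} u<v (_◅_ {j = w} r p) with depth E w ℕ.≤? depth E u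
    ... | yes w≤u = exit-direction E (ℕ.≤-<-trans w≤u u<v) p
    ... | no  w≰u = w -ᶜ u , r , subst (0ℤ ℤ.<_) (sym (along-difference E w u))
      (i<j⇒0<j-i (ℤ.+<+ (ℕ.≰⇒> w≰u)))

    module Source (a : C) where
      open Uniform N (addGrain a c) public

    fired-mono* : ∀ a {s} t {u} → s ≤ t → Source.fired a s u ≤ Source.fired a t u
    fired-mono* a {s} t s≤t with ℕ.m≤n⇒∃[o]m+o≡n s≤t
    ... | k , refl = lemma k
      where
      lemma : ∀ k {u} → Source.fired a s u ≤ Source.fired a (s + k) u
      lemma zero rewrite ℕ.+-identityʳ s = ℕ.≤-refl
      lemma (suc k) rewrite ℕ.+-suc s k = ℕ.≤-trans (lemma k) (Source.fired-mono a (s + k) _)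

    -- The process `χ` is a rival of the run from `a`. By `slow` it fires every cell that its own
    -- arrivals make unstable on top of `c`, so whatever it misses must be due to the grain at `a`.
    module _ (a : C) {χ : ℕ → C → ℕ} (χ-mono : ∀ t u → χ t u ≤ χ (suc t) u)
      (slow : ∀ t v → ¬ 0 < χ (suc t) v → c v + arrivals L (χ t) v < θ) (s T : ℕ) where

      open Source a using (fired; fired-≤1; fired-mono)

      -- The rival gets a head start of `s` steps: a cell that it misses at time `t + s` is also
      -- missed at time `s`. This one set of cells therefore serves at all times.
      Ahead : C → Set
      Ahead u = 0 < fired T u × ¬ 0 < χ s u

      private
        χ-mono* : ∀ t u → χ s u ≤ χ (t + s) u
        χ-mono* zero    u = ℕ.≤-refl
        χ-mono* (suc t) u = ℕ.≤-trans (χ-mono* t u) (χ-mono (t + s) u)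

      ahead : ∀ {t v} → t ≤ T → 0 < fired t v → ¬ 0 < χ (t + s) v → Ahead v
      ahead t≤T p ¬q = ℕ.≤-trans p (fired-mono* a T t≤T) , λ q → ¬q (ℕ.≤-trans q (χ-mono* _ _))

      -- A cell v ≠ a that fires in the run from a, but not in the delayed process χ,
      -- has received grains from a cell with the same property one step earlier.
      ahead-predecessor : ∀ t {v} → v ≢ a → 0 < fired (suc t) v → ¬ 0 < χ (suc t + s) v →
                          ∃[ u ] 0 < fired t u × ¬ 0 < χ (t + s) u × (v -ᶜ u) ∈ L
      ahead-predecessor t {v} v≢a p ¬q =
        let u , u-ahead = ∑ᶜ-exceeds (ℕ.+-cancelˡ-< (c v) _ _ (ℕ.<-≤-trans (slow (t + s) v ¬q)
              (subst (θ ≤_) (cong (_+ arrivals L (fired t) v) (addGrain-away c v≢a)) (H-positive p))))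
        in u , split (count (v -ᶜ u) L) (count-positive L) (fired-≤1 t u) u-ahead
        where
        split : ∀ n {X : Set} → (0 < n → X) → ∀ {f g} → f ≤ 1 → n * g < n * f → 0 < f × ¬ 0 < g × X
        split zero    _ _ ()
        split (suc n) x f≤1 lt =
          let g<f = ℕ.*-cancelˡ-< (suc n) _ _ lt in
          ℕ.≤-<-trans z≤n g<f , (λ 0<g → ℕ.<⇒≱ (ℕ.≤-<-trans 0<g g<f) f≤1) , x (s≤s z≤n)

      -- Predecessors are followed back in time. Nothing has fired at time 0, so the descent can
      -- only stop at `a`.
      ahead-path : ∀ t {v} → t ≤ T → 0 < fired t v → ¬ 0 < χ (t + s) v →
                   Star (λ u w → (Ahead u × Ahead w) × (w -ᶜ u) ∈ L) a v
      ahead-path (suc t) {v} t<T p ¬q = extend (v ≟ᶜ a)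
        where
        t≤T = ℕ.≤-trans (ℕ.n≤1+n t) t<T
        extend : Dec (v ≡ a) → Star (λ u w → (Ahead u × Ahead w) × (w -ᶜ u) ∈ L) a v
        extend (yes refl) = ε
        extend (no v≢a)   =
          let u , p′ , ¬q′ , r = ahead-predecessor t v≢a p ¬q
          in ahead-path t t≤T p′ ¬q′ ◅◅ (((ahead t≤T p′ ¬q′ , ahead t<T p ¬q) , r) ◅ ε)

  weighted⇒disjointPaths : ∀ {P N A B c} → elements N ⊆ P → axis A ≢ axis B →
                           IsCrossingGateFor (uniform {ℓ} {ℓ′} N) A B c → DisjointPaths P {ℓ} {ℓ′} A B
  weighted⇒disjointPaths {P} {N} {A} {B} {c} N⊆P A≢B gate = record
    { a = a ; a′ = a′ ; b = b ; b′ = b′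
    ; a-on-A = a-on-A ; a′-on-A′ = a′-on-A′ ; b-on-B = b-on-B ; b′-on-B′ = b′-on-B′
    ; Red = Red
    ; Blue = Blue
    ; disjoint = λ { (_ , ¬p) (p , _) → ¬p p }
    ; red-avoids = λ { {u} (p , _) e → B′-not-toppled u e (Source.fired⇒topples a bounded-a Tᵃ p) }
    ; blue-avoids = λ { {u} (p , _) e → A′-not-toppled u e (Source.fired⇒topples b bounded-b Tᵇ p) }
    ; blue-end = b′-fired , λ ()
    ; red-path = Star.map (λ { (q , r) → q , N⊆P r }) (ahead-path a (Source.fired-mono b) slow Tᵇ Tᵃ Tᵃ ℕ.≤-refl a′-fired
        λ p → A′-not-toppled a′ a′-on-A′ (Source.fired⇒topples b bounded-b (Tᵃ + Tᵇ) p))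
    ; blue-path = Star.map (λ { (q , r) → q , N⊆P r }) (ahead-path b {λ _ _ → 0} (λ _ _ → z≤n) idle 0 Tᵇ Tᵇ ℕ.≤-refl b′-fired λ ())
    }
    where
    open IsCrossingGateFor gate
    open UniformGrid N stable
    off : ∀ {E F} {u : Cell ℓ ℓ′} → axis E ≢ axis F → u on E → ¬ Corner u → 0 < depth F u
    off {E} {F} E≢F e ¬corner = ℕ.n≢0⇒n>0 λ d≡0 → ¬corner (E , F , E≢F , e , depth⇒on F d≡0)
    -- A non-corner cell of `E` has positive depth from `F`. The grid is thus at least two cells
    -- long in that axis, and a path from `F` to its opposite edge really has to leave `F`.
    spread : ∀ {E F u v w} → axis E ≢ axis F → u on E → ¬ Corner u → v on F → w on opposite F → depth F v < depth F w
    spread {E} {F} {u} {v} {w} E≢F e ¬corner v-on-F w-on-F′ = subst (_< depth F w) (sym (on⇒depth F v-on-F))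
      (ℕ.≤-trans (off {E} {F} E≢F e ¬corner) (ℕ.s≤s⁻¹ (subst (depth F u <_) (sym (on-opposite⇒depth F w-on-F′)) (depth< F u))))
    bounded-a = let δ , δ∈N , 0<δ = exit-direction A (spread {B} {A} (A≢B ∘ sym) b-on-B b-nonCorner a-on-A a′-on-A′)
                                      (topples⇒reachable (uniform N) stable a a′-topples)
                in bounded δ∈N (not-into-edge A a-on-A 0<δ)
    bounded-b = let δ , δ∈N , 0<δ = exit-direction B (spread {A} {B} A≢B a-on-A a-nonCorner b-on-B b′-on-B′)
                                      (topples⇒reachable (uniform N) stable b b′-topples)
                in bounded δ∈N (not-into-edge B b-on-B 0<δ)
    fired-a′ = Source.topples⇒fired a bounded-a a′-topples
    fired-b′ = Source.topples⇒fired b bounded-b b′-topples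
    Tᵃ = proj₁ fired-a′
    Tᵇ = proj₁ fired-b′
    a′-fired = proj₂ fired-a′
    b′-fired = proj₂ fired-b′
    slow : ∀ t v → ¬ 0 < Source.fired b (suc t) v → c v + arrivals (elements N) (Source.fired b t) v < ∣ N ∣ₙ
    slow t v ¬p = ℕ.≰⇒> λ θ≤ → ¬p (subst (0 <_) (sym (H-≥ (ℕ.≤-trans θ≤
      (ℕ.+-monoˡ-≤ (arrivals (elements N) (Source.fired b t) v) (increases v))))) (s≤s z≤n))
      where
      increases : ∀ v → c v ≤ addGrain b c v
      increases v with v ≟ᶜ b
      ... | yes refl = ℕ.n≤1+n (c b)
      ... | no  _    = ℕ.≤-refl
    idle : ∀ (t : ℕ) v → ¬ 0 < 0 → c v + arrivals (elements N) (λ _ → 0) v < ∣ N ∣ₙ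
    idle _ v _ = subst (_< ∣ N ∣ₙ) (sym (trans (cong (c v +_) (arrivals-none (elements N) v λ _ ())) (ℕ.+-identityʳ _))) (stable v)
    -- `Blue` is everything fired from `b` by time `Tᵇ`, the rival being one that never fires. For
    -- `Red` the rival is the run from `b` with head start `Tᵇ`, which makes the two sets disjoint
    -- by construction.
    Red Blue : Cell ℓ ℓ′ → Set
    Red = Ahead a (Source.fired-mono b) slow Tᵇ Tᵃ
    Blue = Ahead b {λ _ _ → 0} (λ _ _ → z≤n) idle 0 Tᵇ

-- Paths with two kinds of steps

module Lattice (δ₁ δ₂ : ℤ²) where

  combination : ℤ → ℤ → ℤ²
  combination x y = x ℤ.* proj₁ δ₁ ℤ.+ y ℤ.* proj₁ δ₂ , x ℤ.* proj₂ δ₁ ℤ.+ y ℤ.* proj₂ δ₂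

  combination-⊕ : ∀ x y x′ y′ → combination x y ⊕ combination x′ y′ ≡ combination (x ℤ.+ x′) (y ℤ.+ y′)
  combination-⊕ x y x′ y′ = cong₂ _,_ (identity x y x′ y′ (proj₁ δ₁) (proj₁ δ₂)) (identity x y x′ y′ (proj₂ δ₁) (proj₂ δ₂))
    where
    identity : ∀ x y x′ y′ i j → x ℤ.* i ℤ.+ y ℤ.* j ℤ.+ (x′ ℤ.* i ℤ.+ y′ ℤ.* j) ≡ (x ℤ.+ x′) ℤ.* i ℤ.+ (y ℤ.+ y′) ℤ.* j
    identity = ℤ-Solver.solve-∀

  combination-⊝ : ∀ x y x′ y′ → combination x y ⊝ combination x′ y′ ≡ combination (x ℤ.- x′) (y ℤ.- y′)
  combination-⊝ x y x′ y′ = cong₂ _,_ (identity x y x′ y′ (proj₁ δ₁) (proj₁ δ₂)) (identity x y x′ y′ (proj₂ δ₁) (proj₂ δ₂))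
    where
    identity : ∀ x y x′ y′ i j → x ℤ.* i ℤ.+ y ℤ.* j ℤ.- (x′ ℤ.* i ℤ.+ y′ ℤ.* j) ≡ (x ℤ.- x′) ℤ.* i ℤ.+ (y ℤ.- y′) ℤ.* j
    identity = ℤ-Solver.solve-∀

  combination-1-0 : combination 1ℤ 0ℤ ≡ δ₁
  combination-1-0 = cong₂ _,_ (identity (proj₁ δ₁) (proj₁ δ₂)) (identity (proj₂ δ₁) (proj₂ δ₂))
    where
    identity : ∀ i j → 1ℤ ℤ.* i ℤ.+ 0ℤ ℤ.* j ≡ i
    identity = ℤ-Solver.solve-∀

  combination-0-1 : combination 0ℤ 1ℤ ≡ δ₂
  combination-0-1 = cong₂ _,_ (identity (proj₁ δ₁) (proj₁ δ₂)) (identity (proj₂ δ₁) (proj₂ δ₂))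
    where
    identity : ∀ i j → 0ℤ ℤ.* i ℤ.+ 1ℤ ℤ.* j ≡ j
    identity = ℤ-Solver.solve-∀

  combination-suc₁ : ∀ k l → combination (ℤ.+ k) (ℤ.+ l) ⊕ δ₁ ≡ combination (ℤ.+ suc k) (ℤ.+ l)
  combination-suc₁ k l = cong₂ _,_ (identity (ℤ.+ k) (ℤ.+ l) (proj₁ δ₁) (proj₁ δ₂)) (identity (ℤ.+ k) (ℤ.+ l) (proj₂ δ₁) (proj₂ δ₂))
    where
    identity : ∀ x y i j → x ℤ.* i ℤ.+ y ℤ.* j ℤ.+ i ≡ (1ℤ ℤ.+ x) ℤ.* i ℤ.+ y ℤ.* j
    identity = ℤ-Solver.solve-∀

  combination-suc₂ : ∀ k l → combination (ℤ.+ k) (ℤ.+ l) ⊕ δ₂ ≡ combination (ℤ.+ k) (ℤ.+ suc l)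
  combination-suc₂ k l = cong₂ _,_ (identity (ℤ.+ k) (ℤ.+ l) (proj₁ δ₁) (proj₁ δ₂)) (identity (ℤ.+ k) (ℤ.+ l) (proj₂ δ₁) (proj₂ δ₂))
    where
    identity : ∀ x y i j → x ℤ.* i ℤ.+ y ℤ.* j ℤ.+ j ≡ x ℤ.* i ℤ.+ (1ℤ ℤ.+ y) ℤ.* j
    identity = ℤ-Solver.solve-∀

  combination-injective : cross δ₁ δ₂ ≢ 0ℤ → ∀ x y x′ y′ → combination x y ≡ combination x′ y′ → x ≡ x′ × y ≡ y′
  combination-injective D≢0 x y x′ y′ eq =
    ℤ.*-cancelʳ-≡ x x′ D {{ℤ.≢-nonZero D≢0}} (trans (sym (left x y)) (trans (cong (λ z → cross z δ₂) eq) (left x′ y′))) ,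
    ℤ.*-cancelʳ-≡ y y′ D {{ℤ.≢-nonZero D≢0}} (trans (sym (right x y)) (trans (cong (cross δ₁) eq) (right x′ y′)))
    where
    D = cross δ₁ δ₂
    identity₁ : ∀ x y a b c d → (x ℤ.* a ℤ.+ y ℤ.* c) ℤ.* d ℤ.- (x ℤ.* b ℤ.+ y ℤ.* d) ℤ.* c ≡ x ℤ.* (a ℤ.* d ℤ.- b ℤ.* c)
    identity₁ = ℤ-Solver.solve-∀
    identity₂ : ∀ x y a b c d → a ℤ.* (x ℤ.* b ℤ.+ y ℤ.* d) ℤ.- b ℤ.* (x ℤ.* a ℤ.+ y ℤ.* c) ≡ y ℤ.* (a ℤ.* d ℤ.- b ℤ.* c)
    identity₂ = ℤ-Solver.solve-∀
    left : ∀ x y → cross (combination x y) δ₂ ≡ x ℤ.* D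
    left x y = identity₁ x y (proj₁ δ₁) (proj₂ δ₁) (proj₁ δ₂) (proj₂ δ₂)
    right : ∀ x y → cross δ₁ (combination x y) ≡ y ℤ.* D
    right x y = identity₂ x y (proj₁ δ₁) (proj₂ δ₁) (proj₁ δ₂) (proj₂ δ₂)

  Heavy : ℤ² → Set
  Heavy δ = δ ≡ δ₁ ⊎ δ ≡ δ₂

  -- Two counters instead of a list of steps: they are the lattice coordinates of the displacement,
  -- on which the coset and uniqueness arguments work. A walk is infinite and gets cut off by a
  -- track.
  record Walk : Set where
    field
      ones twos : ℕ → ℕ
      ones-0    : ones 0 ≡ 0
      twos-0    : twos 0 ≡ 0
      advance   : ∀ i → (ones (suc i) ≡ suc (ones i) × twos (suc i) ≡ twos i) ⊎
                        (ones (suc i) ≡ ones i × twos (suc i) ≡ suc (twos i))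

    step : ℕ → ℤ²
    step i = Sum.[_,_] (const δ₁) (const δ₂) (advance i)

    displacement : ℕ → ℤ²
    displacement i = combination (ℤ.+ ones i) (ℤ.+ twos i)

    step-heavy : ∀ i → Heavy (step i)
    step-heavy i with advance i
    ... | inj₁ _ = inj₁ refl
    ... | inj₂ _ = inj₂ refl

    total : ∀ i → ones i + twos i ≡ i
    total zero    = cong₂ _+_ ones-0 twos-0
    total (suc i) with advance i
    ... | inj₁ (p , q) = trans (cong₂ _+_ p q) (cong suc (total i))
    ... | inj₂ (p , q) = trans (cong₂ _+_ p q) (trans (ℕ.+-suc _ _) (cong suc (total i)))

    displacement-suc : ∀ i → displacement i ⊕ step i ≡ displacement (suc i)
    displacement-suc i with advance i
    ... | inj₁ (p , q) = trans (combination-suc₁ (ones i) (twos i)) (cong₂ (λ k l → combination (ℤ.+ k) (ℤ.+ l)) (sym p) (sym q))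
    ... | inj₂ (p , q) = trans (combination-suc₂ (ones i) (twos i)) (cong₂ (λ k l → combination (ℤ.+ k) (ℤ.+ l)) (sym p) (sym q))

  -- The margin serves two purposes: at the far side the track avoids the edge that must stay
  -- untouched, and at the near side it stays out of reach of the start of the other track.
  record Track (margin : ℕ) {ℓ ℓ′ : ℕ} (E F : Edge) : Set where
    field
      walk : Walk
    open Walk walk public
    field
      n      : ℕ
      cell   : ℕ → Cell ℓ ℓ′
      offset : ∀ {i} → i ≤ n → cell i -ᶜ cell 0 ≡ displacement i
      rises  : ∀ i → 0ℤ ℤ.< along E (step i)
      starts : cell 0 on E
      ends   : cell n on opposite E
      inner  : ∀ {i} → i ≤ n → margin ≤ depth F (cell i) × depth F (cell i) + margin < length-along {ℓ} {ℓ′} (axis F)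

    Own : Cell ℓ ℓ′ → Set
    Own v = ∃[ i ] i < suc n × v ≡ cell i

    own? : ∀ v → Dec (Own v)
    own? v = ℕ.anyUpTo? (λ i → v ≟ᶜ cell i) (suc n)

∈-replicate⁻ : ∀ {A : Set} {x y : A} k → x ∈ replicate k y → x ≡ y
∈-replicate⁻ (suc k) (here p)  = p
∈-replicate⁻ (suc k) (there p) = ∈-replicate⁻ k p

count-replicate : ∀ k δ → count δ (replicate k δ) ≡ k
count-replicate zero    δ = refl
count-replicate (suc k) δ = trans (count-∷ δ δ (replicate k δ)) (cong₂ _+_ (indicator-refl δ) (count-replicate k δ))

-- The uniform grid with two heavy directions

module WeightedNeighborhood {P : List ℤ²} (P≢0 : All NonZero² P) {δ₁ δ₂ : ℤ²} (δ₁∈P : δ₁ ∈ P) (δ₂∈P : δ₂ ∈ P) where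

  open Lattice δ₁ δ₂ using (Heavy)

  -- Heavier than all directions of P together.
  weight : ℕ
  weight = suc (length P)

  directions : List ℤ²
  directions = P ++ replicate weight δ₁ ++ replicate weight δ₂

  directions⊆P : directions ⊆ P
  directions⊆P p with ∈-++⁻ P p
  ... | inj₁ q = q
  ... | inj₂ q with ∈-++⁻ (replicate weight δ₁) q
  ...   | inj₁ r = subst (_∈ P) (sym (∈-replicate⁻ weight r)) δ₁∈P
  ...   | inj₂ r = subst (_∈ P) (sym (∈-replicate⁻ weight r)) δ₂∈P

  neighborhood : Neighborhood
  neighborhood = record
    { elements = directions
    ; nonZero  = All.tabulate λ p → All.lookup P≢0 (directions⊆P p)
    }

  weighted : Weighted P neighborhood
  weighted = directions⊆P , λ p → ∈⇒count (∈-++⁺ˡ p)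

  θ : ℕ
  θ = length P + (weight + weight)

  length-directions : length directions ≡ θ
  length-directions = trans (length-++ P) (cong (length P +_)
    (trans (length-++ (replicate weight δ₁)) (cong₂ _+_ (length-replicate weight) (length-replicate weight))))

  count-directions : ∀ δ → count δ directions ≡ count δ P + (count δ (replicate weight δ₁) + count δ (replicate weight δ₂))
  count-directions δ = trans (count-++ δ P _) (cong (count δ P +_) (count-++ δ (replicate weight δ₁) _))

  heavy-count : ∀ {δ} → Heavy δ → weight ≤ count δ directions
  heavy-count (inj₁ refl) = begin
    weight                            ≡⟨ count-replicate weight δ₁ ⟨
    count δ₁ (replicate weight δ₁)    ≤⟨ ℕ.m≤m+n _ _ ⟩
    count δ₁ (replicate weight δ₁) + count δ₁ (replicate weight δ₂) ≤⟨ ℕ.m≤n+m _ (count δ₁ P) ⟩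
    count δ₁ P + (count δ₁ (replicate weight δ₁) + count δ₁ (replicate weight δ₂)) ≡⟨ count-directions δ₁ ⟨
    count δ₁ directions               ∎
    where open ℕ.≤-Reasoning
  heavy-count (inj₂ refl) = begin
    weight                            ≡⟨ count-replicate weight δ₂ ⟨
    count δ₂ (replicate weight δ₂)    ≤⟨ ℕ.m≤n+m _ _ ⟩
    count δ₂ (replicate weight δ₁) + count δ₂ (replicate weight δ₂) ≤⟨ ℕ.m≤n+m _ (count δ₂ P) ⟩
    count δ₂ P + (count δ₂ (replicate weight δ₁) + count δ₂ (replicate weight δ₂)) ≡⟨ count-directions δ₂ ⟨
    count δ₂ directions               ∎
    where open ℕ.≤-Reasoning

  module _ {ℓ ℓ′ : ℕ} where

    private
      C : Set
      C = Cell ℓ ℓ′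

    arrivals-replicate : ∀ k δ (χ : C → ℕ) v → arrivals (replicate k δ) χ v ≡ k * arrivals₁ δ χ v
    arrivals-replicate zero    δ χ v = arrivals-none [] {χ} v λ _ _ ()
    arrivals-replicate (suc k) δ χ v = trans (arrivals-∷ δ (replicate k δ) χ v) (cong (arrivals₁ δ χ v +_) (arrivals-replicate k δ χ v))

    arrivals-directions : ∀ (χ : C → ℕ) v →
      arrivals directions χ v ≡ arrivals P χ v + (weight * arrivals₁ δ₁ χ v + weight * arrivals₁ δ₂ χ v)
    arrivals-directions χ v = trans (arrivals-++ P _ χ v) (cong (arrivals P χ v +_)
      (trans (arrivals-++ (replicate weight δ₁) _ χ v)
             (cong₂ _+_ (arrivals-replicate weight δ₁ χ v) (arrivals-replicate weight δ₂ χ v))))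

    no-heavy-arrivals : ∀ {χ : C → ℕ} v → (∀ u → χ u ≤ 1) → arrivals₁ δ₁ χ v ≡ 0 → arrivals₁ δ₂ χ v ≡ 0 →
                        arrivals directions χ v < weight
    no-heavy-arrivals {χ} v χ≤1 e₁ e₂ = s≤s (begin
      arrivals directions χ v ≡⟨ arrivals-directions χ v ⟩
      arrivals P χ v + (weight * arrivals₁ δ₁ χ v + weight * arrivals₁ δ₂ χ v)
        ≡⟨ cong₂ (λ i j → arrivals P χ v + (weight * i + weight * j)) e₁ e₂ ⟩
      arrivals P χ v + (weight * 0 + weight * 0) ≡⟨ cong (λ k → arrivals P χ v + (k + k)) (ℕ.*-zeroʳ weight) ⟩
      arrivals P χ v + 0 ≡⟨ ℕ.+-identityʳ _ ⟩
      arrivals P χ v ≤⟨ arrivals-≤length P v χ≤1 ⟩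
      length P ∎)
      where open ℕ.≤-Reasoning

    one-heavy-arrival : ∀ {χ : C → ℕ} v → (∀ u → χ u ≤ 1) → arrivals₁ δ₁ χ v + arrivals₁ δ₂ χ v ≤ 1 →
                        arrivals directions χ v < θ
    one-heavy-arrival {χ} v χ≤1 le = begin-strict
      arrivals directions χ v ≡⟨ arrivals-directions χ v ⟩
      arrivals P χ v + (weight * arrivals₁ δ₁ χ v + weight * arrivals₁ δ₂ χ v)
        ≡⟨ cong (arrivals P χ v +_) (ℕ.*-distribˡ-+ weight (arrivals₁ δ₁ χ v) _) ⟨
      arrivals P χ v + weight * (arrivals₁ δ₁ χ v + arrivals₁ δ₂ χ v)
        ≤⟨ ℕ.+-mono-≤ (arrivals-≤length P v χ≤1) (ℕ.*-monoʳ-≤ weight le) ⟩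
      length P + weight * 1 ≡⟨ cong (length P +_) (ℕ.*-identityʳ weight) ⟩
      length P + weight     <⟨ ℕ.+-monoʳ-< (length P) (ℕ.m<m+n weight (s≤s z≤n)) ⟩
      θ ∎
      where open ℕ.≤-Reasoning

    -- What confines a run to the cells of `Own`. There one heavy arrival suffices. A cell of
    -- `Other` gets no heavy arrival and is short of `weight` grains, more than all light arrivals
    -- together; the exception `b`, which may be nearly full, is out of reach altogether. Any
    -- remaining cell is empty and gets at most one heavy arrival, which leaves it below `θ`.
    record Wire (c : Config ℓ ℓ′) (Own Other : C → Set) (a b : C) : Set where
      field
        own? : ∀ v → Dec (Own v)
        other? : ∀ v → Dec (Other v)
        stable : ∀ u → c u < θ
        a-own : Own a
        a-ready : suc (c a) ≡ θ
        own-ready : ∀ {u} → Own u → θ ≤ c u + weight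
        other-guarded : ∀ {v} → Other v → v ≢ b → c v + weight ≤ θ
        off-empty : ∀ {v} → ¬ Own v → ¬ Other v → c v ≡ 0
        separate : ∀ {u v} → Own u → Other v → ¬ Heavy (v -ᶜ u)
        b-far : ∀ {u} → Own u → ¬ (b -ᶜ u) ∈ P
        no-double : ∀ {u u′} v → Own u → Own u′ → v -ᶜ u ≡ δ₁ → v -ᶜ u′ ≡ δ₂ → ⊥
        entrance : ℤ²
        entrance∈P : entrance ∈ P
        entrance-unused : ∀ u → a -ᶜ u ≢ entrance

    module WireProperties {c Own Other a b} (wire : Wire c Own Other a b) where

      open Wire wire

      open Uniform neighborhood (addGrain a c)

      stable-uniform : Stable (uniform neighborhood) c
      stable-uniform u = subst (c u <_) (sym length-directions) (stable u)

      private
        bounded-run : ∀ v {χ : C → ℕ} → (∀ u → χ u ≤ 1) → addGrain a c v + arrivals directions χ v < length directions + length directions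
        bounded-run = UniformGrid.bounded neighborhood stable-uniform (∈-++⁺ˡ entrance∈P) entrance-unused

        quiet : ∀ v {χ : C → ℕ} → (∀ u → χ u ≤ 1) → (∀ u → 0 < χ u → Own u) → ¬ Own v →
                c v + arrivals directions χ v < θ
        quiet v {χ} χ≤1 χ-own v∉Own with other? v
        ... | no v∉Other = subst (λ k → k + arrivals directions χ v < θ) (sym (off-empty v∉Own v∉Other))
                (one-heavy-arrival {χ} v χ≤1 at-most-one)
          where
          at-most-one : arrivals₁ δ₁ χ v + arrivals₁ δ₂ χ v ≤ 1
          at-most-one with arrivals₁ δ₁ χ v in eq
          ... | zero  = arrivals₁-≤1 δ₂ {χ} v χ≤1
          ... | suc k = subst (λ j → suc k + j ≤ 1) (sym none₂) (subst (_≤ 1) (trans eq (sym (ℕ.+-identityʳ _))) (arrivals₁-≤1 δ₁ {χ} v χ≤1))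
            where
            -- Something arrives through `δ₁`, so a source for `δ₂` would be excluded by
            -- `no-double`.
            none₂ : arrivals₁ δ₂ χ v ≡ 0
            none₂ = arrivals₁-none δ₂ v λ u′ p′ e′ →
              ℕ.1+n≢0 (trans (sym eq) (arrivals₁-none δ₁ v λ u p e → no-double v (χ-own u p) (χ-own u′ p′) e e′))
        ... | yes v∈Other with v ≟ᶜ b
        ...   | yes refl = subst (_< θ) (sym (trans (cong (c b +_) (arrivals-none directions b λ u p → b-far (χ-own u p) ∘ directions⊆P)) (ℕ.+-identityʳ _))) (stable b)
        ...   | no v≢b = ℕ.<-≤-trans (ℕ.+-monoʳ-< (c v) (no-heavy-arrivals {χ} v χ≤1
                  (arrivals₁-none δ₁ v λ u p e → separate (χ-own u p) v∈Other (inj₁ e))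
                  (arrivals₁-none δ₂ v λ u p e → separate (χ-own u p) v∈Other (inj₂ e))))
                  (other-guarded v∈Other v≢b)

        fired-own : ∀ t u → 0 < fired t u → Own u
        fired-own (suc t) u p with own? u
        ... | yes q = q
        ... | no ¬q = ⊥-elim (ℕ.<⇒≱ (quiet u (fired-≤1 t) (fired-own t) ¬q) (subst₂ _≤_ length-directions
                (cong (_+ arrivals directions (fired t) u) (addGrain-away c λ { refl → ¬q a-own })) (H-positive p)))

        fired-step : ∀ t {u w} → Own w → Heavy (w -ᶜ u) → 0 < fired t u → 0 < fired (suc t) w
        fired-step t {u} {w} w∈Own heavy p = subst (0 <_) (sym (H-≥ enough)) (s≤s z≤n)
          where
          open ℕ.≤-Reasoning
          grains : c w ≤ addGrain a c w
          grains with w ≟ᶜ a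
          ... | yes refl = ℕ.n≤1+n (c a)
          ... | no  _    = ℕ.≤-refl
          enough : length directions ≤ addGrain a c w + arrivals directions (fired t) w
          enough = begin
            length directions ≡⟨ length-directions ⟩
            θ                 ≤⟨ own-ready w∈Own ⟩
            c w + weight      ≤⟨ ℕ.+-monoˡ-≤ weight grains ⟩
            addGrain a c w + weight ≡⟨ cong (addGrain a c w +_) (ℕ.*-identityʳ weight) ⟨
            addGrain a c w + weight * 1 ≤⟨ ℕ.+-monoʳ-≤ (addGrain a c w) (ℕ.*-mono-≤ (heavy-count heavy) p) ⟩
            addGrain a c w + count (w -ᶜ u) directions * fired t u
              ≤⟨ ℕ.+-monoʳ-≤ (addGrain a c w) (∑ᶜ-term (λ u → count (w -ᶜ u) directions * fired t u) u) ⟩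
            addGrain a c w + arrivals directions (fired t) w ∎

        fired-along : ∀ t {u w} → 0 < fired t u → Star (λ x y → Own y × Heavy (y -ᶜ x)) u w → ∃[ s ] 0 < fired s w
        fired-along t p ε = t , p
        fired-along t p ((q , h) ◅ path) = fired-along (suc t) (fired-step t q h p) path

      wire-topples : ∀ {a′} → Star (λ x y → Own y × Heavy (y -ᶜ x)) a a′ → Topples (uniform neighborhood) (addGrain a c) a′
      wire-topples path =
        let s , p = fired-along 1 (subst (0 <_) (sym (H-≥ start)) (s≤s z≤n)) path
        in fired⇒topples bounded-run s p
        where
        start : length directions ≤ addGrain a c a + arrivals directions (fired 0) a
        start = ℕ.≤-trans (ℕ.≤-reflexive (trans length-directions (trans (sym a-ready) (sym (addGrain-at a c))))) (ℕ.m≤m+n _ _)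

      topples-own : ∀ {u} → Topples (uniform neighborhood) (addGrain a c) u → Own u
      topples-own p = let t , q = topples⇒fired bounded-run p in fired-own t _ q

same-axis : ∀ F G → axis G ≡ axis F → G ≡ F ⊎ G ≡ opposite F
same-axis west  west  _ = inj₁ refl
same-axis west  east  _ = inj₂ refl
same-axis east  west  _ = inj₂ refl
same-axis east  east  _ = inj₁ refl
same-axis south south _ = inj₁ refl
same-axis south north _ = inj₂ refl
same-axis north south _ = inj₂ refl
same-axis north north _ = inj₁ refl

two-axes : ∀ {α β : Axis} γ → α ≢ β → α ≡ γ ⊎ β ≡ γ
two-axes {westEast}   {westEast}   γ          α≢β = ⊥-elim (α≢β refl)
two-axes {southNorth} {southNorth} γ          α≢β = ⊥-elim (α≢β refl)
two-axes {westEast}   {southNorth} westEast   _ = inj₁ refl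
two-axes {westEast}   {southNorth} southNorth _ = inj₂ refl
two-axes {southNorth} {westEast}   westEast   _ = inj₂ refl
two-axes {southNorth} {westEast}   southNorth _ = inj₁ refl

module _ {ℓ ℓ′ : ℕ} where

  not-on-axis : ∀ F {u : Cell ℓ ℓ′} → 0 < depth F u → suc (depth F u) < length-along {ℓ} {ℓ′} (axis F) →
                ∀ G → axis G ≡ axis F → ¬ u on G
  not-on-axis F low high G eq e with same-axis F G eq
  ... | inj₁ refl = ℕ.<-irrefl (sym (on⇒depth F e)) low
  ... | inj₂ refl = ℕ.<-irrefl (on-opposite⇒depth F e) high

  -- The two edges of a corner have different axes, so one of them is parallel to `F`, where `u` is
  -- strictly inside.
  inside⇒nonCorner : ∀ F {u : Cell ℓ ℓ′} → 0 < depth F u → suc (depth F u) < length-along {ℓ} {ℓ′} (axis F) → ¬ Corner u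
  inside⇒nonCorner F low high (G , G′ , G≢G′ , e , e′) with two-axes (axis F) G≢G′
  ... | inj₁ p = not-on-axis F low high G p e
  ... | inj₂ p = not-on-axis F low high G′ p e′

⊝-⊕ : ∀ u v w → (u ⊝ w) ⊕ (v ⊝ u) ≡ v ⊝ w
⊝-⊕ u v w = cong₂ _,_ (identity (proj₁ u) (proj₁ v) (proj₁ w)) (identity (proj₂ u) (proj₂ v) (proj₂ w))
  where
  identity : ∀ i j k → (i ℤ.- k) ℤ.+ (j ℤ.- i) ≡ j ℤ.- k
  identity = ℤ-Solver.solve-∀

module _ {ℓ ℓ′ : ℕ} where

  point : Cell ℓ ℓ′ → ℤ²
  point u = ℤ.+ xcoord u , ℤ.+ ycoord u

  triangle : ∀ (o u v : Cell ℓ ℓ′) → (u -ᶜ o) ⊕ (v -ᶜ u) ≡ v -ᶜ o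
  triangle o u v = ⊝-⊕ (point u) (point v) (point o)

  offset-cancel : ∀ (o u v : Cell ℓ ℓ′) → v -ᶜ u ≡ (v -ᶜ o) ⊝ (u -ᶜ o)
  offset-cancel o u v = cong₂ _,_
    (identity (ℤ.+ xcoord o) (ℤ.+ xcoord u) (ℤ.+ xcoord v)) (identity (ℤ.+ ycoord o) (ℤ.+ ycoord u) (ℤ.+ ycoord v))
    where
    identity : ∀ i j k → k ℤ.- j ≡ (k ℤ.- i) ℤ.- (j ℤ.- i)
    identity = ℤ-Solver.solve-∀

  base-change : ∀ (o o′ u v : Cell ℓ ℓ′) → o′ -ᶜ o ≡ ((v -ᶜ u) ⊝ (v -ᶜ o′)) ⊕ (u -ᶜ o)
  base-change o o′ u v = cong₂ _,_
    (identity (ℤ.+ xcoord o) (ℤ.+ xcoord o′) (ℤ.+ xcoord u) (ℤ.+ xcoord v))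
    (identity (ℤ.+ ycoord o) (ℤ.+ ycoord o′) (ℤ.+ ycoord u) (ℤ.+ ycoord v))
    where
    identity : ∀ i j k l → j ℤ.- i ≡ ((l ℤ.- k) ℤ.- (l ℤ.- j)) ℤ.+ (k ℤ.- i)
    identity = ℤ-Solver.solve-∀

-- Cells along a track

module TrackProperties {δ₁ δ₂ : ℤ²} (D≢0 : cross δ₁ δ₂ ≢ 0ℤ) {margin ℓ ℓ′ E F}
                       (track : Lattice.Track δ₁ δ₂ margin {ℓ} {ℓ′} E F) where

  open Lattice δ₁ δ₂
  open Track track public

  own-inner : ∀ {u} → Own u → margin ≤ depth F u × depth F u + margin < length-along {ℓ} {ℓ′} (axis F)
  own-inner (i , i<n , refl) = inner (ℕ.s≤s⁻¹ i<n)

  step-difference : ∀ {i} → i < n → cell (suc i) -ᶜ cell i ≡ step i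
  step-difference {i} i<n = begin
    cell (suc i) -ᶜ cell i                       ≡⟨ offset-cancel (cell 0) (cell i) (cell (suc i)) ⟩
    (cell (suc i) -ᶜ cell 0) ⊝ (cell i -ᶜ cell 0) ≡⟨ cong₂ _⊝_ (offset i<n) (offset (ℕ.<⇒≤ i<n)) ⟩
    displacement (suc i) ⊝ displacement i        ≡⟨ cong (_⊝ displacement i) (displacement-suc i) ⟨
    (displacement i ⊕ step i) ⊝ displacement i   ≡⟨ cong₂ _,_ (identity (proj₁ (displacement i)) _) (identity (proj₂ (displacement i)) _) ⟩
    step i                                       ∎
    where
    open ≡-Reasoning
    identity : ∀ i j → i ℤ.+ j ℤ.- i ≡ j
    identity = ℤ-Solver.solve-∀

  -- As the determinant is nonzero, the displacement fixes both counters, and their sum is the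
  -- number of steps.
  counts-determine : ∀ {i j} → displacement i ≡ displacement j → i ≡ j
  counts-determine {i} {j} eq =
    let p , q = combination-injective D≢0 (ℤ.+ ones i) (ℤ.+ twos i) (ℤ.+ ones j) (ℤ.+ twos j) eq in
    trans (sym (total i)) (trans (cong₂ _+_ (ℤ.+-injective p) (ℤ.+-injective q)) (total j))

  cell-injective : ∀ {i j} → i ≤ n → j ≤ n → cell i ≡ cell j → i ≡ j
  cell-injective i≤n j≤n eq = counts-determine (trans (sym (offset i≤n)) (trans (cong (_-ᶜ cell 0) eq) (offset j≤n)))

  after-δ₁ : ∀ {u v} → Own u → v -ᶜ u ≡ δ₁ → ∃[ i ] v -ᶜ cell 0 ≡ combination (ℤ.+ suc (ones i)) (ℤ.+ twos i)
  after-δ₁ {v = v} (i , i<n , refl) eq = i , (begin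
    v -ᶜ cell 0                                 ≡⟨ triangle (cell 0) (cell i) v ⟨
    (cell i -ᶜ cell 0) ⊕ (v -ᶜ cell i) ≡⟨ cong₂ _⊕_ (offset (ℕ.s≤s⁻¹ i<n)) eq ⟩
    displacement i ⊕ δ₁ ≡⟨ combination-suc₁ (ones i) (twos i) ⟩
    combination (ℤ.+ suc (ones i)) (ℤ.+ twos i) ∎)
    where open ≡-Reasoning

  after-δ₂ : ∀ {u v} → Own u → v -ᶜ u ≡ δ₂ → ∃[ i ] v -ᶜ cell 0 ≡ combination (ℤ.+ ones i) (ℤ.+ suc (twos i))
  after-δ₂ {v = v} (i , i<n , refl) eq = i , (begin
    v -ᶜ cell 0                                 ≡⟨ triangle (cell 0) (cell i) v ⟨
    (cell i -ᶜ cell 0) ⊕ (v -ᶜ cell i) ≡⟨ cong₂ _⊕_ (offset (ℕ.s≤s⁻¹ i<n)) eq ⟩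
    displacement i ⊕ δ₂ ≡⟨ combination-suc₂ (ones i) (twos i) ⟩
    combination (ℤ.+ ones i) (ℤ.+ suc (twos i)) ∎)
    where open ≡-Reasoning

  -- The number of steps to a cell is determined by the cell, but the last steps would differ.
  no-double : ∀ {u u′} v → Own u → Own u′ → v -ᶜ u ≡ δ₁ → v -ᶜ u′ ≡ δ₂ → ⊥
  no-double v p p′ e e′ =
    let i , eq = after-δ₁ p e
        j , eq′ = after-δ₂ p′ e′
        x , y = combination-injective D≢0 (ℤ.+ suc (ones i)) (ℤ.+ twos i) (ℤ.+ ones j) (ℤ.+ suc (twos j)) (trans (sym eq) eq′)
        x′ = ℤ.+-injective x
        y′ = ℤ.+-injective y
        i≡j = ℕ.suc-injective (begin
          suc i                  ≡⟨ cong suc (total i) ⟨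
          suc (ones i) + twos i  ≡⟨ cong₂ _+_ x′ y′ ⟩
          ones j + suc (twos j)  ≡⟨ ℕ.+-suc _ _ ⟩
          suc (ones j + twos j)  ≡⟨ cong suc (total j) ⟩
          suc j                  ∎)
    in ℕ.1+n≢n (trans x′ (cong ones (sym i≡j)))
    where open ≡-Reasoning

  track-path : ∀ {i} → i ≤ n → Star (λ u v → Own v × Heavy (v -ᶜ u)) (cell 0) (cell i)
  track-path {zero}  _   = ε
  track-path {suc i} i<n = track-path (ℕ.<⇒≤ i<n) ◅◅
    (((suc i , s≤s i<n , refl) , subst Heavy (sym (step-difference i<n)) (step-heavy i)) ◅ ε)

  start-own : Own (cell 0)
  start-own = 0 , s≤s z≤n , refl

  module _ {dir : Cell ℓ ℓ′ → ℤ²} (follows : ∀ {i} → i ≤ n → dir (cell i) ≡ step i) where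

    dir-path : ∀ {i} → i ≤ n → Star (λ u v → v -ᶜ u ≡ dir u) (cell 0) (cell i)
    dir-path {zero}  _   = ε
    dir-path {suc i} i<n = dir-path (ℕ.<⇒≤ i<n) ◅◅ (trans (step-difference i<n) (sym (follows (ℕ.<⇒≤ i<n))) ◅ ε)

    -- A step from an earlier cell leads to the next one. The last cell lies on the edge opposite to
    -- `E`, and its step still rises, so it leads out of the grid.
    dir-closed : ∀ {u v} → Own u → v -ᶜ u ≡ dir u → Own v
    dir-closed {v = v} (i , i<n , refl) eq with i ℕ.<? n
    ... | yes lt = suc i , s≤s lt , -ᶜ-injectiveˡ (cell i) (trans eq (trans (follows (ℕ.<⇒≤ lt)) (sym (step-difference lt))))
    ... | no ¬lt = ⊥-elim (ℕ.<⇒≱ (depth< E v) (subst (_≤ depth E v) (on-opposite⇒depth E ends)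
          (subst (λ j → depth E (cell j) < depth E v) i≡n (ℤ.drop‿+<+ higher))))
      where
      i≡n : i ≡ n
      i≡n = ℕ.≤-antisym (ℕ.s≤s⁻¹ i<n) (ℕ.≮⇒≥ ¬lt)
      higher : ℤ.+ depth E (cell i) ℤ.< ℤ.+ depth E v
      higher = 0<i-j⇒j<i (subst (0ℤ ℤ.<_) (trans (cong (along E) (sym (trans eq (follows (ℕ.s≤s⁻¹ i<n))))) (along-difference E v (cell i))) (rises i))

-- Gates from two tracks in different cosets

module _ {P : List ℤ²} (P≢0 : All NonZero² P) {δ₁ δ₂ : ℤ²} (δ₁∈P : δ₁ ∈ P) (δ₂∈P : δ₂ ∈ P)
         (D≢0 : cross δ₁ δ₂ ≢ 0ℤ) {r ℓ ℓ′ : ℕ} (short : ∀ E {δ} → δ ∈ P → ∣ along E δ ∣ < r) where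

  open Lattice δ₁ δ₂
  open WeightedNeighborhood P≢0 δ₁∈P δ₂∈P

  private
    C : Set
    C = Cell ℓ ℓ′

  self-difference : ∀ (u : C) → u -ᶜ u ≡ combination 0ℤ 0ℤ
  self-difference u = cong₂ _,_ (ℤ.+-inverseʳ (ℤ.+ xcoord u)) (ℤ.+-inverseʳ (ℤ.+ ycoord u))

  apart-sym : ∀ (o o′ : C) → (∀ x y → o′ -ᶜ o ≢ combination x y) → ∀ x y → o -ᶜ o′ ≢ combination x y
  apart-sym o o′ apart x y eq = apart (0ℤ ℤ.- x) (0ℤ ℤ.- y) (begin
    o′ -ᶜ o                           ≡⟨ offset-cancel o′ o o′ ⟩
    (o′ -ᶜ o′) ⊝ (o -ᶜ o′)            ≡⟨ cong₂ _⊝_ (self-difference o′) eq ⟩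
    combination 0ℤ 0ℤ ⊝ combination x y ≡⟨ combination-⊝ 0ℤ 0ℤ x y ⟩
    combination (0ℤ ℤ.- x) (0ℤ ℤ.- y) ∎)
    where open ≡-Reasoning

  heavy∈P : ∀ {δ} → Heavy δ → δ ∈ P
  heavy∈P (inj₁ refl) = δ₁∈P
  heavy∈P (inj₂ refl) = δ₂∈P

  0<r : 0 < r
  0<r = ℕ.≤-<-trans z≤n (short west δ₁∈P)

  -- Each cell differs from the start of its own track by a lattice vector, so a lattice vector
  -- between the tracks would put both starts into one coset.
  separated : ∀ {E F} (p : Track r {ℓ} {ℓ′} E F) (q : Track r {ℓ} {ℓ′} F E) →
    (∀ x y → Track.cell q 0 -ᶜ Track.cell p 0 ≢ combination x y) →
    ∀ {u v} → Track.Own p u → Track.Own q v → ∀ x y → v -ᶜ u ≢ combination x y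
  separated p q apart (i , i<n , refl) (j , j<n , refl) x y eq =
   apart (x ℤ.- ℤ.+ q.ones j ℤ.+ ℤ.+ p.ones i) (y ℤ.- ℤ.+ q.twos j ℤ.+ ℤ.+ p.twos i) (begin
    q.cell 0 -ᶜ p.cell 0
      ≡⟨ base-change (p.cell 0) (q.cell 0) (p.cell i) (q.cell j) ⟩
    ((q.cell j -ᶜ p.cell i) ⊝ (q.cell j -ᶜ q.cell 0)) ⊕ (p.cell i -ᶜ p.cell 0)
      ≡⟨ cong₂ _⊕_ (cong₂ _⊝_ eq (q.offset (ℕ.s≤s⁻¹ j<n))) (p.offset (ℕ.s≤s⁻¹ i<n)) ⟩
    (combination x y ⊝ q.displacement j) ⊕ p.displacement i
      ≡⟨ cong (_⊕ p.displacement i) (combination-⊝ x y (ℤ.+ q.ones j) (ℤ.+ q.twos j)) ⟩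
    combination (x ℤ.- ℤ.+ q.ones j) (y ℤ.- ℤ.+ q.twos j) ⊕ p.displacement i
      ≡⟨ combination-⊕ (x ℤ.- ℤ.+ q.ones j) (y ℤ.- ℤ.+ q.twos j) (ℤ.+ p.ones i) (ℤ.+ p.twos i) ⟩
    combination (x ℤ.- ℤ.+ q.ones j ℤ.+ ℤ.+ p.ones i) (y ℤ.- ℤ.+ q.twos j ℤ.+ ℤ.+ p.twos i) ∎)
    where
    open ≡-Reasoning
    module p = Track p
    module q = Track q

  disjoint : ∀ {E F} (p : Track r {ℓ} {ℓ′} E F) (q : Track r {ℓ} {ℓ′} F E) →
    (∀ x y → Track.cell q 0 -ᶜ Track.cell p 0 ≢ combination x y) →
    ∀ {u} → Track.Own p u → ¬ Track.Own q u
  disjoint p q apart {u} u∈p u∈q = separated p q apart u∈p u∈q 0ℤ 0ℤ (self-difference u)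

  heavy-combination : ∀ {δ} → Heavy δ → ∃[ x ] ∃[ y ] δ ≡ combination x y
  heavy-combination (inj₁ refl) = 1ℤ , 0ℤ , sym combination-1-0
  heavy-combination (inj₂ refl) = 0ℤ , 1ℤ , sym combination-0-1

  module _ {E F} (p : Track r {ℓ} {ℓ′} E F) where

    open TrackProperties D≢0 p

    own-below : ∀ {u} → Own u → suc (depth F u) < length-along {ℓ} {ℓ′} (axis F)
    own-below u∈p = ℕ.≤-<-trans (ℕ.≤-reflexive (ℕ.+-comm 1 _))
      (ℕ.≤-<-trans (ℕ.+-monoʳ-≤ (depth F _) 0<r) (proj₂ (own-inner u∈p)))

    start-nonCorner : ¬ Corner (cell 0)
    start-nonCorner = inside⇒nonCorner F (ℕ.<-≤-trans 0<r (proj₁ (own-inner start-own))) (own-below start-own)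

    own-avoids : ∀ {u} → u on opposite F → ¬ Own u
    own-avoids e u∈p = ℕ.<-irrefl (on-opposite⇒depth F e) (own-below u∈p)

    step∈P : ∀ i → step i ∈ P
    step∈P i = heavy∈P (step-heavy i)

    far-from-edge : ∀ {u} (b : C) → b on F → Own u → ¬ (b -ᶜ u) ∈ P
    far-from-edge {u} b b-on-F u∈p b-u∈P = ℕ.<⇒≱ (short F b-u∈P) (begin
      r                                         ≤⟨ proj₁ (own-inner u∈p) ⟩
      depth F u                                 ≡⟨ trans (cong ∣_∣ (ℤ.+-identityˡ (ℤ.- (ℤ.+ depth F u)))) (ℤ.∣-i∣≡∣i∣ (ℤ.+ depth F u)) ⟨
      ∣ 0ℤ ℤ.- ℤ.+ depth F u ∣                  ≡⟨ cong (λ k → ∣ ℤ.+ k ℤ.- ℤ.+ depth F u ∣) (on⇒depth F b-on-F) ⟨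
      ∣ ℤ.+ depth F b ℤ.- ℤ.+ depth F u ∣       ≡⟨ cong ∣_∣ (along-difference F b u) ⟨
      ∣ along F (b -ᶜ u) ∣                      ∎)
      where open ℕ.≤-Reasoning

  -- The starts lack one grain. The other track cells lack exactly `weight`: one heavy arrival fills
  -- the gap, while all light arrivals together, at most `length P`, do not.
  record Loading {A B} (p : Track r {ℓ} {ℓ′} A B) (q : Track r {ℓ} {ℓ′} B A) (c : Config ℓ ℓ′) : Set where
    open Track
    field
      p-start : suc (c (cell p 0)) ≡ θ
      q-start : suc (c (cell q 0)) ≡ θ
      loaded  : ∀ {v} → Own p v ⊎ Own q v → v ≢ cell p 0 → v ≢ cell q 0 → c v ≡ length P + weight
      empty   : ∀ {v} → ¬ Own p v → ¬ Own q v → c v ≡ 0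

  swap-loading : ∀ {A B} {p : Track r {ℓ} {ℓ′} A B} {q : Track r B A} {c} → Loading p q c → Loading q p c
  swap-loading l = record
    { p-start = q-start
    ; q-start = p-start
    ; loaded  = λ v∈ v≢q v≢p → loaded (Sum.swap v∈) v≢p v≢q
    ; empty   = λ v∉q v∉p → empty v∉p v∉q
    }
    where open Loading l

  loading : ∀ {A B} (p : Track r {ℓ} {ℓ′} A B) (q : Track r B A) → ∃[ c ] Loading p q c
  loading p q = c , record { p-start = start (inj₁ refl) ; q-start = start (inj₂ refl) ; loaded = loaded ; empty = empty }
    where
    open Track
    start? : ∀ v → Dec (v ≡ cell p 0 ⊎ v ≡ cell q 0)
    start? v = (v ≟ᶜ cell p 0) ⊎-dec (v ≟ᶜ cell q 0)
    own : ∀ v → Dec (Own p v ⊎ Own q v)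
    own v = own? p v ⊎-dec own? q v
    c : Config ℓ ℓ′
    -- The starts come first because they lie on the tracks as well but need a different load.
    c v = if does (start? v) then ℕ.pred θ else (if does (own v) then length P + weight else 0)
    start : ∀ {v} → v ≡ cell p 0 ⊎ v ≡ cell q 0 → suc (c v) ≡ θ
    start {v} e rewrite dec-true (start? v) e = ℕ.suc-pred θ {{ℕ.>-nonZero (ℕ.≤-trans (s≤s z≤n) (ℕ.m≤n+m (weight + weight) (length P)))}}
    loaded : ∀ {v} → Own p v ⊎ Own q v → v ≢ cell p 0 → v ≢ cell q 0 → c v ≡ length P + weight
    loaded {v} v∈ v≢p v≢q rewrite dec-false (start? v) (Sum.[_,_] v≢p v≢q) | dec-true (own v) v∈ = refl
    start-own : ∀ {E F} (t : Track r {ℓ} {ℓ′} E F) {v} → v ≡ cell t 0 → Own t v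
    start-own t e = 0 , s≤s z≤n , e
    empty : ∀ {v} → ¬ Own p v → ¬ Own q v → c v ≡ 0
    empty {v} v∉p v∉q rewrite dec-false (start? v) (Sum.[_,_] (v∉p ∘ start-own p) (v∉q ∘ start-own q))
                            | dec-false (own v) (Sum.[_,_] v∉p v∉q) = refl

  wire : ∀ {A B} {p : Track r {ℓ} {ℓ′} A B} {q : Track r B A} {c} → Loading p q c →
         (∀ x y → Track.cell q 0 -ᶜ Track.cell p 0 ≢ combination x y) →
         Wire c (Track.Own p) (Track.Own q) (Track.cell p 0) (Track.cell q 0)
  wire {A} {B} {p} {q} {c} l apart = record
    { own? = p.own?
    ; other? = q.own?
    ; stable = stable
    ; a-own = p.start-own
    ; a-ready = p-start
    ; own-ready = own-ready
    ; other-guarded = λ {v} v∈q v≢b → guarded v∈q v≢b (v ≟ᶜ p.cell 0)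
    ; off-empty = empty
    ; separate = λ u∈p v∈q heavy → let x , y , eq = heavy-combination heavy in separated p q apart u∈p v∈q x y eq
    ; b-far = far-from-edge p (q.cell 0) q.starts
    ; no-double = p.no-double
    ; entrance = p.step 0
    ; entrance∈P = step∈P p 0
    ; entrance-unused = not-into-edge A p.starts (p.rises 0)
    }
    where
    module p = TrackProperties D≢0 p
    module q = TrackProperties D≢0 q
    open Loading l
    θ-split : length P + weight + weight ≡ θ
    θ-split = ℕ.+-assoc (length P) weight weight
    from-start : ∀ {v} → suc (c v) ≡ θ → θ ≤ c v + weight
    from-start {v} e = ℕ.≤-trans (ℕ.≤-reflexive (trans (sym e) (ℕ.+-comm 1 (c v)))) (ℕ.+-monoʳ-≤ (c v) (s≤s z≤n))
    own-ready : ∀ {u} → p.Own u → θ ≤ c u + weight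
    own-ready {u} u∈p with u ≟ᶜ p.cell 0 | u ≟ᶜ q.cell 0
    ... | yes refl | _        = from-start p-start
    ... | no  _    | yes refl = from-start q-start
    ... | no  u≢p  | no  u≢q  = ℕ.≤-reflexive (trans (sym θ-split) (cong (_+ weight) (sym (loaded (inj₁ u∈p) u≢p u≢q))))
    guarded : ∀ {v} → q.Own v → v ≢ q.cell 0 → Dec (v ≡ p.cell 0) → c v + weight ≤ θ
    guarded v∈q v≢q (yes refl) = ⊥-elim (disjoint p q apart p.start-own v∈q)
    guarded v∈q v≢q (no v≢p)   = ℕ.≤-reflexive (trans (cong (_+ weight) (loaded (inj₂ v∈q) v≢p v≢q)) θ-split)
    stable : ∀ u → c u < θ
    stable u with u ≟ᶜ p.cell 0 | u ≟ᶜ q.cell 0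
    ... | yes refl | _        = ℕ.≤-reflexive p-start
    ... | no  _    | yes refl = ℕ.≤-reflexive q-start
    ... | no  u≢p  | no  u≢q with p.own? u | q.own? u
    ...   | yes u∈p | _ = subst (_< θ) (sym (loaded (inj₁ u∈p) u≢p u≢q)) lower
      where lower = subst (length P + weight <_) θ-split (ℕ.m<m+n (length P + weight) (s≤s z≤n))
    ...   | no _    | yes u∈q = subst (_< θ) (sym (loaded (inj₂ u∈q) u≢p u≢q)) lower
      where lower = subst (length P + weight <_) θ-split (ℕ.m<m+n (length P + weight) (s≤s z≤n))
    ...   | no u∉p  | no u∉q = subst (_< θ) (sym (empty u∉p u∉q)) (ℕ.≤-trans (s≤s z≤n) (ℕ.m≤n+m (weight + weight) (length P)))

  module _ {A B} (A≢B : axis A ≢ axis B) (p : Track r {ℓ} {ℓ′} A B) (q : Track r B A)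
           (apart : ∀ x y → Track.cell q 0 -ᶜ Track.cell p 0 ≢ combination x y) where

    private
      module p = TrackProperties D≢0 p
      module q = TrackProperties D≢0 q

      apart′ : ∀ x y → p.cell 0 -ᶜ q.cell 0 ≢ combination x y
      apart′ = apart-sym (p.cell 0) (q.cell 0) apart

    tracks⇒gate : ∀ {𝒩 c} → Stable 𝒩 c →
      Topples 𝒩 (addGrain (p.cell 0) c) (p.cell p.n) → (∀ {u} → Topples 𝒩 (addGrain (p.cell 0) c) u → p.Own u) →
      Topples 𝒩 (addGrain (q.cell 0) c) (q.cell q.n) → (∀ {u} → Topples 𝒩 (addGrain (q.cell 0) c) u → q.Own u) →
      AdmitsCrossingGate 𝒩
    tracks⇒gate {c = c} stable p-topples p-own q-topples q-own = c , A , B , A≢B , record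
      { stable         = stable
      ; a              = p.cell 0
      ; a′             = p.cell p.n
      ; b              = q.cell 0
      ; b′             = q.cell q.n
      ; a-on-A         = p.starts
      ; a-nonCorner    = start-nonCorner p
      ; a′-on-A′       = p.ends
      ; b-on-B         = q.starts
      ; b-nonCorner    = start-nonCorner q
      ; b′-on-B′       = q.ends
      ; a′-topples     = p-topples
      ; B′-not-toppled = λ u e → own-avoids p e ∘ p-own
      ; b′-topples     = q-topples
      ; A′-not-toppled = λ u e → own-avoids q e ∘ q-own
      }

    tracks⇒weighted : AdmitsCrossingGate (uniform {ℓ} {ℓ′} neighborhood)
    tracks⇒weighted = tracks⇒gate p-wire.stable-uniform
      (p-wire.wire-topples (p.track-path ℕ.≤-refl)) p-wire.topples-own
      (q-wire.wire-topples (q.track-path ℕ.≤-refl)) q-wire.topples-own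
      where
      l = proj₂ (loading p q)
      module p-wire = WireProperties (wire l apart)
      module q-wire = WireProperties (wire (swap-loading l) apart′)

    private
      dir-by : ∀ {v} → Dec (p.Own v) → Dec (q.Own v) → ℤ²
      dir-by (yes (i , _)) _             = p.step i
      dir-by (no _)        (yes (i , _)) = q.step i
      -- A default for the cells off both tracks, which the grain never visits.
      dir-by (no _)        (no _)        = δ₁

      dir : C → ℤ²
      dir v = dir-by (p.own? v) (q.own? v)

      dir∈P : ∀ v → dir v ∈ P
      dir∈P v with p.own? v | q.own? v
      ... | yes (i , _) | _           = step∈P p i
      ... | no _        | yes (i , _) = step∈P q i
      ... | no _        | no _        = δ₁∈P

      p-follows : ∀ {i} → i ≤ p.n → dir (p.cell i) ≡ p.step i
      p-follows {i} i≤n with p.own? (p.cell i)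
      ... | yes (j , j<n , eq) = cong p.step (sym (p.cell-injective i≤n (ℕ.s≤s⁻¹ j<n) eq))
      ... | no ¬own            = ⊥-elim (¬own (i , s≤s i≤n , refl))

      q-follows : ∀ {i} → i ≤ q.n → dir (q.cell i) ≡ q.step i
      q-follows {i} i≤n with p.own? (q.cell i) | q.own? (q.cell i)
      ... | yes u∈p | _                  = ⊥-elim (disjoint p q apart u∈p (i , s≤s i≤n , refl))
      ... | no _    | yes (j , j<n , eq) = cong q.step (sym (q.cell-injective i≤n (ℕ.s≤s⁻¹ j<n) eq))
      ... | no _    | no ¬own            = ⊥-elim (¬own (i , s≤s i≤n , refl))

      primalGrid : Grid ℓ ℓ′
      primalGrid v = record { elements = dir v ∷ [] ; nonZero = All.lookup P≢0 (dir∈P v) ∷ [] }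

      open PrimalGrid primalGrid (λ _ → refl)

      empty : Config ℓ ℓ′
      empty _ = 0

      empty-stable : Stable primalGrid empty
      empty-stable _ = s≤s z≤n

    module _ {E F} (t : Track r {ℓ} {ℓ′} E F) (follows : ∀ {i} → i ≤ Track.n t → dir (Track.cell t i) ≡ Track.step t i) where

      open TrackProperties D≢0 t

      primal-topples : Topples primalGrid (addGrain (cell 0) empty) (cell n)
      primal-topples = reachable⇒topples empty (Star.map here (dir-path {dir} follows ℕ.≤-refl))

      primal-own : ∀ {u} → Topples primalGrid (addGrain (cell 0) empty) u → Own u
      primal-own topples = stays start-own (topples⇒reachable primalGrid empty-stable (cell 0) topples)
        where
        stays : ∀ {u v} → Own u → Star Next u v → Own v
        stays u∈t ε = u∈t
        stays u∈t (here e ◅ path) = stays (dir-closed {dir} follows u∈t e) path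

    tracks⇒primal : ∃[ 𝒩 ] Primal P {ℓ} {ℓ′} 𝒩 × AdmitsCrossingGate 𝒩
    tracks⇒primal = primalGrid , (λ v → (λ { (here refl) → dir∈P v }) , refl) ,
      tracks⇒gate empty-stable (primal-topples p p-follows) (primal-own p p-follows)
                               (primal-topples q q-follows) (primal-own q q-follows)

-- Layout of the two paths

∣along∣ : ∀ E δ → ∣ along E δ ∣ ≡ ∣ component (axis E) δ ∣
∣along∣ E δ = trans (ℤ.abs-* (orientation E) _) (trans (cong (_* ∣ component (axis E) δ ∣) (∣orientation∣ E)) (ℕ.*-identityˡ _))

short-bound : ∀ P → ∃[ r ] (∀ E {δ} → δ ∈ P → ∣ along E δ ∣ < r)
short-bound []      = 0 , λ _ ()
short-bound (δ ∷ P) =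
  let r , short = short-bound P in
  suc (∣ proj₁ δ ∣ + ∣ proj₂ δ ∣) + r , λ
    { E (here refl) → ℕ.≤-trans (s≤s (subst (_≤ ∣ proj₁ δ ∣ + ∣ proj₂ δ ∣) (sym (∣along∣ E δ)) (component≤ (axis E)))) (ℕ.m≤m+n _ r)
    ; E (there p)   → ℕ.≤-trans (short E p) (ℕ.m≤n+m r _) }
  where
  component≤ : ∀ α → ∣ component α δ ∣ ≤ ∣ proj₁ δ ∣ + ∣ proj₂ δ ∣
  component≤ westEast   = ℕ.m≤m+n _ _
  component≤ southNorth = ℕ.m≤n+m _ _

-- Cells are addressed by their depths, which hides the actual edges `A` and `B`. Clamping the
-- arguments makes `locate` total.
record Frame (A B : Edge) (mᴬ mᴮ : ℕ) : Set where
  field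
    {ℓ ℓ′}  : ℕ
    1≤ℓ     : 1 ≤ ℓ
    1≤ℓ′    : 1 ≤ ℓ′
    lengthᴬ : length-along {ℓ} {ℓ′} (axis A) ≡ suc mᴬ
    lengthᴮ : length-along {ℓ} {ℓ′} (axis B) ≡ suc mᴮ
    locate  : ℕ → ℕ → Cell ℓ ℓ′
    depthᴬ  : ∀ {t} s → t ≤ mᴬ → depth A (locate t s) ≡ t
    depthᴮ  : ∀ t {s} → s ≤ mᴮ → depth B (locate t s) ≡ s

clamp : ∀ m → ℕ → Fin (suc m)
clamp m k = Fin.fromℕ< (s≤s (ℕ.m⊓n≤n k m))

toℕ-clamp : ∀ {m k} → k ≤ m → Fin.toℕ (clamp m k) ≡ k
toℕ-clamp k≤m = trans (Fin.toℕ-fromℕ< _) (ℕ.m≤n⇒m⊓n≡m k≤m)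

opposite-clamp : ∀ {m k} → k ≤ m → Fin.toℕ (Fin.opposite (Fin.opposite (clamp m k))) ≡ k
opposite-clamp {m} {k} k≤m = trans (cong Fin.toℕ (Fin.opposite-involutive (clamp m k))) (toℕ-clamp k≤m)

westEast-place : ∀ E → axis E ≡ westEast → ∀ m → Σ[ f ∈ (ℕ → Fin (suc m)) ]
  (∀ {ℓ′} (y : Fin ℓ′) {k} → k ≤ m → depth {suc m} E (f k , y) ≡ k)
westEast-place west refl m = clamp m , λ _ → toℕ-clamp
westEast-place east refl m = Fin.opposite ∘ clamp m , λ _ → opposite-clamp

southNorth-place : ∀ E → axis E ≡ southNorth → ∀ m → Σ[ f ∈ (ℕ → Fin (suc m)) ]
  (∀ {ℓ} (x : Fin ℓ) {k} → k ≤ m → depth {ℓ} {suc m} E (x , f k) ≡ k)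
southNorth-place south refl m = clamp m , λ _ → toℕ-clamp
southNorth-place north refl m = Fin.opposite ∘ clamp m , λ _ → opposite-clamp

frame : ∀ {A B} → axis A ≢ axis B → ∀ mᴬ mᴮ → Frame A B mᴬ mᴮ
frame {A} {B} A≢B mᴬ mᴮ with axis A in eqᴬ | axis B in eqᴮ
... | westEast | westEast     = ⊥-elim (A≢B refl)
... | southNorth | southNorth = ⊥-elim (A≢B refl)
... | westEast | southNorth   =
  let f , f-depth = westEast-place A eqᴬ mᴬ
      g , g-depth = southNorth-place B eqᴮ mᴮ
  in record
    { 1≤ℓ = s≤s z≤n ; 1≤ℓ′ = s≤s z≤n
    ; lengthᴬ = cong length-along eqᴬ ; lengthᴮ = cong length-along eqᴮ
    ; locate = λ t s → f t , g s
    ; depthᴬ = λ s → f-depth (g s) ; depthᴮ = λ t → g-depth (f t) }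
... | southNorth | westEast   =
  let f , f-depth = southNorth-place A eqᴬ mᴬ
      g , g-depth = westEast-place B eqᴮ mᴮ
  in record
    { 1≤ℓ = s≤s z≤n ; 1≤ℓ′ = s≤s z≤n
    ; lengthᴬ = cong length-along eqᴬ ; lengthᴮ = cong length-along eqᴮ
    ; locate = λ t s → g s , f t
    ; depthᴬ = λ s → f-depth (g s) ; depthᴮ = λ t → g-depth (f t) }

swap-frame : ∀ {A B mᴬ mᴮ} (f : Frame A B mᴬ mᴮ) → Frame B A mᴮ mᴬ
swap-frame f = record
  { 1≤ℓ = 1≤ℓ ; 1≤ℓ′ = 1≤ℓ′ ; lengthᴬ = lengthᴮ ; lengthᴮ = lengthᴬ
  ; locate = λ s t → locate t s ; depthᴬ = λ t → depthᴮ t ; depthᴮ = λ s → depthᴬ s }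
  where open Frame f

module Courses (δ₁ δ₂ : ℤ²) where

  open Lattice δ₁ δ₂

  along-⊕ : ∀ E u v → along E (u ⊕ v) ≡ along E u ℤ.+ along E v
  along-⊕ west  u v = ℤ.*-distribˡ-+ 1ℤ (proj₁ u) (proj₁ v)
  along-⊕ east  u v = ℤ.*-distribˡ-+ -1ℤ (proj₁ u) (proj₁ v)
  along-⊕ south u v = ℤ.*-distribˡ-+ 1ℤ (proj₂ u) (proj₂ v)
  along-⊕ north u v = ℤ.*-distribˡ-+ -1ℤ (proj₂ u) (proj₂ v)

  along-combination : ∀ E x y → along E (combination x y) ≡ x ℤ.* along E δ₁ ℤ.+ y ℤ.* along E δ₂
  along-combination E x y = trans (cong (orientation E ℤ.*_) (parts (axis E)))
    (identity (orientation E) x y (component (axis E) δ₁) (component (axis E) δ₂))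
    where
    parts : ∀ α → component α (combination x y) ≡ x ℤ.* component α δ₁ ℤ.+ y ℤ.* component α δ₂
    parts westEast   = refl
    parts southNorth = refl
    identity : ∀ σ x y i j → σ ℤ.* (x ℤ.* i ℤ.+ y ℤ.* j) ≡ x ℤ.* (σ ℤ.* i) ℤ.+ y ℤ.* (σ ℤ.* j)
    identity = ℤ-Solver.solve-∀

  -- A walk that advances m γ away from the edge E while drifting sideways, in the
  -- direction of the edge F, by at most about m η.
  record Course (r : ℕ) (E F : Edge) (m γ η : ℕ) : Set where
    field
      walk : Walk
    open Walk walk public
    field
      n      : ℕ
      rises  : ∀ i → 0ℤ ℤ.< along E (step i)
      top    : along E (displacement n) ≡ ℤ.+ (m * γ)
      shift  : ℕ
      drift≥ : ∀ {i} → i ≤ n → 0ℤ ℤ.≤ ℤ.+ shift ℤ.+ along F (displacement i)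
      drift≤ : ∀ {i} → i ≤ n → ℤ.+ shift ℤ.+ along F (displacement i) ℤ.≤ ℤ.+ (m * η + (r + r))

  -- `base` is the depth of the start from `F`. The heights rise from 0 to `m * γ` and so stay in
  -- the grid; the sideways bounds are the hypotheses `low` and `high`.
  module FromCourse {r E F m γ η mᶠ} (E≢F : axis E ≢ axis F) (course : Course r E F m γ η) (f : Frame E F (m * γ) mᶠ)
                    {base : ℕ} where

    open Course course
    open Frame f

    private
      sideways : ℕ → ℤ
      sideways i = ℤ.+ base ℤ.+ along F (displacement i)

      module _ (low : ∀ {i} → i ≤ n → ℤ.+ r ℤ.≤ sideways i)
               (high : ∀ {i} → i ≤ n → sideways i ℤ.+ ℤ.+ r ℤ.≤ ℤ.+ mᶠ) where

        place : ℕ → Cell ℓ ℓ′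
        place i = locate ∣ along E (displacement i) ∣ ∣ sideways i ∣

        along-displacement-suc : ∀ i → along E (displacement (suc i)) ≡ along E (displacement i) ℤ.+ along E (step i)
        along-displacement-suc i = trans (cong (along E) (sym (displacement-suc i))) (along-⊕ E (displacement i) (step i))

        climbs : ∀ i → along E (displacement i) ℤ.≤ along E (displacement (suc i))
        climbs i = subst (along E (displacement i) ℤ.≤_) (sym (along-displacement-suc i))
          (subst (ℤ._≤ along E (displacement i) ℤ.+ along E (step i)) (ℤ.+-identityʳ _) (ℤ.+-monoʳ-≤ (along E (displacement i)) (ℤ.<⇒≤ (rises i))))

        climbs* : ∀ i k → along E (displacement i) ℤ.≤ along E (displacement (k + i))
        climbs* i zero    = ℤ.≤-refl
        climbs* i (suc k) = ℤ.≤-trans (climbs* i k) (climbs (k + i))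

        zero-displacement : ∀ G → along G (displacement 0) ≡ 0ℤ
        zero-displacement G = trans (along-combination G (ℤ.+ ones 0) (ℤ.+ twos 0))
          (cong₂ (λ k l → ℤ.+ k ℤ.* along G δ₁ ℤ.+ ℤ.+ l ℤ.* along G δ₂) ones-0 twos-0)

        height≥0 : ∀ i → 0ℤ ℤ.≤ along E (displacement i)
        height≥0 i = subst₂ ℤ._≤_ (zero-displacement E) (cong (λ k → along E (displacement k)) (ℕ.+-identityʳ i)) (climbs* 0 i)

        height≤ : ∀ {i} → i ≤ n → ∣ along E (displacement i) ∣ ≤ m * γ
        height≤ {i} i≤n = ℤ.drop‿+≤+ (subst₂ ℤ._≤_ (sym (ℤ.0≤i⇒+∣i∣≡i (height≥0 i)))
          (trans (cong (λ k → along E (displacement k)) (ℕ.m∸n+n≡m i≤n)) top) (climbs* i (n ∸ i)))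

        sideways-abs : ∀ {i} → i ≤ n → ℤ.+ ∣ sideways i ∣ ≡ sideways i
        sideways-abs i≤n = ℤ.0≤i⇒+∣i∣≡i (ℤ.≤-trans (ℤ.+≤+ z≤n) (low i≤n))

        sideways+r≤ : ∀ {i} → i ≤ n → ∣ sideways i ∣ + r ≤ mᶠ
        sideways+r≤ i≤n = ℤ.drop‿+≤+ (subst (λ z → z ℤ.+ ℤ.+ r ℤ.≤ ℤ.+ mᶠ) (sym (sideways-abs i≤n)) (high i≤n))

        depth-E : ∀ {i} → i ≤ n → depth E (place i) ≡ ∣ along E (displacement i) ∣
        depth-E i≤n = depthᴬ _ (height≤ i≤n)

        depth-F : ∀ {i} → i ≤ n → depth F (place i) ≡ ∣ sideways i ∣
        depth-F i≤n = depthᴮ _ (ℕ.m+n≤o⇒m≤o _ (sideways+r≤ i≤n))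

    track : (∀ {i} → i ≤ n → ℤ.+ r ℤ.≤ sideways i) → (∀ {i} → i ≤ n → sideways i ℤ.+ ℤ.+ r ℤ.≤ ℤ.+ mᶠ) → Track r {ℓ} {ℓ′} E F
    track low high = record
      { walk   = walk
      ; n      = n
      ; cell   = place low high
      ; offset = λ {i} i≤n → oriented-injective (cong₂ _,_
          (begin
            along F (place low high i -ᶜ place low high 0) ≡⟨ along-difference F (place low high i) (place low high 0) ⟩
            ℤ.+ depth F (place low high i) ℤ.- ℤ.+ depth F (place low high 0)
              ≡⟨ cong₂ ℤ._-_ (trans (cong ℤ.+_ (depth-F low high i≤n)) (sideways-abs low high i≤n))
                             (trans (cong ℤ.+_ (depth-F low high z≤n)) (trans (sideways-abs low high z≤n) (cong (ℤ._+_ (ℤ.+ base)) (zero-displacement low high F)))) ⟩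
            (ℤ.+ base ℤ.+ along F (displacement i)) ℤ.- (ℤ.+ base ℤ.+ 0ℤ) ≡⟨ identity (ℤ.+ base) (along F (displacement i)) ⟩
            along F (displacement i) ∎)
          (begin
            along E (place low high i -ᶜ place low high 0) ≡⟨ along-difference E (place low high i) (place low high 0) ⟩
            ℤ.+ depth E (place low high i) ℤ.- ℤ.+ depth E (place low high 0)
              ≡⟨ cong₂ ℤ._-_ (trans (cong ℤ.+_ (depth-E low high i≤n)) (ℤ.0≤i⇒+∣i∣≡i (height≥0 low high i)))
                             (cong ℤ.+_ (trans (depth-E low high z≤n) (cong ∣_∣ (zero-displacement low high E)))) ⟩
            along E (displacement i) ℤ.- 0ℤ ≡⟨ ℤ.+-identityʳ _ ⟩
            along E (displacement i) ∎))
      ; rises  = rises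
      ; starts = depth⇒on E (trans (depth-E low high z≤n) (cong ∣_∣ (zero-displacement low high E)))
      ; ends   = depth⇒on-opposite E (trans (cong suc (trans (depth-E low high ℕ.≤-refl) (cong ∣_∣ top))) (sym lengthᴬ))
      ; inner  = λ {i} i≤n →
          subst (r ≤_) (sym (depth-F low high i≤n)) (ℤ.drop‿+≤+ (subst (ℤ.+ r ℤ.≤_) (sym (sideways-abs low high i≤n)) (low i≤n))) ,
          subst₂ (λ k l → k + r < l) (sym (depth-F low high i≤n)) (sym lengthᴮ) (s≤s (sideways+r≤ low high i≤n))
      }
      where
      open ≡-Reasoning
      open Oriented E≢F
      identity : ∀ b x → (b ℤ.+ x) ℤ.- (b ℤ.+ 0ℤ) ≡ x
      identity = ℤ-Solver.solve-∀

    track-start : (low : ∀ {i} → i ≤ n → ℤ.+ r ℤ.≤ sideways i) (high : ∀ {i} → i ≤ n → sideways i ℤ.+ ℤ.+ r ℤ.≤ ℤ.+ mᶠ) →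
                  depth E (Track.cell (track low high) 0) ≡ 0 × depth F (Track.cell (track low high) 0) ≡ base
    track-start low high =
      trans (depth-E low high z≤n) (cong ∣_∣ (zero-displacement low high E)) ,
      trans (depth-F low high z≤n) (cong ∣_∣ (trans (cong (ℤ._+_ (ℤ.+ base)) (zero-displacement low high F)) (ℤ.+-identityʳ (ℤ.+ base))))

-- Straight and zigzag courses

negativePart : ℤ → ℕ
negativePart (ℤ.+ _)  = 0
negativePart -[1+ k ] = suc k

-- For negative `z` the start is moved by the whole drift, so that the walk ends at 0 instead of
-- starting there.
linear-drift : ∀ z {i n} → i ≤ n →
  0ℤ ℤ.≤ ℤ.+ (n * negativePart z) ℤ.+ ℤ.+ i ℤ.* z × ℤ.+ (n * negativePart z) ℤ.+ ℤ.+ i ℤ.* z ℤ.≤ ℤ.+ (n * ∣ z ∣)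
linear-drift (ℤ.+ k) {i} {n} i≤n = subst (λ x → 0ℤ ℤ.≤ x × x ℤ.≤ ℤ.+ (n * k)) (sym value)
  (ℤ.+≤+ z≤n , ℤ.+≤+ (ℕ.*-monoˡ-≤ k i≤n))
  where
  value : ℤ.+ (n * 0) ℤ.+ ℤ.+ i ℤ.* ℤ.+ k ≡ ℤ.+ (i * k)
  value = cong₂ ℤ._+_ (cong ℤ.+_ (ℕ.*-zeroʳ n)) (sym (ℤ.pos-* i k))
linear-drift -[1+ k ] {i} {n} i≤n = subst (λ x → 0ℤ ℤ.≤ x × x ℤ.≤ ℤ.+ (n * suc k)) (sym value)
  (ℤ.i≤j⇒0≤j-i (ℤ.+≤+ (ℕ.*-monoˡ-≤ (suc k) i≤n)) , ℤ.i≤j⇒i-k≤j (ℤ.+ (i * suc k)) ℤ.≤-refl)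
  where
  value : ℤ.+ (n * suc k) ℤ.+ ℤ.+ i ℤ.* -[1+ k ] ≡ ℤ.+ (n * suc k) ℤ.- ℤ.+ (i * suc k)
  value = cong (ℤ._+_ (ℤ.+ (n * suc k))) (trans (sym (ℤ.neg-distribʳ-* (ℤ.+ i) (ℤ.+ suc k))) (cong ℤ.-_ (sym (ℤ.pos-* i (suc k)))))

-∣i∣≤i : ∀ i → ℤ.- (ℤ.+ ∣ i ∣) ℤ.≤ i
-∣i∣≤i (ℤ.+ n)    = ℤ.≤-trans (ℤ.neg-mono-≤ (ℤ.+≤+ z≤n)) (ℤ.+≤+ z≤n)
-∣i∣≤i -[1+ n ] = ℤ.≤-refl

i≤∣i∣ : ∀ i → i ℤ.≤ ℤ.+ ∣ i ∣
i≤∣i∣ (ℤ.+ n)    = ℤ.≤-refl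
i≤∣i∣ -[1+ n ] = ℤ.-≤+

⌈/2⌉-cases : ∀ i → ⌈ i /2⌉ ≡ ⌊ i /2⌋ ⊎ ⌈ i /2⌉ ≡ suc ⌊ i /2⌋
⌈/2⌉-cases zero    = inj₁ refl
⌈/2⌉-cases (suc i) = Sum.[_,_]′ (λ e → inj₂ (cong suc (sym e))) (λ e → inj₁ (sym e)) (⌈/2⌉-cases i)

module _ {δ₁ δ₂ : ℤ²} where

  open Lattice δ₁ δ₂
  open Courses δ₁ δ₂

  straight-walk₁ straight-walk₂ zigzag-walk : Walk
  straight-walk₁ = record { ones = λ i → i ; twos = λ _ → 0 ; ones-0 = refl ; twos-0 = refl ; advance = λ _ → inj₁ (refl , refl) }
  straight-walk₂ = record { ones = λ _ → 0 ; twos = λ i → i ; ones-0 = refl ; twos-0 = refl ; advance = λ _ → inj₂ (refl , refl) }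
  zigzag-walk = record { ones = ⌊_/2⌋ ; twos = ⌈_/2⌉ ; ones-0 = refl ; twos-0 = refl ; advance = λ i → alternate i (⌈/2⌉-cases i) }
    where
    alternate : ∀ i → ⌈ i /2⌉ ≡ ⌊ i /2⌋ ⊎ ⌈ i /2⌉ ≡ suc ⌊ i /2⌋ →
                (⌈ i /2⌉ ≡ suc ⌊ i /2⌋ × suc ⌊ i /2⌋ ≡ ⌈ i /2⌉) ⊎ (⌈ i /2⌉ ≡ ⌊ i /2⌋ × suc ⌊ i /2⌋ ≡ suc ⌈ i /2⌉)
    alternate i (inj₁ e) = inj₂ (e , cong suc (sym e))
    alternate i (inj₂ e) = inj₁ (e , sym e)

  straight-course : ∀ {r E F m} (walk : Walk) (δ : ℤ²) → (∀ i → Walk.step walk i ≡ δ) →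
    (∀ G i → along G (Walk.displacement walk i) ≡ ℤ.+ i ℤ.* along G δ) →
    0ℤ ℤ.< along E δ → Course r E F m ∣ along E δ ∣ ∣ along F δ ∣
  straight-course {r} {E} {F} {m} walk δ step≡δ linear 0<δ = record
    { walk   = walk
    ; n      = m
    ; rises  = λ i → subst (λ z → 0ℤ ℤ.< along E z) (sym (step≡δ i)) 0<δ
    ; top    = trans (linear E m) (trans (cong (ℤ.+ m ℤ.*_) (sym (ℤ.0≤i⇒+∣i∣≡i (ℤ.<⇒≤ 0<δ)))) (sym (ℤ.pos-* m ∣ along E δ ∣)))
    ; shift  = m * negativePart (along F δ)
    ; drift≥ = λ {i} i≤m → subst (λ z → 0ℤ ℤ.≤ ℤ.+ (m * negativePart (along F δ)) ℤ.+ z) (sym (linear F i))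
                 (proj₁ (linear-drift (along F δ) i≤m))
    ; drift≤ = λ {i} i≤m → subst (λ z → ℤ.+ (m * negativePart (along F δ)) ℤ.+ z ℤ.≤ ℤ.+ (m * ∣ along F δ ∣ + (r + r))) (sym (linear F i))
                 (ℤ.≤-trans (proj₂ (linear-drift (along F δ) i≤m)) (ℤ.+≤+ (ℕ.m≤m+n _ _)))
    }

  straight-course₁ : ∀ {r E F m} → 0ℤ ℤ.< along E δ₁ → Course r E F m ∣ along E δ₁ ∣ ∣ along F δ₁ ∣
  straight-course₁ = straight-course straight-walk₁ δ₁ (λ _ → refl) λ G i → trans (along-combination G (ℤ.+ i) 0ℤ) (ℤ.+-identityʳ _)

  straight-course₂ : ∀ {r E F m} → 0ℤ ℤ.< along E δ₂ → Course r E F m ∣ along E δ₂ ∣ ∣ along F δ₂ ∣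
  straight-course₂ = straight-course straight-walk₂ δ₂ (λ _ → refl) λ G i → trans (along-combination G 0ℤ (ℤ.+ i)) (ℤ.+-identityˡ _)

  zigzag-course : ∀ {r E F m} → 0ℤ ℤ.< along E δ₁ → 0ℤ ℤ.< along E δ₂ → ∣ along F δ₂ ∣ ≤ r →
    Course r E F m ∣ along E δ₁ ℤ.+ along E δ₂ ∣ ∣ along F δ₁ ℤ.+ along F δ₂ ∣
  zigzag-course {r} {E} {F} {m} 0<δ₁ 0<δ₂ short = record
    { walk   = zigzag-walk
    ; n      = m + m
    ; rises  = λ i → Sum.[_,_]′ (λ e → subst (λ z → 0ℤ ℤ.< along E z) (sym e) 0<δ₁) (λ e → subst (λ z → 0ℤ ℤ.< along E z) (sym e) 0<δ₂)
                       (Walk.step-heavy zigzag-walk i)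
    ; top    = begin
        along E (Walk.displacement zigzag-walk (m + m))
          ≡⟨ cong₂ (λ k l → along E (combination (ℤ.+ k) (ℤ.+ l))) (sym (ℕ.n≡⌊n+n/2⌋ m)) (sym (ℕ.n≡⌈n+n/2⌉ m)) ⟩
        along E (combination (ℤ.+ m) (ℤ.+ m))
          ≡⟨ along-combination E (ℤ.+ m) (ℤ.+ m) ⟩
        ℤ.+ m ℤ.* along E δ₁ ℤ.+ ℤ.+ m ℤ.* along E δ₂
          ≡⟨ ℤ.*-distribˡ-+ (ℤ.+ m) (along E δ₁) (along E δ₂) ⟨
        ℤ.+ m ℤ.* (along E δ₁ ℤ.+ along E δ₂)
          ≡⟨ cong (ℤ.+ m ℤ.*_) (ℤ.0≤i⇒+∣i∣≡i (ℤ.<⇒≤ (ℤ.+-mono-< 0<δ₁ 0<δ₂))) ⟨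
        ℤ.+ m ℤ.* ℤ.+ ∣ along E δ₁ ℤ.+ along E δ₂ ∣
          ≡⟨ ℤ.pos-* m ∣ along E δ₁ ℤ.+ along E δ₂ ∣ ⟨
        ℤ.+ (m * ∣ along E δ₁ ℤ.+ along E δ₂ ∣) ∎
    -- The additional `r` absorbs a single `δ₂` that is not yet balanced by its `δ₁`.
    ; shift  = m * negativePart μ + r
    ; drift≥ = λ {i} i≤ → proj₁ (bounds i i≤)
    ; drift≤ = λ {i} i≤ → proj₂ (bounds i i≤)
    }
    where
    open ≡-Reasoning
    μ = along F δ₁ ℤ.+ along F δ₂
    below : ℤ.- (ℤ.+ r) ℤ.≤ along F δ₂
    below = ℤ.≤-trans (ℤ.neg-mono-≤ (ℤ.+≤+ short)) (-∣i∣≤i (along F δ₂))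
    above : along F δ₂ ℤ.≤ ℤ.+ r
    above = ℤ.≤-trans (i≤∣i∣ (along F δ₂)) (ℤ.+≤+ short)
    -- Every second cell lies on a straight course in the direction δ₁ + δ₂, and the
    -- others are one step δ₂ away from it.
    detour : ∀ i → ∃[ z ] ℤ.- (ℤ.+ r) ℤ.≤ z × z ℤ.≤ ℤ.+ r ×
             along F (Walk.displacement zigzag-walk i) ≡ ℤ.+ ⌊ i /2⌋ ℤ.* μ ℤ.+ z
    detour i with ⌈/2⌉-cases i
    ... | inj₁ e = 0ℤ , ℤ.neg-mono-≤ (ℤ.+≤+ z≤n) , ℤ.+≤+ z≤n ,
      trans (along-combination F (ℤ.+ ⌊ i /2⌋) (ℤ.+ ⌈ i /2⌉))
      (trans (cong (λ k → ℤ.+ ⌊ i /2⌋ ℤ.* along F δ₁ ℤ.+ ℤ.+ k ℤ.* along F δ₂) e) (identity (ℤ.+ ⌊ i /2⌋) (along F δ₁) (along F δ₂)))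
      where
      identity : ∀ x u v → x ℤ.* u ℤ.+ x ℤ.* v ≡ x ℤ.* (u ℤ.+ v) ℤ.+ 0ℤ
      identity = ℤ-Solver.solve-∀
    ... | inj₂ e = along F δ₂ , below , above ,
      trans (along-combination F (ℤ.+ ⌊ i /2⌋) (ℤ.+ ⌈ i /2⌉))
      (trans (cong (λ k → ℤ.+ ⌊ i /2⌋ ℤ.* along F δ₁ ℤ.+ ℤ.+ k ℤ.* along F δ₂) e) (identity (ℤ.+ ⌊ i /2⌋) (along F δ₁) (along F δ₂)))
      where
      identity : ∀ x u v → x ℤ.* u ℤ.+ (1ℤ ℤ.+ x) ℤ.* v ≡ x ℤ.* (u ℤ.+ v) ℤ.+ v
      identity = ℤ-Solver.solve-∀
    bounds : ∀ i → i ≤ m + m →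
      0ℤ ℤ.≤ ℤ.+ (m * negativePart μ + r) ℤ.+ along F (Walk.displacement zigzag-walk i) ×
      ℤ.+ (m * negativePart μ + r) ℤ.+ along F (Walk.displacement zigzag-walk i) ℤ.≤ ℤ.+ (m * ∣ μ ∣ + (r + r))
    bounds i i≤ =
      let z , z≥ , z≤ , eq = detour i
          lower , upper = linear-drift μ {⌊ i /2⌋} {m} (subst (⌊ i /2⌋ ≤_) (sym (ℕ.n≡⌊n+n/2⌋ m)) (ℕ.⌊n/2⌋-mono i≤))
          total : ℤ.+ (m * negativePart μ + r) ℤ.+ along F (Walk.displacement zigzag-walk i) ≡
                  (ℤ.+ (m * negativePart μ) ℤ.+ ℤ.+ ⌊ i /2⌋ ℤ.* μ) ℤ.+ (ℤ.+ r ℤ.+ z)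
          total = trans (cong (ℤ._+_ (ℤ.+ (m * negativePart μ + r))) eq)
                    (identity (ℤ.+ (m * negativePart μ)) (ℤ.+ r) (ℤ.+ ⌊ i /2⌋ ℤ.* μ) z)
      in subst (0ℤ ℤ.≤_) (sym total) (ℤ.+-mono-≤ lower (subst (ℤ._≤ ℤ.+ r ℤ.+ z) (ℤ.+-inverseʳ (ℤ.+ r)) (ℤ.+-monoʳ-≤ (ℤ.+ r) z≥))) ,
         subst (ℤ._≤ ℤ.+ (m * ∣ μ ∣ + (r + r))) (sym total) (ℤ.+-mono-≤ upper (ℤ.+-monoʳ-≤ (ℤ.+ r) z≤))
      where
      identity : ∀ a r x z → a ℤ.+ r ℤ.+ (x ℤ.+ z) ≡ (a ℤ.+ x) ℤ.+ (r ℤ.+ z)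
      identity = ℤ-Solver.solve-∀

-- Starting cells in different cosets

module _ {s₁ t₁ s₂ t₂ : ℤ} where

  private
    D : ℤ
    D = s₁ ℤ.* t₂ ℤ.- t₁ ℤ.* s₂

  -- The linear form with coefficients `f₁`, `f₂` is divisible by `D` on the lattice. If it is
  -- divisible at the given point too, then a unit shift in the coordinate with the indivisible
  -- coefficient destroys divisibility.
  off-lattice-by : ∀ f₁ f₂ → D ∣ᶻ s₁ ℤ.* f₁ ℤ.+ t₁ ℤ.* f₂ → D ∣ᶻ s₂ ℤ.* f₁ ℤ.+ t₂ ℤ.* f₂ →
    ¬ D ∣ᶻ f₁ ⊎ ¬ D ∣ᶻ f₂ → ∀ g h → ∃[ κ ] ∃[ κ′ ] κ ≤ 1 × κ′ ≤ 1 ×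
    (∀ x y → ¬ (ℤ.- (g ℤ.+ ℤ.+ κ) ≡ x ℤ.* s₁ ℤ.+ y ℤ.* s₂ × h ℤ.+ ℤ.+ κ′ ≡ x ℤ.* t₁ ℤ.+ y ℤ.* t₂))
  off-lattice-by f₁ f₂ d₁ d₂ indivisible g h = choose (D ∣? value 0 0) indivisible
    where
    value : ℕ → ℕ → ℤ
    value κ κ′ = ℤ.- (g ℤ.+ ℤ.+ κ) ℤ.* f₁ ℤ.+ (h ℤ.+ ℤ.+ κ′) ℤ.* f₂
    avoids : ∀ {κ κ′} → ¬ D ∣ᶻ value κ κ′ → ∀ x y →
      ¬ (ℤ.- (g ℤ.+ ℤ.+ κ) ≡ x ℤ.* s₁ ℤ.+ y ℤ.* s₂ × h ℤ.+ ℤ.+ κ′ ≡ x ℤ.* t₁ ℤ.+ y ℤ.* t₂)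
    avoids ¬d x y (p , q) = ¬d (subst (D ∣ᶻ_) (sym (trans (cong₂ (λ i j → i ℤ.* f₁ ℤ.+ j ℤ.* f₂) p q) (identity x y s₁ t₁ s₂ t₂ f₁ f₂)))
      (∣m∣n⇒∣m+n (∣n⇒∣m*n x d₁) (∣n⇒∣m*n y d₂)))
      where
      identity : ∀ x y a b c d f g → (x ℤ.* a ℤ.+ y ℤ.* c) ℤ.* f ℤ.+ (x ℤ.* b ℤ.+ y ℤ.* d) ℤ.* g ≡
                 x ℤ.* (a ℤ.* f ℤ.+ b ℤ.* g) ℤ.+ y ℤ.* (c ℤ.* f ℤ.+ d ℤ.* g)
      identity = ℤ-Solver.solve-∀
    choose : Dec (D ∣ᶻ value 0 0) → ¬ D ∣ᶻ f₁ ⊎ ¬ D ∣ᶻ f₂ → ∃[ κ ] ∃[ κ′ ] κ ≤ 1 × κ′ ≤ 1 × _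
    choose (no ¬d) _         = 0 , 0 , z≤n , z≤n , avoids ¬d
    choose (yes d) (inj₁ ¬f) = 1 , 0 , s≤s z≤n , z≤n , avoids λ d′ → ¬f
      (subst (D ∣ᶻ_) (identity g h f₁ f₂) (∣m∣n⇒∣m-n d d′))
      where
      identity : ∀ g h f₁ f₂ → (ℤ.- (g ℤ.+ 0ℤ) ℤ.* f₁ ℤ.+ (h ℤ.+ 0ℤ) ℤ.* f₂) ℤ.- (ℤ.- (g ℤ.+ 1ℤ) ℤ.* f₁ ℤ.+ (h ℤ.+ 0ℤ) ℤ.* f₂) ≡ f₁
      identity = ℤ-Solver.solve-∀
    choose (yes d) (inj₂ ¬f) = 0 , 1 , z≤n , s≤s z≤n , avoids λ d′ → ¬f
      (subst (D ∣ᶻ_) (identity g h f₁ f₂) (∣m∣n⇒∣m-n d′ d))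
      where
      identity : ∀ g h f₁ f₂ → (ℤ.- (g ℤ.+ 0ℤ) ℤ.* f₁ ℤ.+ (h ℤ.+ 1ℤ) ℤ.* f₂) ℤ.- (ℤ.- (g ℤ.+ 0ℤ) ℤ.* f₁ ℤ.+ (h ℤ.+ 0ℤ) ℤ.* f₂) ≡ f₂
      identity = ℤ-Solver.solve-∀

  -- Cramer's rule gives two linear forms that are divisible by D on the lattice
  -- spanned by (s₁ , t₁) and (s₂ , t₂).  If D divided all their coefficients, then
  -- D² would divide D.
  off-lattice : 2 ≤ ∣ D ∣ → ∀ g h → ∃[ κ ] ∃[ κ′ ] κ ≤ 1 × κ′ ≤ 1 ×
    (∀ x y → ¬ (ℤ.- (g ℤ.+ ℤ.+ κ) ≡ x ℤ.* s₁ ℤ.+ y ℤ.* s₂ × h ℤ.+ ℤ.+ κ′ ≡ x ℤ.* t₁ ℤ.+ y ℤ.* t₂))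
  off-lattice 2≤D = by-cases (D ∣? t₂) (D ∣? s₂) (D ∣? t₁) (D ∣? s₁)
    where
    form : ∀ f₁ f₂ k l → s₁ ℤ.* f₁ ℤ.+ t₁ ℤ.* f₂ ≡ k ℤ.* D → s₂ ℤ.* f₁ ℤ.+ t₂ ℤ.* f₂ ≡ l ℤ.* D →
           ¬ D ∣ᶻ f₁ ⊎ ¬ D ∣ᶻ f₂ → _
    form f₁ f₂ k l e e′ = off-lattice-by f₁ f₂ (divides k e) (divides l e′)
    neg : ∀ {i} → ¬ D ∣ᶻ i → ¬ D ∣ᶻ ℤ.- i
    neg {i} ¬d d = ¬d (subst (D ∣ᶻ_) (ℤ.neg-involutive i) (∣m⇒∣-m d))
    first = form t₂ (ℤ.- s₂) 1ℤ 0ℤ (identity₁ s₁ t₁ s₂ t₂) (identity₂ s₁ t₁ s₂ t₂)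
      where
      identity₁ : ∀ a b c d → a ℤ.* d ℤ.+ b ℤ.* (ℤ.- c) ≡ 1ℤ ℤ.* (a ℤ.* d ℤ.- b ℤ.* c)
      identity₁ = ℤ-Solver.solve-∀
      identity₂ : ∀ a b c d → c ℤ.* d ℤ.+ d ℤ.* (ℤ.- c) ≡ 0ℤ ℤ.* (a ℤ.* d ℤ.- b ℤ.* c)
      identity₂ = ℤ-Solver.solve-∀
    second = form (ℤ.- t₁) s₁ 0ℤ 1ℤ (identity₁ s₁ t₁ s₂ t₂) (identity₂ s₁ t₁ s₂ t₂)
      where
      identity₁ : ∀ a b c d → a ℤ.* (ℤ.- b) ℤ.+ b ℤ.* a ≡ 0ℤ ℤ.* (a ℤ.* d ℤ.- b ℤ.* c)
      identity₁ = ℤ-Solver.solve-∀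
      identity₂ : ∀ a b c d → c ℤ.* (ℤ.- b) ℤ.+ d ℤ.* a ≡ 1ℤ ℤ.* (a ℤ.* d ℤ.- b ℤ.* c)
      identity₂ = ℤ-Solver.solve-∀
    by-cases : Dec (D ∣ᶻ t₂) → Dec (D ∣ᶻ s₂) → Dec (D ∣ᶻ t₁) → Dec (D ∣ᶻ s₁) → _
    by-cases (no ¬d) _ _ _ = first (inj₁ ¬d)
    by-cases _ (no ¬d) _ _ = first (inj₂ (neg ¬d))
    by-cases _ _ (no ¬d) _ = second (inj₁ (neg ¬d))
    by-cases _ _ _ (no ¬d) = second (inj₂ ¬d)
    by-cases (yes (divides d e₁)) (yes (divides c e₂)) (yes (divides b e₃)) (yes (divides a e₄)) =
      ⊥-elim (ℕ.<⇒≱ 2≤D (∣⇒≤ (∣⇒∣ᵤ (divides (a ℤ.* d ℤ.- b ℤ.* c) unit))))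
      where
      identity : ∀ a b c d D → (a ℤ.* D) ℤ.* (d ℤ.* D) ℤ.- (b ℤ.* D) ℤ.* (c ℤ.* D) ≡ (a ℤ.* d ℤ.- b ℤ.* c) ℤ.* D ℤ.* D
      identity = ℤ-Solver.solve-∀
      D≢0 : D ≢ 0ℤ
      D≢0 eq = ℕ.n≮0 (subst (λ z → 1 < ∣ z ∣) eq 2≤D)
      unit : 1ℤ ≡ (a ℤ.* d ℤ.- b ℤ.* c) ℤ.* D
      unit = ℤ.*-cancelʳ-≡ 1ℤ _ D {{ℤ.≢-nonZero D≢0}} (trans (ℤ.*-identityˡ D)
        (trans (cong₂ ℤ._-_ (cong₂ ℤ._*_ e₄ e₁) (cong₂ ℤ._*_ e₃ e₂)) (identity a b c d D)))

-- Choice of edges and directions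

face : ∀ α δ → component α δ ≢ 0ℤ → ∃[ E ] axis E ≡ α × 0ℤ ℤ.< along E δ
face α δ i≢0 = lemma α (component α δ) i≢0 refl
  where
  positive : ∀ {k} → 0ℤ ℤ.< 1ℤ ℤ.* (ℤ.+ suc k)
  positive {k} = subst (0ℤ ℤ.<_) (sym (ℤ.*-identityˡ (ℤ.+ suc k))) (ℤ.+<+ (s≤s z≤n))
  negative : ∀ {k} → 0ℤ ℤ.< -1ℤ ℤ.* -[1+ k ]
  negative {k} = subst (0ℤ ℤ.<_) (sym (ℤ.-1*i≡-i -[1+ k ])) (ℤ.+<+ (s≤s z≤n))
  lemma : ∀ α i → component α δ ≢ 0ℤ → component α δ ≡ i → ∃[ E ] axis E ≡ α × 0ℤ ℤ.< along E δ
  lemma _          (ℤ.+ zero)  i≢0 e = ⊥-elim (i≢0 e)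
  lemma westEast   (ℤ.+ suc k) _ e = west  , refl , subst (λ i → 0ℤ ℤ.< 1ℤ ℤ.* i) (sym e) positive
  lemma southNorth (ℤ.+ suc k) _ e = south , refl , subst (λ i → 0ℤ ℤ.< 1ℤ ℤ.* i) (sym e) positive
  lemma westEast   -[1+ k ]    _ e = east  , refl , subst (λ i → 0ℤ ℤ.< -1ℤ ℤ.* i) (sym e) negative
  lemma southNorth -[1+ k ]    _ e = north , refl , subst (λ i → 0ℤ ℤ.< -1ℤ ℤ.* i) (sym e) negative

-- Equal absolute slopes with nonzero determinant mean that `t₁` and `t₂` have opposite signs. They
-- partly cancel, so `∣ t₁ ℤ.+ t₂ ∣` is at most their maximum, whereas `s₁` and `s₂` add up.
flatter : ∀ {s₁ t₁ s₂ t₂} → 0ℤ ℤ.< s₁ → 0ℤ ℤ.< t₁ → 0ℤ ℤ.< s₂ → ∣ s₁ ∣ * ∣ t₂ ∣ ≡ ∣ s₂ ∣ * ∣ t₁ ∣ →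
          s₁ ℤ.* t₂ ℤ.- t₁ ℤ.* s₂ ≢ 0ℤ → ∣ s₁ ∣ * ∣ t₁ ℤ.+ t₂ ∣ < ∣ s₁ ℤ.+ s₂ ∣ * ∣ t₁ ∣
flatter {ℤ.+ a@(suc _)} {ℤ.+ b@(suc _)} {ℤ.+ c@(suc _)} {ℤ.+ d} _ _ _ eq cross≢0 =
  ⊥-elim (cross≢0 (ℤ.i≡j⇒i-j≡0 (begin
    ℤ.+ a ℤ.* ℤ.+ d ≡⟨ ℤ.pos-* a d ⟨
    ℤ.+ (a * d)     ≡⟨ cong ℤ.+_ (trans eq (ℕ.*-comm c b)) ⟩
    ℤ.+ (b * c)     ≡⟨ ℤ.pos-* b c ⟩
    ℤ.+ b ℤ.* ℤ.+ c ∎)))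
  where open ≡-Reasoning
flatter {ℤ.+ a@(suc _)} {ℤ.+ b@(suc _)} {ℤ.+ c@(suc _)} { -[1+ d ]} _ _ _ eq _ = begin-strict
  a * ∣ b ⊖ suc d ∣     ≤⟨ ℕ.*-monoʳ-≤ a (ℤ.∣m⊝n∣≤m⊔n b (suc d)) ⟩
  a * (b ℕ.⊔ suc d)     ≡⟨ ℕ.*-distribˡ-⊔ a b (suc d) ⟩
  a * b ℕ.⊔ a * suc d   ≡⟨ cong (ℕ._⊔_ (a * b)) eq ⟩
  a * b ℕ.⊔ c * b       <⟨ ℕ.⊔-pres-<m (ℕ.m<m+n (a * b) (s≤s z≤n)) (ℕ.m<n+m (c * b) (s≤s z≤n)) ⟩
  a * b + c * b         ≡⟨ ℕ.*-distribʳ-+ b a c ⟨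
  (a + c) * b           ∎
  where open ℕ.≤-Reasoning
flatter {ℤ.+ zero} (ℤ.+<+ ())
flatter {ℤ.+ suc _} {ℤ.+ zero} _ (ℤ.+<+ ())
flatter {ℤ.+ suc _} {ℤ.+ suc _} {ℤ.+ zero} _ _ (ℤ.+<+ ())

-- The two products have equal absolute values but are different, so they have opposite signs.
opposite-signs : ∀ {s₁ t₁ s₂ t₂} → s₁ ℤ.< 0ℤ → 0ℤ ℤ.< s₂ → 0ℤ ℤ.< t₂ → ∣ s₁ ∣ * ∣ t₂ ∣ ≡ ∣ s₂ ∣ * ∣ t₁ ∣ →
                 s₁ ℤ.* t₂ ℤ.- t₁ ℤ.* s₂ ≢ 0ℤ → 0ℤ ℤ.< t₁
opposite-signs {t₁ = ℤ.+ suc _} _ _ _ _ _ = ℤ.+<+ (s≤s z≤n)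
opposite-signs { -[1+ a ]} {ℤ.+ zero} {s₂} {ℤ.+ suc d} _ _ _ eq _ with () ← trans eq (ℕ.*-zeroʳ ∣ s₂ ∣)
opposite-signs { -[1+ a ]} { -[1+ b ]} {ℤ.+ suc c} {ℤ.+ suc d} _ _ _ eq cross≢0 =
  ⊥-elim (cross≢0 (ℤ.i≡j⇒i-j≡0 (cong (λ k → ℤ.- (ℤ.+ k)) (trans eq (ℕ.*-comm (suc c) (suc b))))))
opposite-signs { -[1+ _ ]} {ℤ.+ zero} {_} {ℤ.+ zero} _ _ (ℤ.+<+ ())
opposite-signs { -[1+ _ ]} { -[1+ _ ]} {ℤ.+ suc _} {ℤ.+ zero} _ _ (ℤ.+<+ ())
opposite-signs { -[1+ _ ]} { -[1+ _ ]} {ℤ.+ zero} _ (ℤ.+<+ ())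
opposite-signs {ℤ.+ _} {ℤ.+ zero} (ℤ.+<+ ())
opposite-signs {ℤ.+ _} { -[1+ _ ]} (ℤ.+<+ ())

module _ {P : List ℤ²} (P≢0 : All NonZero² P) {δ₁ δ₂ : ℤ²} (δ₁∈P : δ₁ ∈ P) (δ₂∈P : δ₂ ∈ P)
         (2≤D : 2 ≤ ∣ cross δ₁ δ₂ ∣) {r : ℕ} (short : ∀ E {δ} → δ ∈ P → ∣ along E δ ∣ < r) where

  open Lattice δ₁ δ₂
  open Courses δ₁ δ₂

  private
    D≢0 : cross δ₁ δ₂ ≢ 0ℤ
    D≢0 eq = ℕ.n≮0 (subst (λ z → 1 < ∣ z ∣) eq 2≤D)

    -- The room needed beyond the drift: a margin `r` on either side, the tolerance `r + r` of
    -- `drift≤`, and 1 for the shift `κ` of the start.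
    slack : ℕ
    slack = suc (r + r + (r + r))

  module _ {E F m γ η mᶠ} (course : Course r E F m γ η) (room : m * η + slack ≤ mᶠ) where

    open Course course

    centred-low : ∀ κ {i} → i ≤ n → ℤ.+ r ℤ.≤ ℤ.+ (r + shift + κ) ℤ.+ along F (displacement i)
    centred-low κ {i} i≤n = subst (ℤ.+ r ℤ.≤_) (identity (ℤ.+ r) (ℤ.+ shift) (ℤ.+ κ) (along F (displacement i)))
      (subst (ℤ._≤ ℤ.+ (r + κ) ℤ.+ (ℤ.+ shift ℤ.+ along F (displacement i))) (ℤ.+-identityʳ (ℤ.+ r))
        (ℤ.+-mono-≤ (ℤ.+≤+ (ℕ.m≤m+n r κ)) (drift≥ i≤n)))
      where
      identity : ∀ r s e x → (r ℤ.+ e) ℤ.+ (s ℤ.+ x) ≡ (r ℤ.+ s ℤ.+ e) ℤ.+ x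
      identity = ℤ-Solver.solve-∀

    centred-high : ∀ {κ} → κ ≤ 1 → ∀ {i} → i ≤ n →
                   ℤ.+ (r + shift + κ) ℤ.+ along F (displacement i) ℤ.+ ℤ.+ r ℤ.≤ ℤ.+ mᶠ
    centred-high {κ} κ≤1 {i} i≤n = begin
      ℤ.+ (r + shift + κ) ℤ.+ along F (displacement i) ℤ.+ ℤ.+ r
        ≡⟨ identity (ℤ.+ r) (ℤ.+ shift) (ℤ.+ κ) (along F (displacement i)) ⟩
      (ℤ.+ shift ℤ.+ along F (displacement i)) ℤ.+ ℤ.+ (κ + (r + r))
        ≤⟨ ℤ.+-mono-≤ (drift≤ i≤n) (ℤ.+≤+ (ℕ.+-monoˡ-≤ (r + r) κ≤1)) ⟩
      ℤ.+ (m * η + (r + r) + (1 + (r + r)))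
        ≡⟨ cong ℤ.+_ (regroup (m * η) (r + r)) ⟩
      ℤ.+ (m * η + slack)
        ≤⟨ ℤ.+≤+ room ⟩
      ℤ.+ mᶠ ∎
      where
      open ℤ.≤-Reasoning
      identity : ∀ r s e x → (r ℤ.+ s ℤ.+ e) ℤ.+ x ℤ.+ r ≡ (s ℤ.+ x) ℤ.+ (e ℤ.+ (r ℤ.+ r))
      identity = ℤ-Solver.solve-∀
      regroup : ∀ a b → a + b + (1 + b) ≡ a + suc (b + b)
      regroup = ℕ-Solver.solve-∀

  -- Scales n and m of the two courses are wanted with n α < m γ and m η < n β, both with `k` to
  -- spare. The mediant choice n = k (γ + η), m = k (α + β) makes both gaps equal to k (γ β - α η),
  -- and the second factor is a positive integer.
  room-for : ∀ k α β γ η → α * η < γ * β → k * (γ + η) * α + k ≤ k * (α + β) * γ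
  room-for k α β γ η lt = begin
    k * (γ + η) * α + k         ≡⟨ left k α γ η ⟩
    k * (γ * α + suc (α * η))   ≤⟨ ℕ.*-monoʳ-≤ k (ℕ.+-monoʳ-≤ (γ * α) lt) ⟩
    k * (γ * α + γ * β)         ≡⟨ right k α β γ ⟩
    k * (α + β) * γ             ∎
    where
    open ℕ.≤-Reasoning
    left : ∀ k α γ η → k * (γ + η) * α + k ≡ k * (γ * α + suc (α * η))
    left = ℕ-Solver.solve-∀
    right : ∀ k α β γ → k * (γ * α + γ * β) ≡ k * (α + β) * γ
    right = ℕ-Solver.solve-∀

  room-for′ : ∀ k α β γ η → α * η < γ * β → k * (α + β) * η + k ≤ k * (γ + η) * β
  room-for′ k α β γ η lt = begin
    k * (α + β) * η + k         ≡⟨ left k α β η ⟩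
    k * (β * η + suc (α * η))   ≤⟨ ℕ.*-monoʳ-≤ k (ℕ.+-monoʳ-≤ (β * η) lt) ⟩
    k * (β * η + γ * β)         ≡⟨ right k β γ η ⟩
    k * (γ + η) * β             ∎
    where
    open ℕ.≤-Reasoning
    left : ∀ k α β η → k * (α + β) * η + k ≡ k * (β * η + suc (α * η))
    left = ℕ-Solver.solve-∀
    right : ∀ k β γ η → k * (β * η + γ * β) ≡ k * (γ + η) * β
    right = ℕ-Solver.solve-∀

  -- The numbers of steps make both courses fit into the grid, with enough slack to
  -- keep each of them away from the two edges parallel to it.
  courses⇒crossings : ∀ {A B} → axis A ≢ axis B → ∀ {α β γ η} → α * η < γ * β →
    (∀ n → Course r A B n β α) → (∀ m → Course r B A m γ η) → PrimalNonUniformCrossing P × WeightedCrossing P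
  courses⇒crossings {A} {B} A≢B {α} {β} {γ} {η} lt p-course q-course =
    -- In the coordinates (depth from `B`, depth from `A`) the tracks start at (r + p.shift + κ, 0)
    -- and (0, r + q.shift + κ′), which explains the signs in `off-lattice`.
    let κ , κ′ , κ≤1 , κ′≤1 , avoids = off-lattice {along B δ₁} {along A δ₁} {along B δ₂} {along A δ₂}
          (subst (2 ≤_) (sym (∣cross-oriented∣ δ₁ δ₂)) 2≤D) (ℤ.+ (r + p.shift)) (ℤ.+ (r + q.shift))
        p-track = P.track (centred-low (p-course n) p-room κ) (centred-high (p-course n) p-room κ≤1)
        q-track = Q.track (centred-low (q-course m) q-room κ′) (centred-high (q-course m) q-room κ′≤1)
        p-tᴬ , p-tᴮ = P.track-start (centred-low (p-course n) p-room κ) (centred-high (p-course n) p-room κ≤1)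
        q-tᴮ , q-tᴬ = Q.track-start (centred-low (q-course m) q-room κ′) (centred-high (q-course m) q-room κ′≤1)
        apart : ∀ x y → Track.cell q-track 0 -ᶜ Track.cell p-track 0 ≢ combination x y
        apart x y eq = avoids x y
          ( trans (sym (ℤ.+-identityˡ _)) (coordinate-of B x y q-tᴮ p-tᴮ eq)
          , trans (sym (ℤ.+-identityʳ _)) (coordinate-of A x y q-tᴬ p-tᴬ eq) )
    in (_ , _ , 1≤ℓ , 1≤ℓ′ , tracks⇒primal P≢0 δ₁∈P δ₂∈P D≢0 short A≢B p-track q-track apart)
     , (_ , _ , 1≤ℓ , 1≤ℓ′ , neighborhood , weighted , tracks⇒weighted P≢0 δ₁∈P δ₂∈P D≢0 short A≢B p-track q-track apart)
    where
    open Oriented A≢B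
    open WeightedNeighborhood P≢0 δ₁∈P δ₂∈P using (neighborhood; weighted)
    n = slack * (γ + η)
    m = slack * (α + β)
    p-room : n * α + slack ≤ m * γ
    p-room = room-for slack α β γ η lt
    q-room : m * η + slack ≤ n * β
    q-room = room-for′ slack α β γ η lt
    f = frame A≢B (n * β) (m * γ)
    open Frame f using (1≤ℓ; 1≤ℓ′; ℓ; ℓ′)
    module p = Course (p-course n)
    module q = Course (q-course m)
    module P {base} = FromCourse A≢B (p-course n) f {base}
    module Q {base} = FromCourse (A≢B ∘ sym) (q-course m) (swap-frame f) {base}
    coordinate-of : ∀ G x y {u v : Cell ℓ ℓ′} {k l} → depth G v ≡ k → depth G u ≡ l → v -ᶜ u ≡ combination x y →
                    ℤ.+ k ℤ.- ℤ.+ l ≡ x ℤ.* along G δ₁ ℤ.+ y ℤ.* along G δ₂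
    coordinate-of G x y {u} {v} p q eq = trans (sym (cong₂ (λ i j → ℤ.+ i ℤ.- ℤ.+ j) p q))
      (trans (sym (along-difference G v u)) (trans (cong (along G) eq) (along-combination G x y)))

  private
    crossings : Set
    crossings = PrimalNonUniformCrossing P × WeightedCrossing P

  -- By the inequality `δ₁` is steeper than `δ₂` with respect to the axis `α`, so `δ₁` crosses along
  -- `α` and `δ₂` along `β`. Its strictness also makes the two components nonzero that determine the
  -- edges.
  straight-crossings : ∀ {α β} → α ≢ β →
    ∣ component β δ₁ ∣ * ∣ component α δ₂ ∣ < ∣ component β δ₂ ∣ * ∣ component α δ₁ ∣ → crossings
  straight-crossings {α} {β} α≢β lt =
    let A , A-α , 0<A = face α δ₁ λ e → ℕ.n≮0 (subst (∣ component β δ₁ ∣ * ∣ component α δ₂ ∣ <_)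
          (trans (cong (λ z → ∣ component β δ₂ ∣ * ∣ z ∣) e) (ℕ.*-zeroʳ ∣ component β δ₂ ∣)) lt)
        B , B-β , 0<B = face β δ₂ λ e → ℕ.n≮0 (subst (∣ component β δ₁ ∣ * ∣ component α δ₂ ∣ <_) (cong (λ z → ∣ z ∣ * ∣ component α δ₁ ∣) e) lt)
        lengths : ∀ E γ δ → axis E ≡ γ → ∣ along E δ ∣ ≡ ∣ component γ δ ∣
        lengths E γ δ e = trans (∣along∣ E δ) (cong (λ γ → ∣ component γ δ ∣) e)
    in courses⇒crossings {A} {B} (λ e → α≢β (trans (sym A-α) (trans e B-β)))
         (subst₂ _<_ (cong₂ _*_ (sym (lengths B β δ₁ B-β)) (sym (lengths A α δ₂ A-α)))
                     (cong₂ _*_ (sym (lengths B β δ₂ B-β)) (sym (lengths A α δ₁ A-α))) lt)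
         (λ n → straight-course₁ 0<A) (λ m → straight-course₂ 0<B)

  -- Two straight courses whose slopes have equal absolute values do not fit into one
  -- rectangle, so the second course alternates between δ₁ and δ₂ to become flatter.
  zigzag-crossings : ∀ {A B} → axis A ≢ axis B → 0ℤ ℤ.< along A δ₁ → 0ℤ ℤ.< along B δ₁ → 0ℤ ℤ.< along B δ₂ →
    ∣ along B δ₁ ∣ * ∣ along A δ₂ ∣ ≡ ∣ along B δ₂ ∣ * ∣ along A δ₁ ∣ → crossings
  zigzag-crossings {A} {B} A≢B 0<A₁ 0<B₁ 0<B₂ eq = courses⇒crossings A≢B
    (flatter {along B δ₁} {along A δ₁} {along B δ₂} {along A δ₂} 0<B₁ 0<A₁ 0<B₂ eq
      λ cross≡0 → D≢0 (ℤ.∣i∣≡0⇒i≡0 (trans (sym (Oriented.∣cross-oriented∣ A≢B δ₁ δ₂)) (cong ∣_∣ cross≡0))))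
    (λ n → straight-course₁ 0<A₁) (λ m → zigzag-course 0<B₁ 0<B₂ (ℕ.<⇒≤ (short A δ₂∈P)))

  -- One vanishing component would make both products zero and with them the determinant, so both
  -- vectors point away from an edge on either axis.
  balanced-crossings : ∣ proj₁ δ₁ ∣ * ∣ proj₂ δ₂ ∣ ≡ ∣ proj₁ δ₂ ∣ * ∣ proj₂ δ₁ ∣ → crossings
  balanced-crossings eq =
    let X , X-axis , 0<X = face westEast δ₂ (nonZeroʳ ∘ inj₁)
        Y , Y-axis , 0<Y = face southNorth δ₂ (nonZeroˡ ∘ inj₂)
        S , S-axis , 0<S = face southNorth δ₁ (nonZeroʳ ∘ inj₂)
        W , W-axis , 0<W = face westEast δ₁ (nonZeroˡ ∘ inj₁)
    in by-sign X Y S W X-axis Y-axis S-axis W-axis 0<X 0<Y 0<S 0<W (0ℤ ℤ.<? along X δ₁)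
    where
    vanishing : ∣ proj₁ δ₁ ∣ * ∣ proj₂ δ₂ ∣ ≡ 0 → ⊥
    vanishing e = D≢0 (cong₂ ℤ._-_ {x = proj₁ δ₁ ℤ.* proj₂ δ₂} {u = proj₂ δ₁ ℤ.* proj₁ δ₂}
      (ℤ.∣i∣≡0⇒i≡0 (trans (ℤ.abs-* (proj₁ δ₁) (proj₂ δ₂)) e))
      (ℤ.∣i∣≡0⇒i≡0 (trans (ℤ.abs-* (proj₂ δ₁) (proj₁ δ₂)) (trans (ℕ.*-comm ∣ proj₂ δ₁ ∣ _) (trans (sym eq) e)))))
    nonZeroˡ : ¬ (proj₁ δ₁ ≡ 0ℤ ⊎ proj₂ δ₂ ≡ 0ℤ)
    nonZeroˡ (inj₁ e) = vanishing (cong (λ z → ∣ z ∣ * ∣ proj₂ δ₂ ∣) e)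
    nonZeroˡ (inj₂ e) = vanishing (trans (cong (λ z → ∣ proj₁ δ₁ ∣ * ∣ z ∣) e) (ℕ.*-zeroʳ ∣ proj₁ δ₁ ∣))
    nonZeroʳ : ¬ (proj₁ δ₂ ≡ 0ℤ ⊎ proj₂ δ₁ ≡ 0ℤ)
    nonZeroʳ (inj₁ e) = vanishing (trans eq (cong (λ z → ∣ z ∣ * ∣ proj₂ δ₁ ∣) e))
    nonZeroʳ (inj₂ e) = vanishing (trans eq (trans (cong (λ z → ∣ proj₁ δ₂ ∣ * ∣ z ∣) e) (ℕ.*-zeroʳ ∣ proj₁ δ₂ ∣)))
    lengths : ∀ E {γ} δ → axis E ≡ γ → ∣ along E δ ∣ ≡ ∣ component γ δ ∣
    lengths E δ e = trans (∣along∣ E δ) (cong (λ γ → ∣ component γ δ ∣) e)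
    horizontal≢vertical : westEast ≢ southNorth
    horizontal≢vertical ()
    -- If δ₁ and δ₂ point to opposite sides horizontally, they point to the same side vertically.
    by-sign : ∀ X Y S W → axis X ≡ westEast → axis Y ≡ southNorth → axis S ≡ southNorth → axis W ≡ westEast →
      0ℤ ℤ.< along X δ₂ → 0ℤ ℤ.< along Y δ₂ → 0ℤ ℤ.< along S δ₁ → 0ℤ ℤ.< along W δ₁ → Dec (0ℤ ℤ.< along X δ₁) → crossings
    by-sign X Y S W X-axis Y-axis S-axis W-axis 0<X 0<Y 0<S 0<W (yes 0<X₁) =
      zigzag-crossings {S} {X} (λ e → horizontal≢vertical (trans (sym X-axis) (trans (sym e) S-axis))) 0<S 0<X₁ 0<X
        (trans (cong₂ _*_ (lengths X δ₁ X-axis) (lengths S δ₂ S-axis))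
        (trans eq (sym (cong₂ _*_ (lengths X δ₂ X-axis) (lengths S δ₁ S-axis)))))
    by-sign X Y S W X-axis Y-axis S-axis W-axis 0<X 0<Y 0<S 0<W (no ¬0<X₁) =
      zigzag-crossings {W} {Y} (λ e → horizontal≢vertical (trans (sym W-axis) (trans e Y-axis))) 0<W
        (opposite-signs (ℤ.≤∧≢⇒< (ℤ.≮⇒≥ ¬0<X₁) X₁≢0) 0<X 0<Y
          (trans (cong₂ _*_ (lengths X δ₁ X-axis) (lengths Y δ₂ Y-axis)) (trans eq (sym (cong₂ _*_ (lengths X δ₂ X-axis) (lengths Y δ₁ Y-axis)))))
          λ cross≡0 → D≢0 (ℤ.∣i∣≡0⇒i≡0 (trans (sym (Oriented.∣cross-oriented∣ {Y} {X}
            (λ e → horizontal≢vertical (trans (sym X-axis) (trans (sym e) Y-axis))) δ₁ δ₂)) (cong ∣_∣ cross≡0))))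
        0<Y
        (trans (cong₂ _*_ (lengths Y δ₁ Y-axis) (lengths W δ₂ W-axis))
        (trans (ℕ.*-comm ∣ proj₂ δ₁ ∣ _) (trans (sym eq) (trans (ℕ.*-comm ∣ proj₁ δ₁ ∣ _) (sym (cong₂ _*_ (lengths Y δ₂ Y-axis) (lengths W δ₁ W-axis)))))))
      where
      X₁≢0 : along X δ₁ ≢ 0ℤ
      X₁≢0 e = nonZeroˡ (inj₁ (ℤ.∣i∣≡0⇒i≡0 (trans (sym (lengths X δ₁ X-axis)) (cong ∣_∣ e))))

  all-crossings : crossings
  all-crossings with ℕ.<-cmp (∣ proj₁ δ₁ ∣ * ∣ proj₂ δ₂ ∣) (∣ proj₁ δ₂ ∣ * ∣ proj₂ δ₁ ∣)
  ... | tri< lt _ _ = straight-crossings {southNorth} {westEast} (λ ()) lt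
  ... | tri≈ _ eq _ = balanced-crossings eq
  ... | tri> _ _ gt = straight-crossings {westEast} {southNorth} (λ ())
    (subst₂ _<_ (ℕ.*-comm ∣ proj₁ δ₂ ∣ _) (ℕ.*-comm ∣ proj₁ δ₁ ∣ _) gt)

-- The equivalence through `Spanning`

spanning⇒crossings : ∀ {P} → All NonZero² P → Spanning P → PrimalNonUniformCrossing P × WeightedCrossing P
spanning⇒crossings {P} P≢0 (δ₁ , δ₂ , δ₁∈P , δ₂∈P , 2≤D) =
  all-crossings P≢0 δ₁∈P δ₂∈P 2≤D (proj₂ (short-bound P))

primal⇒spanning : ∀ {P} → PrimalNonUniformCrossing P → Spanning P
primal⇒spanning (_ , _ , _ , _ , _ , primal , _ , _ , _ , A≢B , gate) =
  disjointPaths⇒spanning A≢B (primal⇒disjointPaths primal gate)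

weighted⇒spanning : ∀ {P} → WeightedCrossing P → Spanning P
weighted⇒spanning (_ , _ , _ , _ , _ , (N⊆P , _) , _ , _ , _ , A≢B , gate) =
  disjointPaths⇒spanning A≢B (weighted⇒disjointPaths N⊆P A≢B gate)

theorem1 : (P : List ℤ²) → All NonZero² P → PrimalNonUniformCrossing P ⇔ WeightedCrossing P
theorem1 P P≢0 = mk⇔ (proj₂ ∘ spanning⇒crossings P≢0 ∘ primal⇒spanning)
                     (proj₁ ∘ spanning⇒crossings P≢0 ∘ weighted⇒spanning)
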